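{- Let $\delta$ be a Berkeley cardinal and let $\langle\mathcal{M}_\delta,\mathcal{R}\rangle$ be the associated potentialist system. Then the propositional modal assertions $\varphi(p_0,\dots,p_n)$ that are valid in $\mathcal{M}_\delta$ (that is, valid at every world of $\mathcal{M}_\delta$, with respect to all substitution instances by assertions of the potentialist language $\mathrm{ZF}^\diamond$, with parameters) are exactly the modal assertions belonging to the modal theory S4.2.
   Context: Background theory: ZF (no Axiom of Choice). Berkeley cardinal: a cardinal $\delta$ is Berkeley if for every transitive set $M$ with $\delta\in M$ and every ordinal $\eta<\delta$ there is a non-trivial elementary embedding $j:M\to M$ (of $\langle M,\in\rangle$) with $\eta<\mathrm{crit}(j)<\delta$; non-trivial means $j$ is not the identity on the ordinals. The system: $\mathcal{M}_\delta$ is the class of all transitive sets $M$ with $\delta\in M$ (the "worlds", viewed as structures $\langle M,\in\rangle$). For $M,N\in\mathcal{M}_\delta$, $M\mathcal{R}N$ ("$M$ accesses $N$") iff $M\subseteq N$ and for every elementary embedding $j:N\to N$ (trivial or not), the restriction $j\restriction M$ is an elementary embedding from $M$ to $M$. Potentialist language: $\mathrm{ZF}^\diamond$ is the language of ZF (i.e. $\{\in\}$) augmented with the modal operators $\Diamond,\Box$. Truth at a world $M$ (with parameters from $M$): atomic formulas, connectives and quantifiers are interpreted as usual in $\langle M,\in\rangle$ (quantifiers range over $M$); $\Diamond\varphi$ holds at $M$ iff $\varphi$ holds at some $N\in\mathcal{M}_\delta$ with $M\mathcal{R}N$; $\Box\varphi$ holds at $M$ iff $\varphi$ holds at every $N\in\mathcal{M}_\delta$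 with $M\mathcal{R}N$. Validity: a propositional modal formula $\varphi(p_0,\dots,p_n)$ is valid at $M$ for a class of assertions if every substitution instance $\varphi(\psi_0,\dots,\psi_n)$, with $\psi_i$ in the class, is true at $M$; it is valid in $\mathcal{M}_\delta$ if it is valid at every world. The class of assertions here is all assertions of $\mathrm{ZF}^\diamond$, with parameters from the world. S4 is the closure under modus ponens and necessitation of (together with propositional tautologies) the axioms (K) $\Box(\varphi\to\psi)\to(\Box\varphi\to\Box\psi)$, (Dual) $\neg\Diamond\varphi\leftrightarrow\Box\neg\varphi$, (S) $\Box\varphi\to\varphi$, (4) $\Box\varphi\to\Box\Box\varphi$. S4.2 is obtained from S4 by adding the axiom (.2) $\Diamond\Box\varphi\to\Box\Diamond\varphi$ (with the same closure). -}

module Defs where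

open import Data.Bool.Base using (Bool; true; not; _∧_; _∨_)
open import Data.Fin.Base using (Fin)
open import Data.Nat.Base using (ℕ; zero; suc)
open import Data.Product.Base using (∃; ∃₂; _×_; proj₁)
open import Data.Sum.Base using (_⊎_)
open import Data.Vec.Base using (Vec; _∷_; lookup)
open import Data.Vec.Relation.Unary.All using (All)
open import Function.Bundles using (_⇔_)
open import Level using (0ℓ)
open import Relation.Binary.Core using (Rel)
open import Relation.Binary.PropositionalEquality.Core using (_≡_; _≢_)
open import Relation.Nullary.Negation.Core using (¬_)
open import Relation.Unary using (Pred)

------------------------------------------------------------------------
-- Propositional modal logic

infix  30 ¬ᵐ_ ◇ᵐ_ □ᵐ_
infixr 25 _∧ᵐ_
infixr 24 _∨ᵐ_
infixr 23 _⇒ᵐ_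
infix  22 _⇔ᵐ_

data ModalFormula : Set where
  var              : ℕ → ModalFormula
  ¬ᵐ_ ◇ᵐ_ □ᵐ_      : ModalFormula → ModalFormula
  _∧ᵐ_ _∨ᵐ_ _⇒ᵐ_   : ModalFormula → ModalFormula → ModalFormula

_⇔ᵐ_ : ModalFormula → ModalFormula → ModalFormula
φ ⇔ᵐ ψ = (φ ⇒ᵐ ψ) ∧ᵐ (ψ ⇒ᵐ φ)

-- Boolean value of a modal formula whose maximal subformulas of the form
-- p, ◇ψ, □ψ are treated as propositional atoms.
⟦_⟧ : ModalFormula → (ModalFormula → Bool) → Bool
⟦ var p  ⟧ v = v (var p)
⟦ ◇ᵐ φ   ⟧ v = v (◇ᵐ φ)
⟦ □ᵐ φ   ⟧ v = v (□ᵐ φ)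
⟦ ¬ᵐ φ   ⟧ v = not (⟦ φ ⟧ v)
⟦ φ ∧ᵐ ψ ⟧ v = ⟦ φ ⟧ v ∧ ⟦ ψ ⟧ v
⟦ φ ∨ᵐ ψ ⟧ v = ⟦ φ ⟧ v ∨ ⟦ ψ ⟧ v
⟦ φ ⇒ᵐ ψ ⟧ v = not (⟦ φ ⟧ v) ∨ ⟦ ψ ⟧ v

-- Equivalently, φ is a substitution instance of a propositional tautology.
Tautology : Pred ModalFormula 0ℓ
Tautology φ = ∀ v → ⟦ φ ⟧ v ≡ true

data S4-Axiom : Pred ModalFormula 0ℓ where
  K    : ∀ φ ψ → S4-Axiom (□ᵐ (φ ⇒ᵐ ψ) ⇒ᵐ (□ᵐ φ ⇒ᵐ □ᵐ ψ))
  Dual : ∀ φ → S4-Axiom (¬ᵐ (◇ᵐ φ) ⇔ᵐ □ᵐ (¬ᵐ φ))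
  S    : ∀ φ → S4-Axiom (□ᵐ φ ⇒ᵐ φ)
  Four : ∀ φ → S4-Axiom (□ᵐ φ ⇒ᵐ □ᵐ (□ᵐ φ))

data S4·2-Axiom : Pred ModalFormula 0ℓ where
  s4   : ∀ {φ} → S4-Axiom φ → S4·2-Axiom φ
  Dot2 : ∀ φ → S4·2-Axiom (◇ᵐ (□ᵐ φ) ⇒ᵐ □ᵐ (◇ᵐ φ))

data Derivable (Axiom : Pred ModalFormula 0ℓ) : Pred ModalFormula 0ℓ where
  taut          : ∀ {φ} → Tautology φ → Derivable Axiom φ
  axiom         : ∀ {φ} → Axiom φ → Derivable Axiom φ
  modus-ponens  : ∀ {φ ψ} → Derivable Axiom (φ ⇒ᵐ ψ) → Derivable Axiom φ →
                  Derivable Axiom ψ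
  necessitation : ∀ {φ} → Derivable Axiom φ → Derivable Axiom (□ᵐ φ)

S4·2 : Pred ModalFormula 0ℓ
S4·2 = Derivable S4·2-Axiom

------------------------------------------------------------------------
-- The languages of ZF and ZF◇

data Language : Set where
  zf zf◇ : Language

infix  40 _∈ᶠ_ _≐ᶠ_
infix  30 ¬ᶠ_ ∀ᶠ_ ∃ᶠ_ ◇ᶠ_ □ᶠ_
infixr 25 _∧ᶠ_
infixr 24 _∨ᶠ_
infixr 23 _⇒ᶠ_

-- Formula L n: formulas with at most n free variables, as de Bruijn indices;
-- a quantifier binds index zero.
data Formula : Language → ℕ → Set where
  _∈ᶠ_ _≐ᶠ_      : ∀ {L n} → Fin n → Fin n → Formula L n
  ¬ᶠ_            : ∀ {L n} → Formula L n → Formula L n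
  _∧ᶠ_ _∨ᶠ_ _⇒ᶠ_ : ∀ {L n} → Formula L n → Formula L n → Formula L n
  ∀ᶠ_ ∃ᶠ_        : ∀ {L n} → Formula L (suc n) → Formula L n
  ◇ᶠ_ □ᶠ_        : ∀ {n} → Formula zf◇ n → Formula zf◇ n

substitute : ∀ {n} → ModalFormula → (ℕ → Formula zf◇ n) → Formula zf◇ n
substitute (var p)  Ψ = Ψ p
substitute (¬ᵐ φ)   Ψ = ¬ᶠ substitute φ Ψ
substitute (◇ᵐ φ)   Ψ = ◇ᶠ substitute φ Ψ
substitute (□ᵐ φ)   Ψ = □ᶠ substitute φ Ψ
substitute (φ ∧ᵐ χ) Ψ = substitute φ Ψ ∧ᶠ substitute χ Ψ
substitute (φ ∨ᵐ χ) Ψ = substitute φ Ψ ∨ᶠ substitute χ Ψ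
substitute (φ ⇒ᵐ χ) Ψ = substitute φ Ψ ⇒ᶠ substitute χ Ψ

------------------------------------------------------------------------
-- Models of ZF

Holds : {U : Set} → Rel U 0ℓ → ∀ {n} → Formula zf n → Vec U n → Set
Holds _∈_ (x ∈ᶠ y) ρ = lookup ρ x ∈ lookup ρ y
Holds _∈_ (x ≐ᶠ y) ρ = lookup ρ x ≡ lookup ρ y
Holds _∈_ (¬ᶠ φ)   ρ = ¬ Holds _∈_ φ ρ
Holds _∈_ (φ ∧ᶠ ψ) ρ = Holds _∈_ φ ρ × Holds _∈_ ψ ρ
Holds _∈_ (φ ∨ᶠ ψ) ρ = Holds _∈_ φ ρ ⊎ Holds _∈_ ψ ρ
Holds _∈_ (φ ⇒ᶠ ψ) ρ = Holds _∈_ φ ρ → Holds _∈_ ψ ρ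
Holds _∈_ (∀ᶠ φ)   ρ = ∀ x → Holds _∈_ φ (x ∷ ρ)
Holds _∈_ (∃ᶠ φ)   ρ = ∃ λ x → Holds _∈_ φ (x ∷ ρ)

-- Theorems of ZF are read as statements about an arbitrary model. Separation
-- and replacement range over first-order formulas with parameters only: over
-- arbitrary Agda predicates, excluded middle for types would yield choice
-- functions and hence AC in the model, which refutes Berkeley cardinals.
record ZFModel : Set₁ where
  infix 4 _∈_
  field
    U   : Set
    _∈_ : Rel U 0ℓ

    extensionality : ∀ {x y} → (∀ z → z ∈ x ⇔ z ∈ y) → x ≡ y
    foundation     : ∀ x → (∃ λ z → z ∈ x) →
                     ∃ λ y → y ∈ x × (∀ z → z ∈ x → ¬ z ∈ y)
    pairing        : ∀ x y → ∃ λ p → ∀ z → z ∈ p ⇔ (z ≡ x ⊎ z ≡ y)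
    union          : ∀ x → ∃ λ u → ∀ z → z ∈ u ⇔ (∃ λ y → y ∈ x × z ∈ y)
    powerset       : ∀ x → ∃ λ p → ∀ z → z ∈ p ⇔ (∀ w → w ∈ z → w ∈ x)
    empty          : ∃ λ e → ∀ z → ¬ z ∈ e
    infinity       : ∃ λ w →
                     (∃ λ e → e ∈ w × (∀ z → ¬ z ∈ e)) ×
                     (∀ x → x ∈ w →
                        ∃ λ s → s ∈ w × (∀ z → z ∈ s ⇔ (z ∈ x ⊎ z ≡ x)))
    separation     : ∀ {n} (φ : Formula zf (suc n)) (ρ : Vec U n) x →
                     ∃ λ y → ∀ z → z ∈ y ⇔ (z ∈ x × Holds _∈_ φ (z ∷ ρ))
    replacement    : ∀ {n} (φ : Formula zf (suc (suc n))) (ρ : Vec U n) x →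
                     (∀ a → a ∈ x → ∀ b c → Holds _∈_ φ (a ∷ b ∷ ρ) →
                        Holds _∈_ φ (a ∷ c ∷ ρ) → b ≡ c) →
                     ∃ λ y → ∀ b → b ∈ y ⇔
                       (∃ λ a → a ∈ x × Holds _∈_ φ (a ∷ b ∷ ρ))

module SetTheory (𝓥 : ZFModel) where
  open ZFModel 𝓥

  infix 4 _⊆_
  _⊆_ : Rel U 0ℓ
  x ⊆ y = ∀ z → z ∈ x → z ∈ y

  Transitive : Pred U 0ℓ
  Transitive x = ∀ y → y ∈ x → y ⊆ x

  ∅ : U
  ∅ = proj₁ empty

  ⦅_,_⦆ : U → U → U
  ⦅ x , y ⦆ = proj₁ (pairing x y)

  infixl 6 _∪_
  _∪_ : U → U → U
  x ∪ y = proj₁ (union ⦅ x , y ⦆)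

  ⟨_,_⟩ : U → U → U
  ⟨ x , y ⟩ = ⦅ ⦅ x , x ⦆ , ⦅ x , y ⦆ ⦆

  succ : U → U
  succ x = x ∪ ⦅ x , x ⦆

  ----------------------------------------------------------------------
  -- Functions, ordinals, cardinals

  -- The set f is (the graph of) a function from the class D to the class E.
  record Function (f : U) (D E : Pred U 0ℓ) : Set where
    field
      graph     : ∀ z → z ∈ f → ∃₂ λ x y → D x × E y × z ≡ ⟨ x , y ⟩
      total     : ∀ x → D x → ∃ λ y → ⟨ x , y ⟩ ∈ f
      univalent : ∀ x y y′ → ⟨ x , y ⟩ ∈ f → ⟨ x , y′ ⟩ ∈ f → y ≡ y′

  record Bijection (f a b : U) : Set where
    field
      function   : Function f (_∈ a) (_∈ b)
      injective  : ∀ x x′ y → ⟨ x , y ⟩ ∈ f → ⟨ x′ , y ⟩ ∈ f → x ≡ x′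
      surjective : ∀ y → y ∈ b → ∃ λ x → ⟨ x , y ⟩ ∈ f

  -- k = j ↾ a
  IsRestriction : (j a k : U) → Set
  IsRestriction j a k =
    ∀ z → z ∈ k ⇔ (z ∈ j × (∃₂ λ x y → x ∈ a × z ≡ ⟨ x , y ⟩))

  Ordinal : Pred U 0ℓ
  Ordinal α = Transitive α × (∀ β → β ∈ α → Transitive β)

  Cardinal : Pred U 0ℓ
  Cardinal κ = Ordinal κ × (∀ α → α ∈ κ → ¬ (∃ λ f → Bijection f α κ))

  Inductive : Pred U 0ℓ
  Inductive w = ∅ ∈ w × (∀ x → x ∈ w → succ x ∈ w)

  -- Membership in the ω of the model, which may be nonstandard.
  Nat : Pred U 0ℓ
  Nat n = ∀ w → Inductive w → n ∈ w

  ----------------------------------------------------------------------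
  -- Satisfaction in set structures ⟨M,∈⟩, internal to the model
  --
  -- Elementarity of a set embedding refers to the formulas in the sense of
  -- the model, coded here as sets over the variables v_i (i ∈ ω) with the
  -- primitives ∈, =, ¬, ∧, ∃; for an ω-nonstandard model these are more than
  -- the codes of the formulas in Formula zf.

  numeral : ℕ → U
  numeral zero    = ∅
  numeral (suc n) = succ (numeral n)

  ⌜_∈_⌝ ⌜_≐_⌝ ⌜_∧_⌝ ⌜∃_,_⌝ : U → U → U
  ⌜ i ∈ j ⌝ = ⟨ numeral 0 , ⟨ i , j ⟩ ⟩
  ⌜ i ≐ j ⌝ = ⟨ numeral 1 , ⟨ i , j ⟩ ⟩
  ⌜ f ∧ g ⌝ = ⟨ numeral 3 , ⟨ f , g ⟩ ⟩
  ⌜∃ i , f ⌝ = ⟨ numeral 4 , ⟨ i , f ⟩ ⟩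

  ⌜¬_⌝ : U → U
  ⌜¬ f ⌝ = ⟨ numeral 2 , f ⟩

  record FormulaClosed (X : U) : Set where
    field
      mem : ∀ i j → Nat i → Nat j → ⌜ i ∈ j ⌝ ∈ X
      eq  : ∀ i j → Nat i → Nat j → ⌜ i ≐ j ⌝ ∈ X
      neg : ∀ f → f ∈ X → ⌜¬ f ⌝ ∈ X
      and : ∀ f g → f ∈ X → g ∈ X → ⌜ f ∧ g ⌝ ∈ X
      ex  : ∀ i f → Nat i → f ∈ X → ⌜∃ i , f ⌝ ∈ X

  Code : Pred U 0ℓ
  Code f = ∀ X → FormulaClosed X → f ∈ X

  Assignment : (M s : U) → Set
  Assignment M s = Function s Nat (_∈ M)

  -- t is an assignment into M that agrees with s except possibly at v_i.
  Variant : (M s i t : U) → Set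
  Variant M s i t = Assignment M t ×
    (∀ n → Nat n → n ≢ i → ∀ a → ⟨ n , a ⟩ ∈ t ⇔ ⟨ n , a ⟩ ∈ s)

  -- S is a satisfaction relation for ⟨M,∈⟩: Tarski's clauses.
  record SatisfactionRelation (M S : U) : Set where
    field
      mem : ∀ i j s → Nat i → Nat j → Assignment M s →
            ⟨ ⌜ i ∈ j ⌝ , s ⟩ ∈ S ⇔
            (∃₂ λ a b → ⟨ i , a ⟩ ∈ s × ⟨ j , b ⟩ ∈ s × a ∈ b)
      eq  : ∀ i j s → Nat i → Nat j → Assignment M s →
            ⟨ ⌜ i ≐ j ⌝ , s ⟩ ∈ S ⇔
            (∃₂ λ a b → ⟨ i , a ⟩ ∈ s × ⟨ j , b ⟩ ∈ s × a ≡ b)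
      neg : ∀ f s → Code f → Assignment M s →
            ⟨ ⌜¬ f ⌝ , s ⟩ ∈ S ⇔ (¬ ⟨ f , s ⟩ ∈ S)
      and : ∀ f g s → Code f → Code g → Assignment M s →
            ⟨ ⌜ f ∧ g ⌝ , s ⟩ ∈ S ⇔ (⟨ f , s ⟩ ∈ S × ⟨ g , s ⟩ ∈ S)
      ex  : ∀ i f s → Nat i → Code f → Assignment M s →
            ⟨ ⌜∃ i , f ⌝ , s ⟩ ∈ S ⇔
            (∃ λ t → Variant M s i t × ⟨ f , t ⟩ ∈ S)

  _⊨_[_] : (M f s : U) → Set
  M ⊨ f [ s ] = ∃ λ S → SatisfactionRelation M S × ⟨ f , s ⟩ ∈ S

  -- In elementary, t is the assignment j ∘ s.
  record ElementaryEmbedding (j M N : U) : Set where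
    field
      function   : Function j (_∈ M) (_∈ N)
      elementary : ∀ f s t → Code f → Assignment M s → Assignment N t →
                   (∀ n a b → ⟨ n , a ⟩ ∈ s → ⟨ n , b ⟩ ∈ t → ⟨ a , b ⟩ ∈ j) →
                   M ⊨ f [ s ] ⇔ N ⊨ f [ t ]

  ----------------------------------------------------------------------
  -- Berkeley cardinals

  NonTrivial : (j M : U) → Set
  NonTrivial j M = ∃ λ α → Ordinal α × α ∈ M × ¬ ⟨ α , α ⟩ ∈ j

  IsCriticalPoint : (j M κ : U) → Set
  IsCriticalPoint j M κ = Ordinal κ × κ ∈ M × ¬ ⟨ κ , κ ⟩ ∈ j ×
    (∀ α → α ∈ κ → ⟨ α , α ⟩ ∈ j)

  Berkeley : Pred U 0ℓ
  Berkeley δ = Cardinal δ ×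
    (∀ M → Transitive M → δ ∈ M → ∀ η → η ∈ δ →
       ∃ λ j → ElementaryEmbedding j M M × NonTrivial j M ×
       (∃ λ κ → IsCriticalPoint j M κ × η ∈ κ × κ ∈ δ))

  ----------------------------------------------------------------------
  -- The potentialist system ⟨𝓜_δ,𝓡⟩

  module Potentialism (δ : U) where

    record World : Set where
      field
        set        : U
        transitive : Transitive set
        δ∈set      : δ ∈ set

    open World public using (set)

    infix 4 _𝓡_
    _𝓡_ : Rel World 0ℓ
    M 𝓡 N = set M ⊆ set N ×
      (∀ j k → ElementaryEmbedding j (set N) (set N) →
         IsRestriction j (set M) k → ElementaryEmbedding k (set M) (set M))

    -- Intended for environments ρ consisting of elements of the world.
    _⊩_[_] : ∀ {n} → World → Formula zf◇ n → Vec U n → Set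
    M ⊩ x ∈ᶠ y [ ρ ] = lookup ρ x ∈ lookup ρ y
    M ⊩ x ≐ᶠ y [ ρ ] = lookup ρ x ≡ lookup ρ y
    M ⊩ ¬ᶠ φ [ ρ ]   = ¬ (M ⊩ φ [ ρ ])
    M ⊩ φ ∧ᶠ ψ [ ρ ] = (M ⊩ φ [ ρ ]) × (M ⊩ ψ [ ρ ])
    M ⊩ φ ∨ᶠ ψ [ ρ ] = (M ⊩ φ [ ρ ]) ⊎ (M ⊩ ψ [ ρ ])
    M ⊩ φ ⇒ᶠ ψ [ ρ ] = (M ⊩ φ [ ρ ]) → (M ⊩ ψ [ ρ ])
    M ⊩ ∀ᶠ φ [ ρ ]   = ∀ x → x ∈ set M → M ⊩ φ [ x ∷ ρ ]
    M ⊩ ∃ᶠ φ [ ρ ]   = ∃ λ x → x ∈ set M × (M ⊩ φ [ x ∷ ρ ])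
    M ⊩ ◇ᶠ φ [ ρ ]   = ∃ λ N → M 𝓡 N × (N ⊩ φ [ ρ ])
    M ⊩ □ᶠ φ [ ρ ]   = ∀ N → M 𝓡 N → N ⊩ φ [ ρ ]

    -- The finitely many parameters of a substitution instance are collected
    -- in one vector ρ shared by all the ψ_i.
    ValidAt : World → Pred ModalFormula 0ℓ
    ValidAt M φ = ∀ {n} (Ψ : ℕ → Formula zf◇ n) (ρ : Vec U n) →
      All (_∈ set M) ρ → M ⊩ substitute φ Ψ [ ρ ]

    Valid : Pred ModalFormula 0ℓ
    Valid φ = ∀ M → ValidAt M φ

{-# OPTIONS --safe #-}
module Submission where

open import Axiom.ExcludedMiddle using (ExcludedMiddle)
open import Data.Bool.Base using (Bool; true; false; not; _∧_; _∨_)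
open import Data.Empty using (⊥-elim)
open import Data.Fin.Base using (Fin; zero; suc; toℕ; _↑ˡ_; _↑ʳ_; lift)
open import Data.Fin.Properties using (toℕ-injective; toℕ<n)
open import Data.Nat.Base using (ℕ; zero; suc; _+_; _<_; z≤n; s≤s)
open import Data.Nat.Properties using (m≤n⇒m<n∨m≡n)
open import Data.Product.Base using (∃; ∃₂; _×_; _,_; proj₁; proj₂)
open import Data.Sum.Base using (_⊎_; inj₁; inj₂; [_,_]′) renaming (map to map-⊎)
open import Function.Base using (_∘_; case_of_)
open import Function.Bundles using (_⇔_; mk⇔; Equivalence)
open import Function.Properties.Equivalence using (⇔-isEquivalence)
open import Level using (0ℓ)
open import Relation.Binary.PropositionalEquality
  using (_≡_; _≢_; refl; sym; trans; cong; subst; subst₂)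
open import Relation.Binary.Structures using (IsEquivalence)
open import Relation.Nullary using (¬_; Dec; yes; no; does; proof; Reflects; invert)
open import Relation.Nullary.Decidable using (decidable-stable)
open import Relation.Nullary.Reflects using (¬-reflects; _×-reflects_; _⊎-reflects_; _→-reflects_)
open import Defs

open Equivalence using (to; from)
open IsEquivalence (⇔-isEquivalence {0ℓ}) using () renaming (sym to ⇔-sym; trans to ⇔-trans)

-- Soundness amounts to 𝓡 being a directed preorder. A world M is 𝓡-below every world P that
-- contains M as an element fixed by all elementary embeddings j : P → P: by induction on the
-- codes, truth in M is expressible in P with M as a parameter, so j ↾ M is elementary. An upper
-- bound of M and N is the transitive closure of {⟨M,N⟩}, in which ⟨M,N⟩ is definable as the only
-- element that belongs to no other element.
--
-- Conversely, a formula that is not provable in S4.2 fails at the root of a finite preorder with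
-- a least and a greatest point. Extending a world N by the sets N and {N,δᵤ}, where the δᵤ are the
-- finite successors of δ, is an 𝓡-step that pushes a button labelled u for good. It also records u
-- as the type of the set that belongs to no other set of the new world, which acts as a switch.
-- If the pushed buttons form a chain, they determine the cluster of its maximum, otherwise the
-- top cluster; the switch selects a point of the cluster. This labels the extensions of an
-- initial world by the points of the preorder in such a way that 𝓡 and the preorder correspond
-- (a bisimulation), and every propositional valuation is definable from the buttons and the switch.

-- Separation and replacement accept only first-order formulas, and elementarity speaks of codes,
-- which may be nonstandard. Hence every induction on codes runs inside the model, on a predicate
-- that carries a defining formula, and satisfaction in a set must first be constructed as a set.
-- The finite preorder, in contrast, lives outside the model: its points are finitely many in the
-- standard sense, so that a valuation on it becomes an actual formula by a finite case distinction.
--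
-- About an elementary embedding nothing is known in advance. All control over it comes from a point
-- that the new world defines without parameters; from this fixed point the argument descends along
-- membership to the old world. In particular nothing is assumed about where an embedding sends the
-- δᵤ, although the formulas of the potentialist language may use them as parameters.

module ModalLogic where

  open import Data.Bool.Base using (T)
  open import Data.Bool.Properties using (T-≡)
  open import Data.List.Base using (List; []; _∷_; _++_; map; filter; length; lookup)
  open import Data.List.Membership.Propositional using () renaming (_∈_ to _∈ˡ_)
  open import Data.List.Membership.Propositional.Properties
    using (∈-++⁺ˡ; ∈-++⁺ʳ; ∈-++⁻; ∈-map⁺; ∈-map⁻; ∈-filter⁺; ∈-filter⁻; ∈-lookup)
  open import Data.List.Relation.Unary.Any using (here; there; index)
  open import Data.List.Relation.Unary.Any.Properties using (lookup-index)

  -- Propositional reasoning and derived rules of S4.2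

  infixr 4 _⇒ᵇ_
  _⇒ᵇ_ : Bool → Bool → Bool
  x ⇒ᵇ y = not x ∨ y

  ∀ᵇ : (Bool → Bool) → Bool
  ∀ᵇ f = f true ∧ f false

  ∀ᵇ-elim : ∀ f → T (∀ᵇ f) → ∀ x → T (f x)
  ∀ᵇ-elim f t true  with f true
  ... | true = _
  ∀ᵇ-elim f t false with f true | f false
  ... | true | true = _

  -- For a concrete schema `T (∀ᵇ f)` evaluates to the unit type, so the truth table is checked by
  -- computation and the argument is just `_`. The Boolean variables stand for the values of the
  -- schematic letters.
  taut₁ : ∀ (f : Bool → Bool) → T (∀ᵇ f) → ∀ x → f x ≡ true
  taut₁ f t x = to T-≡ (∀ᵇ-elim f t x)

  taut₂ : ∀ (f : Bool → Bool → Bool) → T (∀ᵇ λ x → ∀ᵇ (f x)) → ∀ x y → f x y ≡ true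
  taut₂ f t x = taut₁ (f x) (∀ᵇ-elim (λ x → ∀ᵇ (f x)) t x)

  taut₃ : ∀ (f : Bool → Bool → Bool → Bool) → T (∀ᵇ λ x → ∀ᵇ λ y → ∀ᵇ (f x y)) → ∀ x y z → f x y z ≡ true
  taut₃ f t x = taut₂ (f x) (∀ᵇ-elim (λ x → ∀ᵇ λ y → ∀ᵇ (f x y)) t x)

  infix 3 ⊢_ _⊢_
  ⊢_ : ModalFormula → Set
  ⊢ φ = S4·2 φ

  -- A provable implication, not derivability from a premise: necessitation never boxes the left
  -- side, which can thus play the role of a world.
  _⊢_ : ModalFormula → ModalFormula → Set
  c ⊢ φ = ⊢ (c ⇒ᵐ φ)

  opaque
    ⊢-refl : ∀ {a} → a ⊢ a
    ⊢-refl {a} = taut λ v → taut₁ (λ x → x ⇒ᵇ x) _ (⟦ a ⟧ v)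

    weaken : ∀ {c a} → ⊢ a → c ⊢ a
    weaken {c} {a} = modus-ponens (taut λ v → taut₂ (λ x y → x ⇒ᵇ y ⇒ᵇ x) _ (⟦ a ⟧ v) (⟦ c ⟧ v))

    infixl 5 _·_
    _·_ : ∀ {c a b} → c ⊢ (a ⇒ᵐ b) → c ⊢ a → c ⊢ b
    _·_ {c} {a} {b} p = modus-ponens (modus-ponens (taut λ v →
      taut₃ (λ x y z → (x ⇒ᵇ y ⇒ᵇ z) ⇒ᵇ (x ⇒ᵇ y) ⇒ᵇ x ⇒ᵇ z) _ (⟦ c ⟧ v) (⟦ a ⟧ v) (⟦ b ⟧ v)) p)

    ⊢-trans : ∀ {a b c} → a ⊢ b → b ⊢ c → a ⊢ c
    ⊢-trans p q = weaken q · p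

    ∧-intro : ∀ {c a b} → c ⊢ a → c ⊢ b → c ⊢ (a ∧ᵐ b)
    ∧-intro {c} {a} {b} p q = weaken (taut λ v →
      taut₂ (λ x y → x ⇒ᵇ y ⇒ᵇ (x ∧ y)) _ (⟦ a ⟧ v) (⟦ b ⟧ v)) · p · q

    ∧-elim₁ : ∀ {a b} → (a ∧ᵐ b) ⊢ a
    ∧-elim₁ {a} {b} = taut λ v → taut₂ (λ x y → (x ∧ y) ⇒ᵇ x) _ (⟦ a ⟧ v) (⟦ b ⟧ v)

    ∧-elim₂ : ∀ {a b} → (a ∧ᵐ b) ⊢ b
    ∧-elim₂ {a} {b} = taut λ v → taut₂ (λ x y → (x ∧ y) ⇒ᵇ y) _ (⟦ a ⟧ v) (⟦ b ⟧ v)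

    ∨-intro₁ : ∀ {a b} → a ⊢ (a ∨ᵐ b)
    ∨-intro₁ {a} {b} = taut λ v → taut₂ (λ x y → x ⇒ᵇ (x ∨ y)) _ (⟦ a ⟧ v) (⟦ b ⟧ v)

    ∨-intro₂ : ∀ {a b} → b ⊢ (a ∨ᵐ b)
    ∨-intro₂ {a} {b} = taut λ v → taut₂ (λ x y → y ⇒ᵇ (x ∨ y)) _ (⟦ a ⟧ v) (⟦ b ⟧ v)

    ¬∨-intro : ∀ {c a b} → c ⊢ (¬ᵐ a) → c ⊢ (¬ᵐ b) → c ⊢ (¬ᵐ (a ∨ᵐ b))
    ¬∨-intro {c} {a} {b} p q = weaken (taut λ v →
      taut₂ (λ x y → not x ⇒ᵇ not y ⇒ᵇ not (x ∨ y)) _ (⟦ a ⟧ v) (⟦ b ⟧ v)) · p · q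

    ⇒-intro₁ : ∀ {a b} → (¬ᵐ a) ⊢ (a ⇒ᵐ b)
    ⇒-intro₁ {a} {b} = taut λ v → taut₂ (λ x y → not x ⇒ᵇ x ⇒ᵇ y) _ (⟦ a ⟧ v) (⟦ b ⟧ v)

    ⇒-intro₂ : ∀ {a b} → b ⊢ (a ⇒ᵐ b)
    ⇒-intro₂ {a} {b} = taut λ v → taut₂ (λ x y → y ⇒ᵇ x ⇒ᵇ y) _ (⟦ a ⟧ v) (⟦ b ⟧ v)

    contrapositive : ∀ {a b} → a ⊢ b → (¬ᵐ b) ⊢ (¬ᵐ a)
    contrapositive {a} {b} = modus-ponens (taut λ v →
      taut₂ (λ x y → (x ⇒ᵇ y) ⇒ᵇ not y ⇒ᵇ not x) _ (⟦ a ⟧ v) (⟦ b ⟧ v))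

    ¬¬-intro : ∀ {a} → a ⊢ (¬ᵐ ¬ᵐ a)
    ¬¬-intro {a} = taut λ v → taut₁ (λ x → x ⇒ᵇ not (not x)) _ (⟦ a ⟧ v)

    ¬¬-elim : ∀ {a} → (¬ᵐ ¬ᵐ a) ⊢ a
    ¬¬-elim {a} = taut λ v → taut₁ (λ x → not (not x) ⇒ᵇ x) _ (⟦ a ⟧ v)

    explosion : ∀ {c a} → c ⊢ a → c ⊢ (¬ᵐ a) → ⊢ (¬ᵐ c)
    explosion {c} {a} p q = modus-ponens (modus-ponens (taut λ v →
      taut₂ (λ x y → (x ⇒ᵇ y) ⇒ᵇ (x ⇒ᵇ not y) ⇒ᵇ not x) _ (⟦ c ⟧ v) (⟦ a ⟧ v)) p) q

    ¬-cases : ∀ {c a} → ⊢ (¬ᵐ (c ∧ᵐ a)) → ⊢ (¬ᵐ (c ∧ᵐ ¬ᵐ a)) → ⊢ (¬ᵐ c)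
    ¬-cases {c} {a} p q = modus-ponens (modus-ponens (taut λ v →
      taut₂ (λ x y → not (x ∧ y) ⇒ᵇ not (x ∧ not y) ⇒ᵇ not x) _ (⟦ c ⟧ v) (⟦ a ⟧ v)) p) q

    □-mono : ∀ {a b} → a ⊢ b → (□ᵐ a) ⊢ (□ᵐ b)
    □-mono p = modus-ponens (axiom (s4 (K _ _))) (necessitation p)

    □-app : ∀ {c a b} → c ⊢ (□ᵐ (a ⇒ᵐ b)) → c ⊢ (□ᵐ a) → c ⊢ (□ᵐ b)
    □-app p q = weaken (axiom (s4 (K _ _))) · p · q

    □-∧ : ∀ {c a b} → c ⊢ (□ᵐ a) → c ⊢ (□ᵐ b) → c ⊢ (□ᵐ (a ∧ᵐ b))
    □-∧ {a = a} {b} p q = □-app (⊢-trans p (□-mono {a = a} (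
      taut λ v → taut₂ (λ x y → x ⇒ᵇ y ⇒ᵇ (x ∧ y)) _ (⟦ a ⟧ v) (⟦ b ⟧ v)))) q

    □-elim : ∀ {a} → (□ᵐ a) ⊢ a
    □-elim = axiom (s4 (S _))

    □-dup : ∀ {a} → (□ᵐ a) ⊢ (□ᵐ □ᵐ a)
    □-dup = axiom (s4 (Four _))

    ¬◇⇒□¬ : ∀ {a} → (¬ᵐ ◇ᵐ a) ⊢ (□ᵐ ¬ᵐ a)
    ¬◇⇒□¬ = modus-ponens ∧-elim₁ (axiom (s4 (Dual _)))

    □¬⇒¬◇ : ∀ {a} → (□ᵐ ¬ᵐ a) ⊢ (¬ᵐ ◇ᵐ a)
    □¬⇒¬◇ = modus-ponens ∧-elim₂ (axiom (s4 (Dual _)))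

    ◇⇒¬□¬ : ∀ {a} → (◇ᵐ a) ⊢ (¬ᵐ □ᵐ ¬ᵐ a)
    ◇⇒¬□¬ = ⊢-trans ¬¬-intro (contrapositive □¬⇒¬◇)

    ¬□¬⇒◇ : ∀ {a} → (¬ᵐ □ᵐ ¬ᵐ a) ⊢ (◇ᵐ a)
    ¬□¬⇒◇ = ⊢-trans (contrapositive ¬◇⇒□¬) ¬¬-elim

    ◇-mono : ∀ {a b} → a ⊢ b → (◇ᵐ a) ⊢ (◇ᵐ b)
    ◇-mono p = ⊢-trans ◇⇒¬□¬ (⊢-trans (contrapositive (□-mono (contrapositive p))) ¬□¬⇒◇)

    ◇-intro : ∀ {a} → a ⊢ (◇ᵐ a)
    ◇-intro = ⊢-trans ¬¬-intro (⊢-trans (contrapositive □-elim) ¬□¬⇒◇)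

    ◇◇⇒◇ : ∀ {a} → (◇ᵐ ◇ᵐ a) ⊢ (◇ᵐ a)
    ◇◇⇒◇ = ⊢-trans ◇⇒¬□¬ (⊢-trans (contrapositive (⊢-trans □-dup (□-mono □¬⇒¬◇))) ¬□¬⇒◇)

    ¬□⇒◇¬ : ∀ {a} → (¬ᵐ □ᵐ a) ⊢ (◇ᵐ ¬ᵐ a)
    ¬□⇒◇¬ = ⊢-trans (contrapositive (□-mono ¬¬-elim)) ¬□¬⇒◇

    ◇¬⇒¬□ : ∀ {a} → (◇ᵐ ¬ᵐ a) ⊢ (¬ᵐ □ᵐ a)
    ◇¬⇒¬□ = ⊢-trans ◇⇒¬□¬ (contrapositive (□-mono ¬¬-intro))

    modus-tollens : ∀ {c a b} → c ⊢ (a ⇒ᵐ b) → c ⊢ (¬ᵐ b) → c ⊢ (¬ᵐ a)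
    modus-tollens {c} {a} {b} p q = weaken (taut λ v →
      taut₂ (λ x y → (x ⇒ᵇ y) ⇒ᵇ not y ⇒ᵇ not x) _ (⟦ a ⟧ v) (⟦ b ⟧ v)) · p · q

    ◇-∧ : ∀ {c a b} → c ⊢ (□ᵐ a) → c ⊢ (◇ᵐ b) → c ⊢ (◇ᵐ (a ∧ᵐ b))
    ◇-∧ {c} {a} {b} p q = ⊢-trans (modus-tollens (⊢-trans p (⊢-trans (□-mono (taut λ v →
      taut₂ (λ x y → x ⇒ᵇ not (x ∧ y) ⇒ᵇ not y) _ (⟦ a ⟧ v) (⟦ b ⟧ v)))
      (axiom (s4 (K _ _))))) (⊢-trans q ◇⇒¬□¬)) ¬□¬⇒◇

    -- This is how (.2) enters completeness. It turns `◇□□a` into `□◇□a`, which meets `◇□□b` at a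
    -- point with `◇□a` and `□□b`; one further step from there reaches `□a` and `□b` together.
    ◇□-∧ : ∀ {c a b} → c ⊢ (◇ᵐ □ᵐ a) → c ⊢ (◇ᵐ □ᵐ b) → c ⊢ (◇ᵐ □ᵐ (a ∧ᵐ b))
    ◇□-∧ p q = ⊢-trans
      (◇-∧ (⊢-trans p (⊢-trans (◇-mono □-dup) (axiom (Dot2 _)))) (⊢-trans q (◇-mono □-dup)))
      (⊢-trans (◇-mono (◇-∧ ∧-elim₂ ∧-elim₁)) (⊢-trans ◇◇⇒◇ (◇-mono (□-∧ ∧-elim₂ ∧-elim₁))))

  -- Finite state descriptions

  Consistent : ModalFormula → Set
  Consistent c = ¬ (⊢ ¬ᵐ c)

  Decides : ModalFormula → ModalFormula → Set
  Decides c a = c ⊢ a ⊎ c ⊢ (¬ᵐ a)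

  decides-strengthen : ∀ {c d a} → d ⊢ c → Decides c a → Decides d a
  decides-strengthen p (inj₁ q) = inj₁ (⊢-trans p q)
  decides-strengthen p (inj₂ q) = inj₂ (⊢-trans p q)

  subformulas : ModalFormula → List ModalFormula
  subformulas (var p)  = var p ∷ []
  subformulas (¬ᵐ φ)   = ¬ᵐ φ ∷ subformulas φ
  -- ◇ φ is evaluated as ¬ □ ¬ φ, so that only boxed formulas determine the accessibility relation.
  subformulas (◇ᵐ φ)   = ◇ᵐ φ ∷ □ᵐ ¬ᵐ φ ∷ subformulas φ
  subformulas (□ᵐ φ)   = □ᵐ φ ∷ subformulas φ
  subformulas (φ ∧ᵐ ψ) = (φ ∧ᵐ ψ) ∷ subformulas φ ++ subformulas ψ
  subformulas (φ ∨ᵐ ψ) = (φ ∨ᵐ ψ) ∷ subformulas φ ++ subformulas ψ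
  subformulas (φ ⇒ᵐ ψ) = (φ ⇒ᵐ ψ) ∷ subformulas φ ++ subformulas ψ

  self∈subformulas : ∀ φ → φ ∈ˡ subformulas φ
  self∈subformulas (var p)  = here refl
  self∈subformulas (¬ᵐ φ)   = here refl
  self∈subformulas (◇ᵐ φ)   = here refl
  self∈subformulas (□ᵐ φ)   = here refl
  self∈subformulas (φ ∧ᵐ ψ) = here refl
  self∈subformulas (φ ∨ᵐ ψ) = here refl
  self∈subformulas (φ ⇒ᵐ ψ) = here refl

  -- All conjunctions that contain each formula of the list either plain or negated. The tautology
  -- in the base case stands for the empty conjunction.
  atoms : List ModalFormula → List ModalFormula
  atoms []      = (var 0 ⇒ᵐ var 0) ∷ []
  atoms (x ∷ l) = map (x ∧ᵐ_) (atoms l) ++ map ((¬ᵐ x) ∧ᵐ_) (atoms l)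

  atom-decides : ∀ l {a x} → a ∈ˡ atoms l → x ∈ˡ l → Decides a x
  atom-decides (y ∷ l) a∈ x∈ with ∈-++⁻ (map (y ∧ᵐ_) (atoms l)) a∈
  atom-decides (y ∷ l) a∈ (here refl) | inj₁ p with ∈-map⁻ _ p
  ... | b , b∈ , refl = inj₁ ∧-elim₁
  atom-decides (y ∷ l) a∈ (there x∈)  | inj₁ p with ∈-map⁻ _ p
  ... | b , b∈ , refl = decides-strengthen ∧-elim₂ (atom-decides l b∈ x∈)
  atom-decides (y ∷ l) a∈ (here refl) | inj₂ p with ∈-map⁻ _ p
  ... | b , b∈ , refl = inj₂ ∧-elim₁
  atom-decides (y ∷ l) a∈ (there x∈)  | inj₂ p with ∈-map⁻ _ p
  ... | b , b∈ , refl = decides-strengthen ∧-elim₂ (atom-decides l b∈ x∈)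

  decided-atom : ∀ l {c} → (∀ {x} → x ∈ˡ l → Decides c x) → ∃ λ a → a ∈ˡ atoms l × c ⊢ a
  decided-atom []      d = _ , here refl , weaken ⊢-refl
  decided-atom (x ∷ l) d with decided-atom l (d ∘ there) | d (here refl)
  ... | a , a∈ , p | inj₁ q = _ , ∈-++⁺ˡ (∈-map⁺ (x ∧ᵐ_) a∈) , ∧-intro q p
  ... | a , a∈ , p | inj₂ q = _ , ∈-++⁺ʳ (map (x ∧ᵐ_) (atoms l)) (∈-map⁺ ((¬ᵐ x) ∧ᵐ_) a∈) , ∧-intro q p

  -- The disjunction of all atoms is provable; this is used without ever writing the disjunction, by
  -- merging under the box the two cases for one formula of the list at a time.
  □-atoms : ∀ l {c η} → (∀ {a} → a ∈ˡ atoms l → c ⊢ (□ᵐ (a ⇒ᵐ η))) → c ⊢ (□ᵐ η)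
  □-atoms []          p = □-app (p (here refl)) (weaken (necessitation ⊢-refl))
  □-atoms (x ∷ l) {c} {η} p = □-atoms l λ {a} a∈ → □-app (□-app (weaken (necessitation (taut λ v →
      taut₃ (λ x y z → ((x ∧ y) ⇒ᵇ z) ⇒ᵇ ((not x ∧ y) ⇒ᵇ z) ⇒ᵇ y ⇒ᵇ z) _ (⟦ x ⟧ v) (⟦ a ⟧ v) (⟦ η ⟧ v))))
      (p (∈-++⁺ˡ (∈-map⁺ (x ∧ᵐ_) a∈))))
      (p (∈-++⁺ʳ (map (x ∧ᵐ_) (atoms l)) (∈-map⁺ ((¬ᵐ x) ∧ᵐ_) a∈)))

  record DirectedModel : Set₁ where
    field
      size          : ℕ
      _≼_           : Fin size → Fin size → Set
      ≼-refl        : ∀ {u} → u ≼ u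
      ≼-trans       : ∀ {u v w} → u ≼ v → v ≼ w → u ≼ w
      root          : Fin size
      root-least    : ∀ u → root ≼ u
      top           : Fin size
      top-greatest  : ∀ u → u ≼ top
      valuation     : Fin size → ℕ → Set

    Sat : Fin size → ModalFormula → Set
    Sat w (var p)  = valuation w p
    Sat w (¬ᵐ φ)   = ¬ Sat w φ
    Sat w (◇ᵐ φ)   = ∃ λ u → w ≼ u × Sat u φ
    Sat w (□ᵐ φ)   = ∀ u → w ≼ u → Sat u φ
    Sat w (φ ∧ᵐ ψ) = Sat w φ × Sat w ψ
    Sat w (φ ∨ᵐ ψ) = Sat w φ ⊎ Sat w ψ
    Sat w (φ ⇒ᵐ ψ) = Sat w φ → Sat w ψ

  -- Finite countermodels to unprovable formulas

  module Completeness (em : ExcludedMiddle 0ℓ) where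

    -- Lindenbaum's construction for finitely many formulas: what replaces a maximal consistent set
    -- is a single formula.
    extend : ∀ c → Consistent c → ∀ l →
             ∃ λ d → Consistent d × d ⊢ c × (∀ {x} → x ∈ˡ l → Decides d x)
    extend c con []      = c , con , ⊢-refl , λ ()
    extend c con (x ∷ l) with extend c con l
    ... | d , cd , p , dec with em {P = Consistent (d ∧ᵐ x)}
    ... | yes k = _ , k , ⊢-trans ∧-elim₁ p ,
                  λ { (here refl) → inj₁ ∧-elim₂ ; (there m) → decides-strengthen ∧-elim₁ (dec m) }
    ... | no k  = (d ∧ᵐ ¬ᵐ x) , (λ q → cd (¬-cases (decidable-stable em k) q)) , ⊢-trans ∧-elim₁ p ,
                  λ { (here refl) → inj₂ ∧-elim₂ ; (there m) → decides-strengthen ∧-elim₁ (dec m) }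

    -- `β` is the conjunction of all `χ` with `P χ` whose box occurs in the list. Closure of `P`
    -- under conjunction makes `β` inherit `P`, so finitely many facts about boxed formulas act as
    -- one.
    collect : ∀ (P : ModalFormula → Set) →
              P (var 0 ⇒ᵐ var 0) → (∀ {a b} → P a → P b → P (a ∧ᵐ b)) →
              ∀ l → ∃ λ β → P β × (∀ {χ} → (□ᵐ χ) ∈ˡ l → P χ → β ⊢ χ)
    collect P p0 p∧ [] = _ , p0 , λ ()
    collect P p0 p∧ (x ∷ l) with collect P p0 p∧ l
    ... | β , pβ , f with em {P = ∃ λ χ → x ≡ (□ᵐ χ) × P χ}
    ... | yes (χ , refl , pχ) = (χ ∧ᵐ β) , p∧ pχ pβ ,
            λ { (here refl) _ → ∧-elim₁ ; (there m) q → ⊢-trans ∧-elim₂ (f m q) }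
    ... | no ¬χ = β , pβ , λ { (here refl) q → ⊥-elim (¬χ (_ , refl , q)) ; (there m) q → f m q }

    enumerate : ∀ (P : ModalFormula → Set) l →
                ∃ λ n → ∃ λ (f : Fin n → ModalFormula) →
                (∀ w → f w ∈ˡ l × P (f w)) × (∀ {a} → a ∈ˡ l → P a → ∃ λ w → f w ≡ a)
    enumerate P l = length l′ , lookup l′ , (λ w → ∈-filter⁻ P? {xs = l} (∈-lookup {xs = l′} w)) ,
      λ m p → index (∈-filter⁺ P? m p) , sym (lookup-index (∈-filter⁺ P? m p))
      where
      P? : ∀ a → Dec (P a)
      P? a = em
      l′ = filter P? l

    -- The worlds are the atoms that `c` declares possible. As `c` also decides `◇ a` for every atom
    -- `a`, an atom that is not a world is provably impossible under `c`; finitely many worlds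
    -- therefore account for everything that `c` considers possible.
    module CanonicalModel
      (Σφ : List ModalFormula) (c : ModalFormula) (c-consistent : Consistent c)
      (c-decides : ∀ {x} → x ∈ˡ Σφ → Decides c x)
      (c-decides-◇ : ∀ {a} → a ∈ˡ atoms Σφ → Decides c (◇ᵐ a))
      (size : ℕ) (atom : Fin size → ModalFormula)
      (atom-possible∈ : ∀ w → atom w ∈ˡ atoms Σφ × c ⊢ (◇ᵐ atom w))
      (world : ∀ {a} → a ∈ˡ atoms Σφ → c ⊢ (◇ᵐ a) → ∃ λ w → atom w ≡ a)
      where

      World : Set
      World = Fin size

      atom∈ : ∀ w → atom w ∈ˡ atoms Σφ
      atom∈ w = proj₁ (atom-possible∈ w)

      atom-possible : ∀ w → c ⊢ (◇ᵐ atom w)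
      atom-possible w = proj₂ (atom-possible∈ w)

      atom-consistent : ∀ w {x} → atom w ⊢ x → ¬ (atom w ⊢ (¬ᵐ x))
      atom-consistent w p q = c-consistent (explosion (atom-possible w)
        (weaken (modus-ponens □¬⇒¬◇ (necessitation (explosion p q)))))

      decides : ∀ w {x} → x ∈ˡ Σφ → Decides (atom w) x
      decides w = atom-decides Σφ (atom∈ w)

      -- Filtration in its transitive form: whole boxed formulas are preserved, which yields a
      -- preorder by definition.
      _≼_ : World → World → Set
      u ≼ v = ∀ χ → (□ᵐ χ) ∈ˡ Σφ → atom u ⊢ (□ᵐ χ) → atom v ⊢ (□ᵐ χ)

      -- Otherwise `c` proves `□ (a ⇒ ¬ θ)` for every atom `a`: an impossible atom is excluded under
      -- the box, a possible one refutes `θ` by assumption. Then `c` proves `□ ¬ θ`.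
      possible-world : ∀ {θ} → c ⊢ (◇ᵐ θ) → ∃ λ w → ¬ (atom w ⊢ (¬ᵐ θ))
      possible-world {θ} p with em {P = ∃ λ w → ¬ (atom w ⊢ (¬ᵐ θ))}
      ... | yes r = r
      ... | no ¬r = ⊥-elim (c-consistent (explosion p (⊢-trans (□-atoms Σφ step) □¬⇒¬◇)))
        where
        step : ∀ {a} → a ∈ˡ atoms Σφ → c ⊢ (□ᵐ (a ⇒ᵐ ¬ᵐ θ))
        step m with c-decides-◇ m
        ... | inj₂ q = ⊢-trans (⊢-trans q ¬◇⇒□¬) (□-mono ⇒-intro₁)
        ... | inj₁ q with world m q
        ... | w , refl = weaken (necessitation (decidable-stable em λ k → ¬r (w , k)))

      compatible : ∀ w {θ x} → ¬ (atom w ⊢ (¬ᵐ θ)) → x ∈ˡ Σφ → θ ⊢ x → atom w ⊢ x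
      compatible w k m p with decides w m
      ... | inj₁ q = q
      ... | inj₂ q = ⊥-elim (k (⊢-trans q (contrapositive p)))

      -- `β` gathers the boxes of `w`. They are collected as `□□χ`, so that `◇ θ` strengthens to
      -- `◇ (□ β ∧ θ)`; a world compatible with the latter has all boxes of `w`. Since `w` is itself
      -- only possible under `c`, two diamonds are contracted to one.
      successor : ∀ w {θ} → atom w ⊢ (◇ᵐ θ) → ∃ λ u → w ≼ u × ¬ (atom u ⊢ (¬ᵐ θ))
      successor w {θ} p with collect (λ χ → atom w ⊢ (□ᵐ □ᵐ χ))
                               (weaken (necessitation (necessitation ⊢-refl)))
                               (λ q r → ⊢-trans (□-∧ q r) (□-mono (□-∧ ∧-elim₁ ∧-elim₂))) Σφ
      ... | β , □β , f with possible-world (⊢-trans (atom-possible w)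
                              (⊢-trans (◇-mono (◇-∧ □β p)) ◇◇⇒◇))
      ... | u , k = u , (λ χ m q → compatible u k m (⊢-trans ∧-elim₁ (□-mono (f m (⊢-trans q □-dup))))) ,
                    λ q → k (⊢-trans q (contrapositive ∧-elim₂))

      -- A box true at some world is possibly necessary under `c`. By `◇□-∧` all these boxes are
      -- possible together, and a world that realizes them lies above every other.
      greatest : ∃ λ t → ∀ w → w ≼ t
      greatest with collect (λ χ → c ⊢ (◇ᵐ □ᵐ χ))
                      (weaken (modus-ponens ◇-intro (necessitation ⊢-refl))) ◇□-∧ Σφ
      ... | β , □β , f with possible-world □β
      ... | t , k = t , λ w χ m q →
                    compatible t k m (□-mono (f m (⊢-trans (atom-possible w) (◇-mono q))))

      root-atom : ∃ λ a → a ∈ˡ atoms Σφ × c ⊢ a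
      root-atom = decided-atom Σφ c-decides

      root-world : ∃ λ w → atom w ≡ proj₁ root-atom
      root-world = world (proj₁ (proj₂ root-atom)) (⊢-trans (proj₂ (proj₂ root-atom)) ◇-intro)

      root : World
      root = proj₁ root-world

      c⊢root : c ⊢ atom root
      c⊢root = subst (λ a → c ⊢ a) (sym (proj₂ root-world)) (proj₂ (proj₂ root-atom))

      -- `c` proves the atom of the root. A box `□χ` of the root therefore gives `□□χ` under `c`,
      -- whereas a world that refutes `□χ` would give `◇ ¬ □χ`.
      root-least : ∀ w → root ≼ w
      root-least w χ m p with decides w m
      ... | inj₁ q = q
      ... | inj₂ q = ⊥-elim (c-consistent (explosion
                       (⊢-trans (⊢-trans c⊢root p) □-dup)
                       (⊢-trans (atom-possible w) (⊢-trans (◇-mono q) ◇¬⇒¬□))))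

      model : DirectedModel
      model = record
        { size = size ; _≼_ = _≼_
        ; ≼-refl = λ χ m p → p ; ≼-trans = λ p q χ m r → q χ m (p χ m r)
        ; root = root ; root-least = root-least
        ; top = proj₁ greatest ; top-greatest = proj₂ greatest
        ; valuation = λ w p → atom w ⊢ var p }

      open DirectedModel model using (Sat)

      truth : ∀ ψ → (∀ {χ} → χ ∈ˡ subformulas ψ → χ ∈ˡ Σφ) → ∀ w → Sat w ψ ⇔ (atom w ⊢ ψ)
      truth (var p)  sub w = mk⇔ (λ x → x) (λ x → x)
      truth (¬ᵐ ψ)   sub w = mk⇔ f (λ p q → atom-consistent w (to (truth ψ (sub ∘ there) w) q) p)
        where
        f : Sat w (¬ᵐ ψ) → atom w ⊢ (¬ᵐ ψ)
        f k with decides w (sub (there (self∈subformulas ψ)))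
        ... | inj₁ q = ⊥-elim (k (from (truth ψ (sub ∘ there) w) q))
        ... | inj₂ q = q
      truth (◇ᵐ ψ)   sub w = mk⇔ f g
        where
        IH : ∀ u → Sat u ψ ⇔ (atom u ⊢ ψ)
        IH = truth ψ (sub ∘ there ∘ there)
        f : Sat w (◇ᵐ ψ) → atom w ⊢ (◇ᵐ ψ)
        f (u , w≼u , s) with decides w (sub (there (here refl)))
        ... | inj₁ q = ⊥-elim (atom-consistent u (to (IH u) s)
                         (⊢-trans (w≼u _ (sub (there (here refl))) q) □-elim))
        ... | inj₂ q = ⊢-trans q ¬□¬⇒◇
        g : atom w ⊢ (◇ᵐ ψ) → Sat w (◇ᵐ ψ)
        g p with successor w p
        ... | u , w≼u , k = u , w≼u ,
              from (IH u) (compatible u k (sub (there (there (self∈subformulas ψ)))) ⊢-refl)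
      truth (□ᵐ ψ)   sub w = mk⇔ f (λ p u w≼u → from (IH u) (⊢-trans (w≼u ψ (sub (here refl)) p) □-elim))
        where
        IH : ∀ u → Sat u ψ ⇔ (atom u ⊢ ψ)
        IH = truth ψ (sub ∘ there)
        f : Sat w (□ᵐ ψ) → atom w ⊢ (□ᵐ ψ)
        f s with decides w (sub (here refl))
        ... | inj₁ q = q
        ... | inj₂ q with successor w (⊢-trans q ¬□⇒◇¬)
        ... | u , w≼u , k = ⊥-elim (k (⊢-trans (to (IH u) (s u w≼u)) ¬¬-intro))
      truth (ψ ∧ᵐ χ) sub w = mk⇔
        (λ (p , q) → ∧-intro (to IHˡ p) (to IHʳ q))
        (λ p → from IHˡ (⊢-trans p ∧-elim₁) , from IHʳ (⊢-trans p ∧-elim₂))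
        where
        IHˡ = truth ψ (sub ∘ there ∘ ∈-++⁺ˡ) w
        IHʳ = truth χ (sub ∘ there ∘ ∈-++⁺ʳ (subformulas ψ)) w
      truth (ψ ∨ᵐ χ) sub w = mk⇔
        (λ { (inj₁ p) → ⊢-trans (to IHˡ p) ∨-intro₁ ; (inj₂ p) → ⊢-trans (to IHʳ p) ∨-intro₂ }) g
        where
        IHˡ = truth ψ (sub ∘ there ∘ ∈-++⁺ˡ) w
        IHʳ = truth χ (sub ∘ there ∘ ∈-++⁺ʳ (subformulas ψ)) w
        g : atom w ⊢ (ψ ∨ᵐ χ) → Sat w (ψ ∨ᵐ χ)
        g p with decides w (sub (there (∈-++⁺ˡ (self∈subformulas ψ))))
               | decides w (sub (there (∈-++⁺ʳ (subformulas ψ) (self∈subformulas χ))))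
        ... | inj₁ q | _      = inj₁ (from IHˡ q)
        ... | inj₂ _ | inj₁ q = inj₂ (from IHʳ q)
        ... | inj₂ q | inj₂ r = ⊥-elim (atom-consistent w p (¬∨-intro q r))
      truth (ψ ⇒ᵐ χ) sub w = mk⇔ f (λ p s → from IHʳ (p · to IHˡ s))
        where
        IHˡ = truth ψ (sub ∘ there ∘ ∈-++⁺ˡ) w
        IHʳ = truth χ (sub ∘ there ∘ ∈-++⁺ʳ (subformulas ψ)) w
        f : Sat w (ψ ⇒ᵐ χ) → atom w ⊢ (ψ ⇒ᵐ χ)
        f s with decides w (sub (there (∈-++⁺ˡ (self∈subformulas ψ))))
        ... | inj₁ q = ⊢-trans (to IHʳ (s (from IHˡ q))) ⇒-intro₂
        ... | inj₂ q = ⊢-trans q ⇒-intro₁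

      root-truth : ∀ {φ} → (∀ {χ} → χ ∈ˡ subformulas φ → χ ∈ˡ Σφ) → Sat root φ → ¬ (c ⊢ (¬ᵐ φ))
      root-truth sub s q = c-consistent (explosion (⊢-trans c⊢root (to (truth _ sub root) s)) q)

    countermodel : ∀ φ → ¬ S4·2 φ →
                   ∃ λ (𝓕 : DirectedModel) → ¬ DirectedModel.Sat 𝓕 (DirectedModel.root 𝓕) φ
    countermodel φ k
      with extend (¬ᵐ φ) (λ p → k (modus-ponens ¬¬-elim p)) (subformulas φ ++ map ◇ᵐ_ (atoms (subformulas φ)))
    ... | c , c-con , c⊢¬φ , dec
      with enumerate (λ a → c ⊢ (◇ᵐ a)) (atoms (subformulas φ))
    ... | size , atom , possible , world = model , λ s → root-truth (λ m → m) s c⊢¬φ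
      where open CanonicalModel (subformulas φ) c c-con (λ m → dec (∈-++⁺ˡ m))
                   (λ m → dec (∈-++⁺ʳ (subformulas φ) (∈-map⁺ ◇ᵐ_ m))) size atom possible world

open ModalLogic using (DirectedModel; module Completeness)

module SetModel (𝓥 : ZFModel) (em : ExcludedMiddle 0ℓ) where

  open import Data.Vec.Base using (Vec; []; _∷_; lookup; _++_; head; tail; tabulate)
  open import Data.Vec.Properties using (lookup-++ˡ; lookup-++ʳ; lookup∘tabulate)
  open import Data.Vec.Relation.Unary.All using (_∷_)
  open import Data.Vec.Relation.Unary.All.Properties using (tabulate⁺)

  open ZFModel 𝓥
  open SetTheory 𝓥

  -- Definable predicates

  rename : ∀ {m n} → (Fin m → Fin n) → Formula zf m → Formula zf n
  rename σ (x ∈ᶠ y) = σ x ∈ᶠ σ y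
  rename σ (x ≐ᶠ y) = σ x ≐ᶠ σ y
  rename σ (¬ᶠ φ)   = ¬ᶠ rename σ φ
  rename σ (φ ∧ᶠ ψ) = rename σ φ ∧ᶠ rename σ ψ
  rename σ (φ ∨ᶠ ψ) = rename σ φ ∨ᶠ rename σ ψ
  rename σ (φ ⇒ᶠ ψ) = rename σ φ ⇒ᶠ rename σ ψ
  rename σ (∀ᶠ φ)   = ∀ᶠ rename (lift 1 σ) φ
  rename σ (∃ᶠ φ)   = ∃ᶠ rename (lift 1 σ) φ

  Renames : ∀ {m n} → (Fin m → Fin n) → Vec U m → Vec U n → Set
  Renames σ ρ ρ′ = ∀ i → lookup ρ′ (σ i) ≡ lookup ρ i

  renames-lift : ∀ {m n} k {σ : Fin m → Fin n} {ρ ρ′} → Renames σ ρ ρ′ →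
                 ∀ (xs : Vec U k) → Renames (lift k σ) (xs ++ ρ) (xs ++ ρ′)
  renames-lift zero    r []       i       = r i
  renames-lift (suc k) r (x ∷ xs) zero    = refl
  renames-lift (suc k) r (x ∷ xs) (suc i) = renames-lift k r xs i

  holds-rename : ∀ {m n} (φ : Formula zf m) {σ : Fin m → Fin n} {ρ ρ′} → Renames σ ρ ρ′ →
                 Holds _∈_ (rename σ φ) ρ′ ⇔ Holds _∈_ φ ρ
  holds-rename (x ∈ᶠ y) r = mk⇔ (subst₂ _∈_ (r x) (r y)) (subst₂ _∈_ (sym (r x)) (sym (r y)))
  holds-rename (x ≐ᶠ y) r = mk⇔ (subst₂ _≡_ (r x) (r y)) (subst₂ _≡_ (sym (r x)) (sym (r y)))
  holds-rename (¬ᶠ φ)   r = mk⇔ (_∘ from (holds-rename φ r)) (_∘ to (holds-rename φ r))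
  holds-rename (φ ∧ᶠ ψ) r = mk⇔
    (λ (p , q) → to (holds-rename φ r) p , to (holds-rename ψ r) q)
    (λ (p , q) → from (holds-rename φ r) p , from (holds-rename ψ r) q)
  holds-rename (φ ∨ᶠ ψ) r = mk⇔
    (map-⊎ (to (holds-rename φ r)) (to (holds-rename ψ r)))
    (map-⊎ (from (holds-rename φ r)) (from (holds-rename ψ r)))
  holds-rename (φ ⇒ᶠ ψ) r = mk⇔
    (λ f → to (holds-rename ψ r) ∘ f ∘ from (holds-rename φ r))
    (λ f → from (holds-rename ψ r) ∘ f ∘ to (holds-rename φ r))
  holds-rename (∀ᶠ φ)   r = mk⇔
    (λ f x → to (holds-rename φ (renames-lift 1 r (x ∷ []))) (f x))
    (λ f x → from (holds-rename φ (renames-lift 1 r (x ∷ []))) (f x))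
  holds-rename (∃ᶠ φ)   r = mk⇔
    (λ (x , p) → x , to (holds-rename φ (renames-lift 1 r (x ∷ []))) p)
    (λ (x , p) → x , from (holds-rename φ (renames-lift 1 r (x ∷ []))) p)

  -- A semantic predicate together with a defining formula. The combinators below build the formula
  -- along with the predicate, so that a definability proof merely repeats the shape of the
  -- statement. Each predicate carries its own parameters; binary connectives concatenate them.
  record Definable {n} (Q : Vec U n → Set) : Set where
    constructor definable
    field
      {arity}  : ℕ
      params   : Vec U arity
      formula  : Formula zf (n + arity)
      correct  : ∀ xs → Holds _∈_ formula (xs ++ params) ⇔ Q xs

  open Definable

  -- The language has no function symbols, so an operation on sets is represented by its graph.
  -- `letᵈ` inserts it into a formula by an existential quantifier.
  record Termᵈ {n} (t : Vec U n → U) : Set where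
    constructor term
    field
      graphᵈ : Definable {suc n} (λ v → head v ≡ t (tail v))

  open Termᵈ

  module _ {n : ℕ} where

    infix  30 ¬ᵈ_ ∀ᵈ_ ∃ᵈ_
    infixr 23 _⇔ᵈ_

    opaque
      mapᵈ : {P Q : Vec U n → Set} → (∀ xs → P xs ⇔ Q xs) → Definable P → Definable Q
      mapᵈ e d = definable (params d) (formula d) λ xs → ⇔-trans (correct d xs) (e xs)

      ¬ᵈ_ : {P : Vec U n → Set} → Definable P → Definable (λ xs → ¬ P xs)
      ¬ᵈ d = definable (params d) (¬ᶠ formula d) λ xs →
        mk⇔ (_∘ from (correct d xs)) (_∘ to (correct d xs))

      ∀ᵈ_ : {P : Vec U (suc n) → Set} → Definable P → Definable (λ xs → ∀ x → P (x ∷ xs))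
      ∀ᵈ d = definable (params d) (∀ᶠ formula d) λ xs →
        mk⇔ (λ f x → to (correct d (x ∷ xs)) (f x)) (λ f x → from (correct d (x ∷ xs)) (f x))

      ∃ᵈ_ : {P : Vec U (suc n) → Set} → Definable P → Definable (λ xs → ∃ λ x → P (x ∷ xs))
      ∃ᵈ d = definable (params d) (∃ᶠ formula d) λ xs →
        mk⇔ (λ (x , p) → x , to (correct d (x ∷ xs)) p) (λ (x , p) → x , from (correct d (x ∷ xs)) p)

    module _ {P Q : Vec U n → Set} (d : Definable P) (e : Definable Q) where
      private
        σˡ : Fin (n + arity d) → Fin (n + (arity d + arity e))
        σˡ = lift n (_↑ˡ arity e)
        σʳ : Fin (n + arity e) → Fin (n + (arity d + arity e))
        σʳ = lift n (arity d ↑ʳ_)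
        okˡ : ∀ xs → Holds _∈_ (rename σˡ (formula d)) (xs ++ (params d ++ params e)) ⇔ P xs
        okˡ xs = ⇔-trans (holds-rename (formula d)
          (renames-lift n (lookup-++ˡ (params d) (params e)) xs)) (correct d xs)
        okʳ : ∀ xs → Holds _∈_ (rename σʳ (formula e)) (xs ++ (params d ++ params e)) ⇔ Q xs
        okʳ xs = ⇔-trans (holds-rename (formula e)
          (renames-lift n (lookup-++ʳ (params d) (params e)) xs)) (correct e xs)

      infixr 25 _∧ᵈ_
      infixr 24 _∨ᵈ_
      infixr 23 _⇒ᵈ_

      opaque
        _∧ᵈ_ : Definable (λ xs → P xs × Q xs)
        _∧ᵈ_ = definable (params d ++ params e) (rename σˡ (formula d) ∧ᶠ rename σʳ (formula e)) λ xs → mk⇔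
          (λ (p , q) → to (okˡ xs) p , to (okʳ xs) q) (λ (p , q) → from (okˡ xs) p , from (okʳ xs) q)

        _∨ᵈ_ : Definable (λ xs → P xs ⊎ Q xs)
        _∨ᵈ_ = definable (params d ++ params e) (rename σˡ (formula d) ∨ᶠ rename σʳ (formula e)) λ xs → mk⇔
          (map-⊎ (to (okˡ xs)) (to (okʳ xs))) (map-⊎ (from (okˡ xs)) (from (okʳ xs)))

        _⇒ᵈ_ : Definable (λ xs → P xs → Q xs)
        _⇒ᵈ_ = definable (params d ++ params e) (rename σˡ (formula d) ⇒ᶠ rename σʳ (formula e)) λ xs → mk⇔
          (λ f → to (okʳ xs) ∘ f ∘ from (okˡ xs)) (λ f → from (okʳ xs) ∘ f ∘ to (okˡ xs))

    opaque
      _⇔ᵈ_ : {P Q : Vec U n → Set} → Definable P → Definable Q → Definable (λ xs → P xs ⇔ Q xs)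
      d ⇔ᵈ e = mapᵈ (λ xs → mk⇔ (λ (f , g) → mk⇔ f g) (λ h → to h , from h)) ((d ⇒ᵈ e) ∧ᵈ (e ⇒ᵈ d))

  module _ {n : ℕ} where

    opaque
      wk : {t : Vec U n → U} → Termᵈ t → Termᵈ {suc n} (t ∘ tail)
      wk (term d) = term (definable (params d) (rename (lift 1 suc) (formula d)) λ { (y ∷ x ∷ xs) →
        ⇔-trans (holds-rename (formula d) (renames-lift 1 {ρ = xs ++ params d} (λ i → refl) (y ∷ [])))
                (correct d (y ∷ xs)) })

      letᵈ : {t : Vec U n → U} {P : Vec U (suc n) → Set} →
             Termᵈ t → Definable P → Definable (λ xs → P (t xs ∷ xs))
      letᵈ {t} {P} d e = mapᵈ (λ xs → mk⇔ (λ (x , p , q) → subst (λ z → P (z ∷ xs)) p q) (λ q → _ , refl , q))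
        (∃ᵈ (graphᵈ d ∧ᵈ e))

      const : (c : U) → Termᵈ {n} (λ _ → c)
      const c = term (definable (c ∷ []) (zero ≐ᶠ suc (n ↑ʳ zero)) λ { (x ∷ xs) →
        mk⇔ (λ p → trans p (lookup-++ʳ xs (c ∷ []) zero)) (λ p → trans p (sym (lookup-++ʳ xs (c ∷ []) zero))) })

  opaque
    mem₁₀ : ∀ {n} → Definable {suc (suc n)} (λ v → head (tail v) ∈ head v)
    mem₁₀ = definable [] (suc zero ∈ᶠ zero) λ { (x ∷ y ∷ xs) → mk⇔ (λ p → p) (λ p → p) }

    eq₁₀ : ∀ {n} → Definable {suc (suc n)} (λ v → head (tail v) ≡ head v)
    eq₁₀ = definable [] (suc zero ≐ᶠ zero) λ { (x ∷ y ∷ xs) → mk⇔ (λ p → p) (λ p → p) }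

  module _ {n : ℕ} {t u : Vec U n → U} where

    infix 40 _∈ᵈ_ _≐ᵈ_

    opaque
      _∈ᵈ_ : Termᵈ t → Termᵈ u → Definable (λ xs → t xs ∈ u xs)
      d ∈ᵈ e = letᵈ d (letᵈ (wk e) mem₁₀)

      _≐ᵈ_ : Termᵈ t → Termᵈ u → Definable (λ xs → t xs ≡ u xs)
      d ≐ᵈ e = letᵈ d (letᵈ (wk e) eq₁₀)

  opaque
    #0 : ∀ {n} → Termᵈ {suc n} (λ v → head v)
    #0 = term (definable [] (zero ≐ᶠ suc zero) λ { (x ∷ y ∷ xs) → mk⇔ (λ p → p) (λ p → p) })

  module _ {n : ℕ} where
    opaque
      #1 : Termᵈ {suc (suc n)} (λ v → head (tail v))
      #1 = wk #0
      #2 : Termᵈ {suc (suc (suc n))} (λ v → head (tail (tail v)))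
      #2 = wk #1
      #3 : Termᵈ {suc (suc (suc (suc n)))} (λ v → head (tail (tail (tail v))))
      #3 = wk #2
      #4 : Termᵈ {suc (suc (suc (suc (suc n))))} (λ v → head (tail (tail (tail (tail v)))))
      #4 = wk #3
      #5 : Termᵈ {suc (suc (suc (suc (suc (suc n)))))} (λ v → head (tail (tail (tail (tail (tail v))))))
      #5 = wk #4
      #6 : Termᵈ {suc (suc (suc (suc (suc (suc (suc n))))))} (λ v → head (tail (tail (tail (tail (tail (tail v)))))))
      #6 = wk #5

  opaque
    -- Under two existential quantifiers over the components of a pair `z`, the environment reads
    -- second component, first component, `z`; the relation expects the first component first and
    -- has no place for `z`.
    reindex₁₀ : {R : Vec U 2 → Set} → Definable R → Definable {3} (λ v → R (head (tail v) ∷ head v ∷ []))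
    reindex₁₀ d = definable (params d)
      (rename (λ { zero → suc zero ; (suc zero) → zero ; (suc (suc i)) → suc (suc (suc i)) }) (formula d))
      λ { (x ∷ y ∷ z ∷ []) → ⇔-trans
        (holds-rename (formula d) (λ { zero → refl ; (suc zero) → refl ; (suc (suc i)) → refl }))
        (correct d (y ∷ x ∷ [])) }

  opaque
    separate : {Q : Vec U 1 → Set} → Definable Q → ∀ x →
               ∃ λ y → ∀ z → z ∈ y ⇔ (z ∈ x × Q (z ∷ []))
    separate d x with separation (formula d) (params d) x
    ... | y , f = y , λ z → ⇔-trans (f z) (mk⇔
      (λ (p , q) → p , to (correct d (z ∷ [])) q) (λ (p , q) → p , from (correct d (z ∷ [])) q))

    replace : {Q : Vec U 2 → Set} → Definable Q → ∀ x →
              (∀ a → a ∈ x → ∀ b c → Q (a ∷ b ∷ []) → Q (a ∷ c ∷ []) → b ≡ c) →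
              ∃ λ y → ∀ b → b ∈ y ⇔ (∃ λ a → a ∈ x × Q (a ∷ b ∷ []))
    replace d x fun with replacement (formula d) (params d) x (λ a m b c p q →
      fun a m b c (to (correct d (a ∷ b ∷ [])) p) (to (correct d (a ∷ c ∷ [])) q))
    ... | y , f = y , λ b → ⇔-trans (f b) (mk⇔
      (λ (a , m , q) → a , m , to (correct d (a ∷ b ∷ [])) q)
      (λ (a , m , q) → a , m , from (correct d (a ∷ b ∷ [])) q))

  -- Pairs, unions and successors

  ∈-pair : ∀ x y z → z ∈ ⦅ x , y ⦆ ⇔ (z ≡ x ⊎ z ≡ y)
  ∈-pair x y = proj₂ (pairing x y)

  ∈-pairˡ : ∀ {x y} → x ∈ ⦅ x , y ⦆
  ∈-pairˡ = from (∈-pair _ _ _) (inj₁ refl)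

  ∈-pairʳ : ∀ {x y} → y ∈ ⦅ x , y ⦆
  ∈-pairʳ = from (∈-pair _ _ _) (inj₂ refl)

  ∈-pair⁻ : ∀ {x y z} → z ∈ ⦅ x , y ⦆ → z ≡ x ⊎ z ≡ y
  ∈-pair⁻ = to (∈-pair _ _ _)

  ∈-single⁻ : ∀ {x z} → z ∈ ⦅ x , x ⦆ → z ≡ x
  ∈-single⁻ p = [ (λ q → q) , (λ q → q) ]′ (∈-pair⁻ p)

  ∈-∪ˡ : ∀ {x y z} → z ∈ x → z ∈ x ∪ y
  ∈-∪ˡ p = from (proj₂ (union _) _) (_ , ∈-pairˡ , p)

  ∈-∪ʳ : ∀ {x y z} → z ∈ y → z ∈ x ∪ y
  ∈-∪ʳ p = from (proj₂ (union _) _) (_ , ∈-pairʳ , p)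

  ∈-∪⁻ : ∀ {x y z} → z ∈ x ∪ y → z ∈ x ⊎ z ∈ y
  ∈-∪⁻ p with to (proj₂ (union _) _) p
  ... | w , m , q with ∈-pair⁻ m
  ... | inj₁ refl = inj₁ q
  ... | inj₂ refl = inj₂ q

  ∈-succ-self : ∀ {x} → x ∈ succ x
  ∈-succ-self = ∈-∪ʳ ∈-pairˡ

  ∈-succ : ∀ {x z} → z ∈ x → z ∈ succ x
  ∈-succ = ∈-∪ˡ

  ∈-succ⁻ : ∀ {x z} → z ∈ succ x → z ∈ x ⊎ z ≡ x
  ∈-succ⁻ p = map-⊎ (λ q → q) ∈-single⁻ (∈-∪⁻ p)

  ∉∅ : ∀ {z} → ¬ z ∈ ∅
  ∉∅ = proj₂ empty _

  singleton-pair : ∀ {x y z} → ⦅ x , x ⦆ ≡ ⦅ y , z ⦆ → y ≡ x × z ≡ x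
  singleton-pair e = ∈-single⁻ (subst (_ ∈_) (sym e) ∈-pairˡ) , ∈-single⁻ (subst (_ ∈_) (sym e) ∈-pairʳ)

  pair-cancelˡ : ∀ {x y z} → ⦅ x , y ⦆ ≡ ⦅ x , z ⦆ → y ≡ z
  pair-cancelˡ {x} {y} {z} e with ∈-pair⁻ (subst (y ∈_) e ∈-pairʳ)
  ... | inj₂ p    = p
  ... | inj₁ refl = sym (proj₂ (singleton-pair e))

  ⟨⟩-injective : ∀ {x y x′ y′} → ⟨ x , y ⟩ ≡ ⟨ x′ , y′ ⟩ → x ≡ x′ × y ≡ y′
  ⟨⟩-injective {x} {y} {x′} {y′} e with ∈-pair⁻ (subst (⦅ x , x ⦆ ∈_) e ∈-pairˡ)
  ... | inj₂ p with singleton-pair p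
  ... | refl , refl = refl , proj₂ (singleton-pair (sym (proj₂ (singleton-pair (sym e)))))
  ⟨⟩-injective {x} {y} {x′} {y′} e | inj₁ p with singleton-pair p
  ... | refl , _ = refl , pair-cancelˡ (pair-cancelˡ e)

  ∈-irrefl : ∀ {x} → ¬ x ∈ x
  ∈-irrefl {x} p with foundation ⦅ x , x ⦆ (x , ∈-pairˡ)
  ... | y , m , f with ∈-single⁻ m
  ... | refl = f x ∈-pairˡ p

  ∈-asym : ∀ {x y} → x ∈ y → ¬ y ∈ x
  ∈-asym {x} {y} p q with foundation ⦅ x , y ⦆ (x , ∈-pairˡ)
  ... | w , m , f with ∈-pair⁻ m
  ... | inj₁ refl = f y ∈-pairʳ q
  ... | inj₂ refl = f x ∈-pairˡ p

  succ-injective : ∀ {x y} → succ x ≡ succ y → x ≡ y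
  succ-injective {x} {y} e with ∈-succ⁻ (subst (x ∈_) e ∈-succ-self) | ∈-succ⁻ (subst (y ∈_) (sym e) ∈-succ-self)
  ... | inj₂ p | _      = p
  ... | inj₁ _ | inj₂ q = sym q
  ... | inj₁ p | inj₁ q = ⊥-elim (∈-asym p q)

  succ≢∅ : ∀ {x} → succ x ≢ ∅
  succ≢∅ e = ∉∅ (subst (_ ∈_) e ∈-succ-self)

  numeral-injective : ∀ m n → numeral m ≡ numeral n → m ≡ n
  numeral-injective zero    zero    e = refl
  numeral-injective zero    (suc n) e = ⊥-elim (succ≢∅ (sym e))
  numeral-injective (suc m) zero    e = ⊥-elim (succ≢∅ e)
  numeral-injective (suc m) (suc n) e = cong suc (numeral-injective m n (succ-injective e))

  𝒫 : U → U
  𝒫 x = proj₁ (powerset x)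

  ∈-𝒫 : ∀ {x z} → z ∈ 𝒫 x ⇔ (∀ w → w ∈ z → w ∈ x)
  ∈-𝒫 = proj₂ (powerset _) _

  opaque
    extensionᵈ : ∀ {n} {t : Vec U n → U} {P : Vec U (suc n) → Set} →
                 (∀ xs z → z ∈ t xs ⇔ P (z ∷ xs)) →
                 Definable {suc (suc n)} (λ v → P (head v ∷ tail (tail v))) → Termᵈ t
    extensionᵈ {t = t} {P} e d = term (mapᵈ
      (λ xs → mk⇔
        (λ f → extensionality λ z → ⇔-trans (f z) (⇔-sym (e (tail xs) z)))
        (λ p z → subst (λ y → z ∈ y ⇔ P (z ∷ tail xs)) (sym p) (e (tail xs) z)))
      (∀ᵈ ((#0 ∈ᵈ #1) ⇔ᵈ d)))

  module _ {n : ℕ} {t u : Vec U n → U} where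
    opaque
      pairᵈ : Termᵈ t → Termᵈ u → Termᵈ (λ xs → ⦅ t xs , u xs ⦆)
      pairᵈ d e = extensionᵈ {P = λ v → head v ≡ t (tail v) ⊎ head v ≡ u (tail v)} (λ xs → ∈-pair (t xs) (u xs))
        ((#0 ≐ᵈ wk (wk d)) ∨ᵈ (#0 ≐ᵈ wk (wk e)))

  opaque
    ⟨_,_⟩ᵈ : ∀ {n} {t u : Vec U n → U} → Termᵈ t → Termᵈ u → Termᵈ (λ xs → ⟨ t xs , u xs ⟩)
    ⟨ d , e ⟩ᵈ = pairᵈ (pairᵈ d d) (pairᵈ d e)

  module _ {n : ℕ} {t : Vec U n → U} where
    opaque
      succᵈ : Termᵈ t → Termᵈ (λ xs → succ (t xs))
      succᵈ d = extensionᵈ {P = λ v → head v ∈ t (tail v) ⊎ head v ≡ t (tail v)}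
        (λ xs z → mk⇔ ∈-succ⁻ [ ∈-succ , (λ { refl → ∈-succ-self }) ]′)
        ((#0 ∈ᵈ wk (wk d)) ∨ᵈ (#0 ≐ᵈ wk (wk d)))

      𝒫ᵈ : Termᵈ t → Termᵈ (λ xs → 𝒫 (t xs))
      𝒫ᵈ d = extensionᵈ {P = λ v → ∀ w → w ∈ head v → w ∈ t (tail v)} (λ xs z → ∈-𝒫)
        (∀ᵈ (#0 ∈ᵈ #1 ⇒ᵈ #0 ∈ᵈ wk (wk (wk d))))

  -- The set ω and a set closed under pairing

  natᵈ : ∀ {n} {t : Vec U n → U} → Termᵈ t → Definable (λ xs → Nat (t xs))
  natᵈ d = ∀ᵈ ((const ∅ ∈ᵈ #0 ∧ᵈ ∀ᵈ (#0 ∈ᵈ #1 ⇒ᵈ succᵈ #0 ∈ᵈ #1)) ⇒ᵈ wk d ∈ᵈ #0)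

  Nat-zero : Nat ∅
  Nat-zero w ind = proj₁ ind

  Nat-succ : ∀ {n} → Nat n → Nat (succ n)
  Nat-succ p w ind = proj₂ ind _ (p w ind)

  Nat-numeral : ∀ k → Nat (numeral k)
  Nat-numeral zero    = Nat-zero
  Nat-numeral (suc k) = Nat-succ (Nat-numeral k)

  inductive-set : ∃ Inductive
  inductive-set with infinity
  ... | w , (e , e∈w , e-empty) , closed = w , subst (_∈ w) e≡∅ e∈w , succ-closed
    where
    e≡∅ : e ≡ ∅
    e≡∅ = extensionality λ z → mk⇔ (⊥-elim ∘ e-empty z) (⊥-elim ∘ ∉∅)
    succ-closed : ∀ x → x ∈ w → succ x ∈ w
    succ-closed x m with closed x m
    ... | s , s∈w , f = subst (_∈ w)
      (extensionality λ z → mk⇔ ([ ∈-succ , (λ { refl → ∈-succ-self }) ]′ ∘ to (f z)) (from (f z) ∘ ∈-succ⁻)) s∈w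

  opaque
    ω-set : ∃ λ w → ∀ z → z ∈ w ⇔ Nat z
    ω-set with separate (natᵈ #0) (proj₁ inductive-set)
    ... | y , f = y , λ z → ⇔-trans (f z) (mk⇔ proj₂ λ p → p _ (proj₂ inductive-set) , p)

  ω : U
  ω = proj₁ ω-set

  ∈ω⁺ : ∀ {n} → Nat n → n ∈ ω
  ∈ω⁺ = from (proj₂ ω-set _)

  ∈ω⁻ : ∀ {n} → n ∈ ω → Nat n
  ∈ω⁻ = to (proj₂ ω-set _)

  ω-induction : ∀ {Q : Vec U 1 → Set} → Definable Q → Q (∅ ∷ []) →
                (∀ n → Nat n → Q (n ∷ []) → Q (succ n ∷ [])) → ∀ {n} → Nat n → Q (n ∷ [])
  ω-induction d base step {n} p with separate d ω
  ... | X , f = proj₂ (to (f n) (p X (from (f ∅) (∈ω⁺ Nat-zero , base) ,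
    λ x m → let q , r = to (f x) m in from (f (succ x)) (∈ω⁺ (Nat-succ (∈ω⁻ q)) , step x (∈ω⁻ q) r))))

  Nat-cases : ∀ {n} → Nat n → n ≡ ∅ ⊎ (∃ λ m → Nat m × n ≡ succ m)
  Nat-cases = ω-induction (#0 ≐ᵈ const ∅ ∨ᵈ ∃ᵈ (natᵈ #0 ∧ᵈ #1 ≐ᵈ succᵈ #0))
    (inj₁ refl) (λ n p _ → inj₂ (n , p , refl))

  ω-transitive : ∀ {n} → Nat n → n ⊆ ω
  ω-transitive = ω-induction (∀ᵈ (#0 ∈ᵈ #1 ⇒ᵈ #0 ∈ᵈ const ω))
    (λ z m → ⊥-elim (∉∅ m))
    (λ n p f z m → [ f z , (λ { refl → ∈ω⁺ p }) ]′ (∈-succ⁻ m))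

  -- x is the n-th iterated power set of ω if the pair of n and x belongs to a set g all of whose
  -- elements are justified by the recursion equations.
  Sound : U → Set
  Sound g = ∀ n x → ⟨ n , x ⟩ ∈ g →
    (n ≡ ∅ × x ≡ ω) ⊎ (∃₂ λ m y → n ≡ succ m × x ≡ 𝒫 y × ⟨ m , y ⟩ ∈ g)

  Level : U → U → Set
  Level n x = ∃ λ g → Sound g × ⟨ n , x ⟩ ∈ g

  levelᵈ : ∀ {n} {t u : Vec U n → U} → Termᵈ t → Termᵈ u → Definable (λ xs → Level (t xs) (u xs))
  levelᵈ d e = ∃ᵈ (∀ᵈ ∀ᵈ (⟨ #1 , #0 ⟩ᵈ ∈ᵈ #2 ⇒ᵈ
      (#1 ≐ᵈ const ∅ ∧ᵈ #0 ≐ᵈ const ω) ∨ᵈ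
      ∃ᵈ ∃ᵈ (#3 ≐ᵈ succᵈ #1 ∧ᵈ #2 ≐ᵈ 𝒫ᵈ #0 ∧ᵈ ⟨ #1 , #0 ⟩ᵈ ∈ᵈ #4))
    ∧ᵈ ⟨ wk d , wk e ⟩ᵈ ∈ᵈ #0)

  level-zero : Level ∅ ω
  level-zero = ⦅ ⟨ ∅ , ω ⟩ , ⟨ ∅ , ω ⟩ ⦆ , (λ n x m → inj₁ (⟨⟩-injective (∈-single⁻ m))) , ∈-pairˡ

  level-succ : ∀ {n x} → Level n x → Level (succ n) (𝒫 x)
  level-succ {n} {x} (g , s , p) = g ∪ ⦅ q , q ⦆ , sound , ∈-∪ʳ ∈-pairˡ
    where
    q = ⟨ succ n , 𝒫 x ⟩
    sound : Sound (g ∪ ⦅ q , q ⦆)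
    sound m y r with ∈-∪⁻ r
    ... | inj₁ r′ = map-⊎ (λ e → e) (λ (k , z , e , e′ , h) → k , z , e , e′ , ∈-∪ˡ h) (s m y r′)
    ... | inj₂ r′ with ⟨⟩-injective (∈-single⁻ r′)
    ... | refl , refl = inj₂ (n , x , refl , refl , ∈-∪ˡ p)

  level-zero⁻ : ∀ {x} → Level ∅ x → x ≡ ω
  level-zero⁻ (g , s , p) with s _ _ p
  ... | inj₁ (_ , e)         = e
  ... | inj₂ (m , _ , e , _) = ⊥-elim (succ≢∅ (sym e))

  level-succ⁻ : ∀ {n x} → Level (succ n) x → ∃ λ y → Level n y × x ≡ 𝒫 y
  level-succ⁻ (g , s , p) with s _ _ p
  ... | inj₁ (e , _) = ⊥-elim (succ≢∅ e)
  ... | inj₂ (m , y , e , e′ , q) with succ-injective e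
  ... | refl = y , (g , s , q) , e′

  level-unique : ∀ {n} → Nat n → ∀ x y → Level n x → Level n y → x ≡ y
  level-unique = ω-induction (∀ᵈ ∀ᵈ (levelᵈ #2 #1 ⇒ᵈ levelᵈ #2 #0 ⇒ᵈ #1 ≐ᵈ #0))
    (λ x y l l′ → trans (level-zero⁻ l) (sym (level-zero⁻ l′))) step
    where
    step : ∀ n → Nat n → (∀ x y → Level n x → Level n y → x ≡ y) →
           ∀ x y → Level (succ n) x → Level (succ n) y → x ≡ y
    step n p ih x y l l′ with level-succ⁻ l | level-succ⁻ l′
    ... | a , la , refl | b , lb , refl = cong 𝒫 (ih a b la lb)

  𝒫-mono : ∀ {x y} → x ⊆ y → 𝒫 x ⊆ 𝒫 y
  𝒫-mono s z m = from ∈-𝒫 λ w h → s w (to ∈-𝒫 m w h)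

  ω⊆𝒫 : ∀ {x} → ω ⊆ x → ω ⊆ 𝒫 x
  ω⊆𝒫 s n p = from ∈-𝒫 λ w h → s w (ω-transitive (∈ω⁻ p) w h)

  ω⊆level : ∀ {n} → Nat n → ∀ x → Level n x → ∀ z → z ∈ ω → z ∈ x
  ω⊆level = ω-induction (∀ᵈ (levelᵈ #1 #0 ⇒ᵈ ∀ᵈ (#0 ∈ᵈ const ω ⇒ᵈ #0 ∈ᵈ #1)))
    (λ x l → subst (ω ⊆_) (sym (level-zero⁻ l)) (λ z m → m)) step
    where
    step : ∀ n → Nat n → (∀ x → Level n x → ω ⊆ x) → ∀ x → Level (succ n) x → ω ⊆ x
    step n p ih x l with level-succ⁻ l
    ... | y , ly , refl = ω⊆𝒫 (ih y ly)

  -- The induction leaves the other index universally quantified, because a successor step strips a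
  -- power set from both levels; index zero is the least level by `ω⊆level`.
  level-comparable : ∀ {n} → Nat n → ∀ m x y → Nat m → Level n x → Level m y → x ⊆ y ⊎ y ⊆ x
  level-comparable = ω-induction
    (∀ᵈ ∀ᵈ ∀ᵈ (natᵈ #2 ⇒ᵈ levelᵈ #3 #1 ⇒ᵈ levelᵈ #2 #0 ⇒ᵈ
      ∀ᵈ (#0 ∈ᵈ #2 ⇒ᵈ #0 ∈ᵈ #1) ∨ᵈ ∀ᵈ (#0 ∈ᵈ #1 ⇒ᵈ #0 ∈ᵈ #2)))
    (λ m x y p l l′ → inj₁ (subst (_⊆ y) (sym (level-zero⁻ l)) (ω⊆level p y l′))) step
    where
    step : ∀ n → Nat n → (∀ m x y → Nat m → Level n x → Level m y → x ⊆ y ⊎ y ⊆ x) →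
           ∀ m x y → Nat m → Level (succ n) x → Level m y → x ⊆ y ⊎ y ⊆ x
    step n p ih m x y q l l′ with Nat-cases q
    ... | inj₁ refl = inj₂ (subst (_⊆ x) (sym (level-zero⁻ l′)) (ω⊆level (Nat-succ p) x l))
    ... | inj₂ (k , q′ , refl) with level-succ⁻ l | level-succ⁻ l′
    ... | a , la , refl | b , lb , refl = map-⊎ 𝒫-mono 𝒫-mono (ih k a b q′ la lb)

  opaque
    -- `V` is the union of the iterated power sets of ω, gathered by replacement. Of the levels
    -- containing two given elements one includes the other, and the next level after the larger
    -- contains their pair.
    pair-closed-set : ∃ λ V → ω ⊆ V × (∀ x y → x ∈ V → y ∈ V → ⦅ x , y ⦆ ∈ V)
    pair-closed-set with replace (levelᵈ #0 #1) ω (λ n p → level-unique (∈ω⁻ p))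
    ... | L , f with union L
    ... | V , h = V , (λ z m → from (h z) (ω , from (f ω) (∅ , ∈ω⁺ Nat-zero , level-zero) , m)) , closed
      where
      put : ∀ {n x z} → Nat n → Level n x → z ∈ x → z ∈ V
      put {x = x} p l m = from (h _) (x , from (f x) (_ , ∈ω⁺ p , l) , m)
      closed : ∀ x y → x ∈ V → y ∈ V → ⦅ x , y ⦆ ∈ V
      closed x y p q with to (h x) p | to (h y) q
      ... | a , a∈ , x∈a | b , b∈ , y∈b with to (f a) a∈ | to (f b) b∈
      ... | m , m∈ , la | n , n∈ , lb with level-comparable (∈ω⁻ m∈) n a b (∈ω⁻ n∈) la lb
      ... | inj₁ a⊆b = put (Nat-succ (∈ω⁻ n∈)) (level-succ lb) (from ∈-𝒫 λ w r →
              [ (λ { refl → a⊆b x x∈a }) , (λ { refl → y∈b }) ]′ (∈-pair⁻ r))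
      ... | inj₂ b⊆a = put (Nat-succ (∈ω⁻ m∈)) (level-succ la) (from ∈-𝒫 λ w r →
              [ (λ { refl → x∈a }) , (λ { refl → b⊆a y y∈b }) ]′ (∈-pair⁻ r))

  -- Assignments

  opaque
    product : ∀ a b → ∃ λ p → ∀ z → z ∈ p ⇔ (∃₂ λ x y → x ∈ a × y ∈ b × z ≡ ⟨ x , y ⟩)
    product a b with separate
      (∃ᵈ ∃ᵈ (#1 ∈ᵈ const a ∧ᵈ #0 ∈ᵈ const b ∧ᵈ #2 ≐ᵈ ⟨ #1 , #0 ⟩ᵈ)) (𝒫 (𝒫 (a ∪ b)))
    ... | p , f = p , λ z → ⇔-trans (f z) (mk⇔ proj₂ λ { (x , y , q , r , refl) →
      from ∈-𝒫 (λ w m → from ∈-𝒫 (bounded q r w (∈-pair⁻ m))) , x , y , q , r , refl })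
      where
      bounded : ∀ {x y} → x ∈ a → y ∈ b → ∀ w → w ≡ ⦅ x , x ⦆ ⊎ w ≡ ⦅ x , y ⦆ → ∀ v → v ∈ w → v ∈ a ∪ b
      bounded q r _ (inj₁ refl) v n with ∈-single⁻ n
      ... | refl = ∈-∪ˡ q
      bounded q r _ (inj₂ refl) v n with ∈-pair⁻ n
      ... | inj₁ refl = ∈-∪ˡ q
      ... | inj₂ refl = ∈-∪ʳ r

  _×ˢ_ : U → U → U
  a ×ˢ b = proj₁ (product a b)

  ∈-product : ∀ {a b x y} → x ∈ a → y ∈ b → ⟨ x , y ⟩ ∈ a ×ˢ b
  ∈-product p q = from (proj₂ (product _ _) _) (_ , _ , p , q , refl)

  ∈-product⁻ : ∀ {a b x y} → ⟨ x , y ⟩ ∈ a ×ˢ b → x ∈ a × y ∈ b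
  ∈-product⁻ m with to (proj₂ (product _ _) _) m
  ... | _ , _ , p , q , e with ⟨⟩-injective e
  ... | refl , refl = p , q

  opaque
    define-assignment : ∀ {R : Vec U 2 → Set} → Definable R → ∀ M →
      (∀ n → Nat n → ∃ λ a → a ∈ M × R (n ∷ a ∷ [])) →
      (∀ n a b → Nat n → R (n ∷ a ∷ []) → R (n ∷ b ∷ []) → a ≡ b) →
      ∃ λ s → Assignment M s × (∀ n a → ⟨ n , a ⟩ ∈ s ⇔ (Nat n × a ∈ M × R (n ∷ a ∷ [])))
    define-assignment {R} d M tot uni with separate
      (∃ᵈ ∃ᵈ (#2 ≐ᵈ ⟨ #1 , #0 ⟩ᵈ ∧ᵈ reindex₁₀ d)) (ω ×ˢ M)
    ... | s , f = s , record { graph = gr ; total = to′ ; univalent = un } , spec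
      where
      spec : ∀ n a → ⟨ n , a ⟩ ∈ s ⇔ (Nat n × a ∈ M × R (n ∷ a ∷ []))
      spec n a = mk⇔ fo (λ (p , q , r) → from (f _) (∈-product (∈ω⁺ p) q , n , a , refl , r))
        where
        fo : ⟨ n , a ⟩ ∈ s → Nat n × a ∈ M × R (n ∷ a ∷ [])
        fo m with to (f _) m
        ... | q , _ , _ , e , r with ⟨⟩-injective e
        ... | refl , refl = ∈ω⁻ (proj₁ (∈-product⁻ q)) , proj₂ (∈-product⁻ q) , r
      gr : ∀ z → z ∈ s → ∃₂ λ x y → Nat x × y ∈ M × z ≡ ⟨ x , y ⟩
      gr z m with to (f _) m
      ... | q , x , y , refl , r = x , y , ∈ω⁻ (proj₁ (∈-product⁻ q)) , proj₂ (∈-product⁻ q) , refl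
      to′ : ∀ n → Nat n → ∃ λ a → ⟨ n , a ⟩ ∈ s
      to′ n p = let a , q , r = tot n p in a , from (spec n a) (p , q , r)
      un : ∀ n a b → ⟨ n , a ⟩ ∈ s → ⟨ n , b ⟩ ∈ s → a ≡ b
      un n a b m m′ = let p , _ , r = to (spec n a) m ; _ , _ , r′ = to (spec n b) m′ in uni n a b p r r′

  module _ {n : ℕ} {m s : Vec U n → U} where
    opaque
      assignmentᵈ : Termᵈ m → Termᵈ s → Definable (λ xs → Assignment (m xs) (s xs))
      assignmentᵈ dm ds = mapᵈ
        (λ xs → mk⇔ (λ (g , t , u) → record { graph = g ; total = t ; univalent = u })
                    (λ F → let open Function F in graph , total , univalent))
        (∀ᵈ (#0 ∈ᵈ wk ds ⇒ᵈ ∃ᵈ ∃ᵈ (natᵈ #1 ∧ᵈ #0 ∈ᵈ wk (wk (wk dm)) ∧ᵈ #2 ≐ᵈ ⟨ #1 , #0 ⟩ᵈ)) ∧ᵈ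
         ∀ᵈ (natᵈ #0 ⇒ᵈ ∃ᵈ (⟨ #1 , #0 ⟩ᵈ ∈ᵈ wk (wk ds))) ∧ᵈ
         ∀ᵈ ∀ᵈ ∀ᵈ (⟨ #2 , #1 ⟩ᵈ ∈ᵈ wk (wk (wk ds)) ⇒ᵈ ⟨ #2 , #0 ⟩ᵈ ∈ᵈ wk (wk (wk ds)) ⇒ᵈ #1 ≐ᵈ #0))

  module _ {n : ℕ} {m s i t : Vec U n → U} where
    opaque
      variantᵈ : Termᵈ m → Termᵈ s → Termᵈ i → Termᵈ t →
                 Definable (λ xs → Variant (m xs) (s xs) (i xs) (t xs))
      variantᵈ dm ds di dt = assignmentᵈ dm dt ∧ᵈ
        ∀ᵈ (natᵈ #0 ⇒ᵈ ¬ᵈ (#0 ≐ᵈ wk di) ⇒ᵈ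
          ∀ᵈ (⟨ #1 , #0 ⟩ᵈ ∈ᵈ wk (wk dt) ⇔ᵈ ⟨ #1 , #0 ⟩ᵈ ∈ᵈ wk (wk ds)))

  opaque
    assignments : ∀ M → ∃ λ A → ∀ s → s ∈ A ⇔ Assignment M s
    assignments M with separate (assignmentᵈ (const M) #0) (𝒫 (ω ×ˢ M))
    ... | A , f = A , λ s → ⇔-trans (f s) (mk⇔ proj₂ λ as → from ∈-𝒫 (λ z m →
      let _ , _ , p , q , e = Function.graph as z m in subst (_∈ ω ×ˢ M) (sym e) (∈-product (∈ω⁺ p) q)) , as)

  -- Codes of formulas

  tag-injective : ∀ k l {x y} → ⟨ numeral k , x ⟩ ≡ ⟨ numeral l , y ⟩ → k ≡ l
  tag-injective k l e = numeral-injective k l (proj₁ (⟨⟩-injective e))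

  module _ {n : ℕ} {t u : Vec U n → U} (d : Termᵈ t) (e : Termᵈ u) where
    opaque
      ⌜∈⌝ᵈ : Termᵈ (λ xs → ⌜ t xs ∈ u xs ⌝)
      ⌜∈⌝ᵈ = ⟨ const (numeral 0) , ⟨ d , e ⟩ᵈ ⟩ᵈ
      ⌜≐⌝ᵈ : Termᵈ (λ xs → ⌜ t xs ≐ u xs ⌝)
      ⌜≐⌝ᵈ = ⟨ const (numeral 1) , ⟨ d , e ⟩ᵈ ⟩ᵈ
      ⌜∧⌝ᵈ : Termᵈ (λ xs → ⌜ t xs ∧ u xs ⌝)
      ⌜∧⌝ᵈ = ⟨ const (numeral 3) , ⟨ d , e ⟩ᵈ ⟩ᵈ
      ⌜∃⌝ᵈ : Termᵈ (λ xs → ⌜∃ t xs , u xs ⌝)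
      ⌜∃⌝ᵈ = ⟨ const (numeral 4) , ⟨ d , e ⟩ᵈ ⟩ᵈ

  code-∈ : ∀ {i j} → Nat i → Nat j → Code ⌜ i ∈ j ⌝
  code-∈ p q X c = FormulaClosed.mem c _ _ p q

  code-≐ : ∀ {i j} → Nat i → Nat j → Code ⌜ i ≐ j ⌝
  code-≐ p q X c = FormulaClosed.eq c _ _ p q

  code-¬ : ∀ {f} → Code f → Code ⌜¬ f ⌝
  code-¬ p X c = FormulaClosed.neg c _ (p X c)

  code-∧ : ∀ {f g} → Code f → Code g → Code ⌜ f ∧ g ⌝
  code-∧ p q X c = FormulaClosed.and c _ _ (p X c) (q X c)

  code-∃ : ∀ {i f} → Nat i → Code f → Code ⌜∃ i , f ⌝
  code-∃ p q X c = FormulaClosed.ex c _ _ p (q X c)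

  module _ {n : ℕ} {t : Vec U n → U} where
    opaque
      ⌜¬⌝ᵈ : Termᵈ t → Termᵈ (λ xs → ⌜¬ t xs ⌝)
      ⌜¬⌝ᵈ d = ⟨ const (numeral 2) , d ⟩ᵈ

  module _ {n : ℕ} {t : Vec U n → U} where
    opaque
      formulaClosedᵈ : Termᵈ t → Definable (λ xs → FormulaClosed (t xs))
      formulaClosedᵈ d = mapᵈ
        (λ xs → mk⇔ (λ (a , b , c , d , e) → record { mem = a ; eq = b ; neg = c ; and = d ; ex = e })
                    (λ F → let open FormulaClosed F in mem , eq , neg , and , ex))
        (∀ᵈ ∀ᵈ (natᵈ #1 ⇒ᵈ natᵈ #0 ⇒ᵈ ⌜∈⌝ᵈ #1 #0 ∈ᵈ wk (wk d)) ∧ᵈ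
         ∀ᵈ ∀ᵈ (natᵈ #1 ⇒ᵈ natᵈ #0 ⇒ᵈ ⌜≐⌝ᵈ #1 #0 ∈ᵈ wk (wk d)) ∧ᵈ
         ∀ᵈ (#0 ∈ᵈ wk d ⇒ᵈ ⌜¬⌝ᵈ #0 ∈ᵈ wk d) ∧ᵈ
         ∀ᵈ ∀ᵈ (#1 ∈ᵈ wk (wk d) ⇒ᵈ #0 ∈ᵈ wk (wk d) ⇒ᵈ ⌜∧⌝ᵈ #1 #0 ∈ᵈ wk (wk d)) ∧ᵈ
         ∀ᵈ ∀ᵈ (natᵈ #1 ⇒ᵈ #0 ∈ᵈ wk (wk d) ⇒ᵈ ⌜∃⌝ᵈ #1 #0 ∈ᵈ wk (wk d)))

  module _ {n : ℕ} {t : Vec U n → U} where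
    opaque
      codeᵈ : Termᵈ t → Definable (λ xs → Code (t xs))
      codeᵈ d = ∀ᵈ (formulaClosedᵈ #0 ⇒ᵈ wk d ∈ᵈ #0)

  opaque
    -- Codes are nested pairs over natural numbers and thus lie in the pair-closed set. This bounds
    -- the class `Code` by a set, from which separation can then cut.
    formula-closed-set : ∃ FormulaClosed
    formula-closed-set with pair-closed-set
    ... | V , ω⊆V , pc = V , record
      { mem = λ i j p q → opair (num 0) (opair (nat p) (nat q))
      ; eq  = λ i j p q → opair (num 1) (opair (nat p) (nat q))
      ; neg = λ f p → opair (num 2) p
      ; and = λ f g p q → opair (num 3) (opair p q)
      ; ex  = λ i f p q → opair (num 4) (opair (nat p) q) }
      where
      nat : ∀ {n} → Nat n → n ∈ V
      nat p = ω⊆V _ (∈ω⁺ p)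
      num : ∀ k → numeral k ∈ V
      num k = nat (Nat-numeral k)
      opair : ∀ {x y} → x ∈ V → y ∈ V → ⟨ x , y ⟩ ∈ V
      opair p q = pc _ _ (pc _ _ p p) (pc _ _ p q)

  𝒞 : U
  𝒞 = proj₁ formula-closed-set

  code∈𝒞 : ∀ {f} → Code f → f ∈ 𝒞
  code∈𝒞 p = p 𝒞 (proj₂ formula-closed-set)

  opaque
    -- A code belongs to every set closed under the formula operations, so it suffices that the
    -- codes with `Q` form such a set. This also covers codes of nonstandard formulas, which
    -- recursion in Agda cannot reach.
    code-induction : ∀ {Q : Vec U 1 → Set} → Definable Q →
      (∀ i j → Nat i → Nat j → Q (⌜ i ∈ j ⌝ ∷ [])) →
      (∀ i j → Nat i → Nat j → Q (⌜ i ≐ j ⌝ ∷ [])) →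
      (∀ f → Code f → Q (f ∷ []) → Q (⌜¬ f ⌝ ∷ [])) →
      (∀ f g → Code f → Code g → Q (f ∷ []) → Q (g ∷ []) → Q (⌜ f ∧ g ⌝ ∷ [])) →
      (∀ i f → Nat i → Code f → Q (f ∷ []) → Q (⌜∃ i , f ⌝ ∷ [])) →
      ∀ {f} → Code f → Q (f ∷ [])
    code-induction {Q} d qm qe qn qa qx {f} c with separate (codeᵈ #0 ∧ᵈ d) 𝒞
    ... | X , h = proj₂ (out (c X record
      { mem = λ i j p q → into (code-∈ p q) (qm i j p q)
      ; eq  = λ i j p q → into (code-≐ p q) (qe i j p q)
      ; neg = λ f p → let k , q = out p in into (code-¬ k) (qn f k q)
      ; and = λ f g p p′ → let k , q = out p ; k′ , q′ = out p′ in into (code-∧ k k′) (qa f g k k′ q q′)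
      ; ex  = λ i f n p → let k , q = out p in into (code-∃ n k) (qx i f n k q) }))
      where
      into : ∀ {f} → Code f → Q (f ∷ []) → f ∈ X
      into k q = from (h _) (code∈𝒞 k , k , q)
      out : ∀ {f} → f ∈ X → Code f × Q (f ∷ [])
      out p = proj₂ (to (h _) p)

  -- Tarski's recursion

  module Truth (M : U) where

    𝒜 : U
    𝒜 = proj₁ (assignments M)

    ∈𝒜 : ∀ {s} → s ∈ 𝒜 ⇔ Assignment M s
    ∈𝒜 = proj₂ (assignments M) _

    MemClause EqClause : U → U → Set
    MemClause f A = ∃₂ λ i j → Nat i × Nat j × f ≡ ⌜ i ∈ j ⌝ ×
      (∀ s → s ∈ A ⇔ (s ∈ 𝒜 × ∃₂ λ a b → ⟨ i , a ⟩ ∈ s × ⟨ j , b ⟩ ∈ s × a ∈ b))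
    EqClause f A = ∃₂ λ i j → Nat i × Nat j × f ≡ ⌜ i ≐ j ⌝ ×
      (∀ s → s ∈ A ⇔ (s ∈ 𝒜 × ∃₂ λ a b → ⟨ i , a ⟩ ∈ s × ⟨ j , b ⟩ ∈ s × a ≡ b))

    NegClause AndClause ExClause : U → U → U → Set
    NegClause g f A = ∃₂ λ h B → f ≡ ⌜¬ h ⌝ × ⟨ h , B ⟩ ∈ g × (∀ s → s ∈ A ⇔ (s ∈ 𝒜 × ¬ s ∈ B))
    AndClause g f A = ∃₂ λ h B → ∃₂ λ k C → f ≡ ⌜ h ∧ k ⌝ × ⟨ h , B ⟩ ∈ g × ⟨ k , C ⟩ ∈ g ×
      (∀ s → s ∈ A ⇔ (s ∈ B × s ∈ C))
    ExClause g f A = ∃ λ i → ∃₂ λ h B → Nat i × f ≡ ⌜∃ i , h ⌝ × ⟨ h , B ⟩ ∈ g ×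
      (∀ s → s ∈ A ⇔ (s ∈ 𝒜 × ∃ λ t → Variant M s i t × t ∈ B))

    Justified : U → U → U → Set
    Justified g f A = MemClause f A ⊎ EqClause f A ⊎ NegClause g f A ⊎ AndClause g f A ⊎ ExClause g f A

    -- The approximations `g` to the truth function need not be single-valued, so the union of two
    -- of them is again one without any check of agreement. Uniqueness of the values is a separate
    -- induction on codes.
    SoundTruth : U → Set
    SoundTruth g = ∀ f A → ⟨ f , A ⟩ ∈ g → Justified g f A

    -- A is the set of the assignments that satisfy f.
    Value : U → U → Set
    Value f A = ∃ λ g → SoundTruth g × ⟨ f , A ⟩ ∈ g

    opaque
      valueᵈ : ∀ {n} {t u : Vec U n → U} → Termᵈ t → Termᵈ u → Definable (λ xs → Value (t xs) (u xs))
      valueᵈ d e = ∃ᵈ (∀ᵈ ∀ᵈ (⟨ #1 , #0 ⟩ᵈ ∈ᵈ #2 ⇒ᵈ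
          (∃ᵈ ∃ᵈ (natᵈ #1 ∧ᵈ natᵈ #0 ∧ᵈ #3 ≐ᵈ ⌜∈⌝ᵈ #1 #0 ∧ᵈ
            ∀ᵈ (#0 ∈ᵈ #3 ⇔ᵈ (#0 ∈ᵈ const 𝒜 ∧ᵈ
              ∃ᵈ ∃ᵈ (⟨ #4 , #1 ⟩ᵈ ∈ᵈ #2 ∧ᵈ ⟨ #3 , #0 ⟩ᵈ ∈ᵈ #2 ∧ᵈ #1 ∈ᵈ #0)))) ∨ᵈ
           ∃ᵈ ∃ᵈ (natᵈ #1 ∧ᵈ natᵈ #0 ∧ᵈ #3 ≐ᵈ ⌜≐⌝ᵈ #1 #0 ∧ᵈ
            ∀ᵈ (#0 ∈ᵈ #3 ⇔ᵈ (#0 ∈ᵈ const 𝒜 ∧ᵈ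
              ∃ᵈ ∃ᵈ (⟨ #4 , #1 ⟩ᵈ ∈ᵈ #2 ∧ᵈ ⟨ #3 , #0 ⟩ᵈ ∈ᵈ #2 ∧ᵈ #1 ≐ᵈ #0)))) ∨ᵈ
           ∃ᵈ ∃ᵈ (#3 ≐ᵈ ⌜¬⌝ᵈ #1 ∧ᵈ ⟨ #1 , #0 ⟩ᵈ ∈ᵈ #4 ∧ᵈ
            ∀ᵈ (#0 ∈ᵈ #3 ⇔ᵈ (#0 ∈ᵈ const 𝒜 ∧ᵈ ¬ᵈ (#0 ∈ᵈ #1)))) ∨ᵈ
           ∃ᵈ ∃ᵈ ∃ᵈ ∃ᵈ (#5 ≐ᵈ ⌜∧⌝ᵈ #3 #1 ∧ᵈ ⟨ #3 , #2 ⟩ᵈ ∈ᵈ #6 ∧ᵈ ⟨ #1 , #0 ⟩ᵈ ∈ᵈ #6 ∧ᵈ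
            ∀ᵈ (#0 ∈ᵈ #5 ⇔ᵈ (#0 ∈ᵈ #3 ∧ᵈ #0 ∈ᵈ #1))) ∨ᵈ
           ∃ᵈ ∃ᵈ ∃ᵈ (natᵈ #2 ∧ᵈ #4 ≐ᵈ ⌜∃⌝ᵈ #2 #1 ∧ᵈ ⟨ #1 , #0 ⟩ᵈ ∈ᵈ #5 ∧ᵈ
            ∀ᵈ (#0 ∈ᵈ #4 ⇔ᵈ (#0 ∈ᵈ const 𝒜 ∧ᵈ
              ∃ᵈ (variantᵈ (const M) #1 #4 #0 ∧ᵈ #0 ∈ᵈ #2))))))
        ∧ᵈ ⟨ wk d , wk e ⟩ᵈ ∈ᵈ #0)

    justified-mono : ∀ {g g′ f A} → g ⊆ g′ → Justified g f A → Justified g′ f A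
    justified-mono s (inj₁ j) = inj₁ j
    justified-mono s (inj₂ (inj₁ j)) = inj₂ (inj₁ j)
    justified-mono s (inj₂ (inj₂ (inj₁ (h , B , e , m , r)))) = inj₂ (inj₂ (inj₁ (h , B , e , s _ m , r)))
    justified-mono s (inj₂ (inj₂ (inj₂ (inj₁ (h , B , k , C , e , m , m′ , r))))) =
      inj₂ (inj₂ (inj₂ (inj₁ (h , B , k , C , e , s _ m , s _ m′ , r))))
    justified-mono s (inj₂ (inj₂ (inj₂ (inj₂ (i , h , B , p , e , m , r))))) =
      inj₂ (inj₂ (inj₂ (inj₂ (i , h , B , p , e , s _ m , r))))

    sound-∪ : ∀ {g g′} → SoundTruth g → SoundTruth g′ → SoundTruth (g ∪ g′)
    sound-∪ p q f A m with ∈-∪⁻ m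
    ... | inj₁ n = justified-mono (λ z → ∈-∪ˡ) (p f A n)
    ... | inj₂ n = justified-mono (λ z → ∈-∪ʳ) (q f A n)

    sound-∅ : SoundTruth ∅
    sound-∅ f A m = ⊥-elim (∉∅ m)

    value-add : ∀ {g f A} → SoundTruth g → Justified g f A → Value f A
    value-add {g} {f} {A} s j = g ∪ ⦅ ⟨ f , A ⟩ , ⟨ f , A ⟩ ⦆ , sound , ∈-∪ʳ ∈-pairˡ
      where
      sound : SoundTruth (g ∪ ⦅ ⟨ f , A ⟩ , ⟨ f , A ⟩ ⦆)
      sound h B m with ∈-∪⁻ m
      ... | inj₁ n = justified-mono (λ z → ∈-∪ˡ) (s h B n)
      ... | inj₂ n with ⟨⟩-injective (∈-single⁻ n)
      ... | refl , refl = justified-mono (λ z → ∈-∪ˡ) j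

    opaque
      value-∈ : ∀ {i j} → Nat i → Nat j → ∃ λ A → Value ⌜ i ∈ j ⌝ A ×
        (∀ s → s ∈ A ⇔ (s ∈ 𝒜 × ∃₂ λ a b → ⟨ i , a ⟩ ∈ s × ⟨ j , b ⟩ ∈ s × a ∈ b))
      value-∈ {i} {j} p q with separate
        (∃ᵈ ∃ᵈ (⟨ const i , #1 ⟩ᵈ ∈ᵈ #2 ∧ᵈ ⟨ const j , #0 ⟩ᵈ ∈ᵈ #2 ∧ᵈ #1 ∈ᵈ #0)) 𝒜
      ... | A , r = A , value-add sound-∅ (inj₁ (i , j , p , q , refl , r)) , r

    opaque
      value-≐ : ∀ {i j} → Nat i → Nat j → ∃ λ A → Value ⌜ i ≐ j ⌝ A ×
        (∀ s → s ∈ A ⇔ (s ∈ 𝒜 × ∃₂ λ a b → ⟨ i , a ⟩ ∈ s × ⟨ j , b ⟩ ∈ s × a ≡ b))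
      value-≐ {i} {j} p q with separate
        (∃ᵈ ∃ᵈ (⟨ const i , #1 ⟩ᵈ ∈ᵈ #2 ∧ᵈ ⟨ const j , #0 ⟩ᵈ ∈ᵈ #2 ∧ᵈ #1 ≐ᵈ #0)) 𝒜
      ... | A , r = A , value-add sound-∅ (inj₂ (inj₁ (i , j , p , q , refl , r))) , r

    opaque
      value-¬ : ∀ {h B} → Value h B → ∃ λ A → Value ⌜¬ h ⌝ A × (∀ s → s ∈ A ⇔ (s ∈ 𝒜 × ¬ s ∈ B))
      value-¬ {h} {B} (g , s , m) with separate (¬ᵈ (#0 ∈ᵈ const B)) 𝒜
      ... | A , r = A , value-add s (inj₂ (inj₂ (inj₁ (h , B , refl , m , r)))) , r

    opaque
      value-∧ : ∀ {h B k C} → Value h B → Value k C →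
                ∃ λ A → Value ⌜ h ∧ k ⌝ A × (∀ s → s ∈ A ⇔ (s ∈ B × s ∈ C))
      value-∧ {h} {B} {k} {C} (g , s , m) (g′ , s′ , m′) with separate (#0 ∈ᵈ const C) B
      ... | A , r = A , value-add (sound-∪ s s′)
        (inj₂ (inj₂ (inj₂ (inj₁ (h , B , k , C , refl , ∈-∪ˡ m , ∈-∪ʳ m′ , r))))) , r

    opaque
      value-∃ : ∀ {i h B} → Nat i → Value h B → ∃ λ A → Value ⌜∃ i , h ⌝ A ×
                (∀ s → s ∈ A ⇔ (s ∈ 𝒜 × ∃ λ t → Variant M s i t × t ∈ B))
      value-∃ {i} {h} {B} p (g , s , m) with separate
        (∃ᵈ (variantᵈ (const M) #1 (const i) #0 ∧ᵈ #0 ∈ᵈ const B)) 𝒜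
      ... | A , r = A , value-add s (inj₂ (inj₂ (inj₂ (inj₂ (i , h , B , p , refl , m , r))))) , r

    opaque
      value-exists : ∀ {f} → Code f → ∃ (Value f)
      value-exists = code-induction (∃ᵈ valueᵈ #1 #0)
        (λ i j p q → let A , v , _ = value-∈ p q in A , v)
        (λ i j p q → let A , v , _ = value-≐ p q in A , v)
        (λ f _ (B , v) → let A , w , _ = value-¬ v in A , w)
        (λ f g _ _ (B , v) (C , w) → let A , x , _ = value-∧ v w in A , x)
        (λ i f p _ (B , v) → let A , w , _ = value-∃ p v in A , w)

    opaque
      -- The numeral tags distinguish the five kinds of codes, so only one clause can justify the
      -- pair; injectivity of pairing then identifies the components. The other inversions work in
      -- the same way.
      value-∈⁻ : ∀ {i j A} → Value ⌜ i ∈ j ⌝ A →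
        (∀ s → s ∈ A ⇔ (s ∈ 𝒜 × ∃₂ λ a b → ⟨ i , a ⟩ ∈ s × ⟨ j , b ⟩ ∈ s × a ∈ b))
      value-∈⁻ (g , s , m) with s _ _ m
      ... | inj₁ (_ , _ , _ , _ , e , r) with ⟨⟩-injective (proj₂ (⟨⟩-injective e))
      ... | refl , refl = r
      value-∈⁻ (g , s , m) | inj₂ (inj₁ (_ , _ , _ , _ , e , _)) = case tag-injective 0 1 e of λ ()
      value-∈⁻ (g , s , m) | inj₂ (inj₂ (inj₁ (_ , _ , e , _))) = case tag-injective 0 2 e of λ ()
      value-∈⁻ (g , s , m) | inj₂ (inj₂ (inj₂ (inj₁ (_ , _ , _ , _ , e , _)))) = case tag-injective 0 3 e of λ ()
      value-∈⁻ (g , s , m) | inj₂ (inj₂ (inj₂ (inj₂ (_ , _ , _ , _ , e , _)))) = case tag-injective 0 4 e of λ ()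

      value-≐⁻ : ∀ {i j A} → Value ⌜ i ≐ j ⌝ A →
        (∀ s → s ∈ A ⇔ (s ∈ 𝒜 × ∃₂ λ a b → ⟨ i , a ⟩ ∈ s × ⟨ j , b ⟩ ∈ s × a ≡ b))
      value-≐⁻ (g , s , m) with s _ _ m
      ... | inj₂ (inj₁ (_ , _ , _ , _ , e , r)) with ⟨⟩-injective (proj₂ (⟨⟩-injective e))
      ... | refl , refl = r
      value-≐⁻ (g , s , m) | inj₁ (_ , _ , _ , _ , e , _) = case tag-injective 1 0 e of λ ()
      value-≐⁻ (g , s , m) | inj₂ (inj₂ (inj₁ (_ , _ , e , _))) = case tag-injective 1 2 e of λ ()
      value-≐⁻ (g , s , m) | inj₂ (inj₂ (inj₂ (inj₁ (_ , _ , _ , _ , e , _)))) = case tag-injective 1 3 e of λ ()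
      value-≐⁻ (g , s , m) | inj₂ (inj₂ (inj₂ (inj₂ (_ , _ , _ , _ , e , _)))) = case tag-injective 1 4 e of λ ()

      value-¬⁻ : ∀ {h A} → Value ⌜¬ h ⌝ A → ∃ λ B → Value h B × (∀ s → s ∈ A ⇔ (s ∈ 𝒜 × ¬ s ∈ B))
      value-¬⁻ (g , s , m) with s _ _ m
      ... | inj₂ (inj₂ (inj₁ (_ , B , e , n , r))) with proj₂ (⟨⟩-injective e)
      ... | refl = B , (g , s , n) , r
      value-¬⁻ (g , s , m) | inj₁ (_ , _ , _ , _ , e , _) = case tag-injective 2 0 e of λ ()
      value-¬⁻ (g , s , m) | inj₂ (inj₁ (_ , _ , _ , _ , e , _)) = case tag-injective 2 1 e of λ ()
      value-¬⁻ (g , s , m) | inj₂ (inj₂ (inj₂ (inj₁ (_ , _ , _ , _ , e , _)))) = case tag-injective 2 3 e of λ ()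
      value-¬⁻ (g , s , m) | inj₂ (inj₂ (inj₂ (inj₂ (_ , _ , _ , _ , e , _)))) = case tag-injective 2 4 e of λ ()

      value-∧⁻ : ∀ {h k A} → Value ⌜ h ∧ k ⌝ A →
                 ∃₂ λ B C → Value h B × Value k C × (∀ s → s ∈ A ⇔ (s ∈ B × s ∈ C))
      value-∧⁻ (g , s , m) with s _ _ m
      ... | inj₂ (inj₂ (inj₂ (inj₁ (_ , B , _ , C , e , n , n′ , r)))) with ⟨⟩-injective (proj₂ (⟨⟩-injective e))
      ... | refl , refl = B , C , (g , s , n) , (g , s , n′) , r
      value-∧⁻ (g , s , m) | inj₁ (_ , _ , _ , _ , e , _) = case tag-injective 3 0 e of λ ()
      value-∧⁻ (g , s , m) | inj₂ (inj₁ (_ , _ , _ , _ , e , _)) = case tag-injective 3 1 e of λ ()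
      value-∧⁻ (g , s , m) | inj₂ (inj₂ (inj₁ (_ , _ , e , _))) = case tag-injective 3 2 e of λ ()
      value-∧⁻ (g , s , m) | inj₂ (inj₂ (inj₂ (inj₂ (_ , _ , _ , _ , e , _)))) = case tag-injective 3 4 e of λ ()

      value-∃⁻ : ∀ {i h A} → Value ⌜∃ i , h ⌝ A → ∃ λ B → Value h B ×
                 (∀ s → s ∈ A ⇔ (s ∈ 𝒜 × ∃ λ t → Variant M s i t × t ∈ B))
      value-∃⁻ (g , s , m) with s _ _ m
      ... | inj₂ (inj₂ (inj₂ (inj₂ (_ , _ , B , _ , e , n , r)))) with ⟨⟩-injective (proj₂ (⟨⟩-injective e))
      ... | refl , refl = B , (g , s , n) , r
      value-∃⁻ (g , s , m) | inj₁ (_ , _ , _ , _ , e , _) = case tag-injective 4 0 e of λ ()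
      value-∃⁻ (g , s , m) | inj₂ (inj₁ (_ , _ , _ , _ , e , _)) = case tag-injective 4 1 e of λ ()
      value-∃⁻ (g , s , m) | inj₂ (inj₂ (inj₁ (_ , _ , e , _))) = case tag-injective 4 2 e of λ ()
      value-∃⁻ (g , s , m) | inj₂ (inj₂ (inj₂ (inj₁ (_ , _ , _ , _ , e , _)))) = case tag-injective 4 3 e of λ ()

    private
      same : ∀ {A B : U} {P : U → Set} → (∀ s → s ∈ A ⇔ P s) → (∀ s → s ∈ B ⇔ P s) → A ≡ B
      same p q = extensionality λ s → ⇔-trans (p s) (⇔-sym (q s))

    opaque
      value-unique : ∀ {f} → Code f → ∀ A B → Value f A → Value f B → A ≡ B
      value-unique = code-induction (∀ᵈ ∀ᵈ (valueᵈ #2 #1 ⇒ᵈ valueᵈ #2 #0 ⇒ᵈ #1 ≐ᵈ #0))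
        (λ i j _ _ A B v w → same (value-∈⁻ v) (value-∈⁻ w))
        (λ i j _ _ A B v w → same (value-≐⁻ v) (value-≐⁻ w))
        un-¬ un-∧ un-∃
        where
        Unique : U → Set
        Unique f = ∀ A B → Value f A → Value f B → A ≡ B
        un-¬ : ∀ f → Code f → Unique f → Unique ⌜¬ f ⌝
        un-¬ f _ ih A B v w with value-¬⁻ v | value-¬⁻ w
        ... | A′ , v′ , r | B′ , w′ , r′ with ih A′ B′ v′ w′
        ... | refl = same r r′
        un-∧ : ∀ f g → Code f → Code g → Unique f → Unique g → Unique ⌜ f ∧ g ⌝
        un-∧ f g _ _ ihf ihg A B v w with value-∧⁻ v | value-∧⁻ w
        ... | A′ , C , v′ , x , r | B′ , D , w′ , y , r′ with ihf A′ B′ v′ w′ | ihg C D x y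
        ... | refl | refl = same r r′
        un-∃ : ∀ i f → Nat i → Code f → Unique f → Unique ⌜∃ i , f ⌝
        un-∃ i f _ _ ih A B v w with value-∃⁻ v | value-∃⁻ w
        ... | A′ , v′ , r | B′ , w′ , r′ with ih A′ B′ v′ w′
        ... | refl = same r r′

    opaque
      -- Collects all values into one set of pairs; by uniqueness of values, membership does not
      -- depend on which value witnesses it.
      truth-set : ∃ λ T → ∀ {f A s} → Code f → Value f A → Assignment M s → ⟨ f , s ⟩ ∈ T ⇔ s ∈ A
      truth-set with separate (∃ᵈ ∃ᵈ ∃ᵈ (#3 ≐ᵈ ⟨ #2 , #1 ⟩ᵈ ∧ᵈ valueᵈ #2 #0 ∧ᵈ #1 ∈ᵈ #0)) (𝒞 ×ˢ 𝒜)
      ... | T , h = T , λ c v as → mk⇔ (forth c v)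
                      (λ m → from (h _) (∈-product (code∈𝒞 c) (from ∈𝒜 as) , _ , _ , _ , refl , v , m))
        where
        forth : ∀ {f A s} → Code f → Value f A → ⟨ f , s ⟩ ∈ T → s ∈ A
        forth c v m with to (h _) m
        ... | _ , _ , _ , B , e , w , n with ⟨⟩-injective e
        ... | refl , refl with value-unique c _ B v w
        ... | refl = n

    opaque
      satisfaction-exists : ∃ (SatisfactionRelation M)
      satisfaction-exists = T , record
        { mem = λ i j s p q as → let A , v , r = value-∈ p q in
            ⇔-trans (T-spec (code-∈ p q) v as) (with-𝒜 as (r s))
        ; eq  = λ i j s p q as → let A , v , r = value-≐ p q in
            ⇔-trans (T-spec (code-≐ p q) v as) (with-𝒜 as (r s))
        ; neg = λ f s c as → let B , w = value-exists c ; A , v , r = value-¬ w ; e = T-spec c w as in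
            ⇔-trans (T-spec (code-¬ c) v as) (⇔-trans (with-𝒜 as (r s))
              (mk⇔ (_∘ to e) (_∘ from e)))
        ; and = λ f g s c d as → let B , w = value-exists c ; C , x = value-exists d ; A , v , r = value-∧ w x in
            ⇔-trans (T-spec (code-∧ c d) v as) (⇔-trans (r s) (mk⇔
              (λ (p , q) → from (T-spec c w as) p , from (T-spec d x as) q)
              (λ (p , q) → to (T-spec c w as) p , to (T-spec d x as) q)))
        ; ex  = λ i f s p c as → let B , w = value-exists c ; A , v , r = value-∃ p w in
            ⇔-trans (T-spec (code-∃ p c) v as) (⇔-trans (with-𝒜 as (r s)) (mk⇔
              (λ (t , w′ , m) → t , w′ , from (T-spec c w (proj₁ w′)) m)
              (λ (t , w′ , m) → t , w′ , to (T-spec c w (proj₁ w′)) m))) }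
        where
        T : U
        T = proj₁ truth-set
        T-spec : ∀ {f A s} → Code f → Value f A → Assignment M s → ⟨ f , s ⟩ ∈ T ⇔ s ∈ A
        T-spec = proj₂ truth-set
        with-𝒜 : ∀ {s} {P Q : Set} → Assignment M s → P ⇔ (s ∈ 𝒜 × Q) → P ⇔ Q
        with-𝒜 as e = ⇔-trans e (mk⇔ proj₂ λ q → from ∈𝒜 as , q)

    opaque
      -- Tarski's clauses say nothing about pairs other than codes with assignments, so agreement is
      -- confined to these. It frees `M ⊨ f [ s ]` from the choice of the satisfaction relation.
      satisfaction-unique : ∀ {T T′} → SatisfactionRelation M T → SatisfactionRelation M T′ →
        ∀ {f} → Code f → ∀ s → Assignment M s → ⟨ f , s ⟩ ∈ T ⇔ ⟨ f , s ⟩ ∈ T′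
      satisfaction-unique {T} {T′} σ σ′ = code-induction
        (∀ᵈ (assignmentᵈ (const M) #0 ⇒ᵈ ⟨ #1 , #0 ⟩ᵈ ∈ᵈ const T ⇔ᵈ ⟨ #1 , #0 ⟩ᵈ ∈ᵈ const T′))
        (λ i j p q s as → ⇔-trans (R.mem i j s p q as) (⇔-sym (R′.mem i j s p q as)))
        (λ i j p q s as → ⇔-trans (R.eq i j s p q as) (⇔-sym (R′.eq i j s p q as)))
        (λ f c ih s as → ⇔-trans (R.neg f s c as) (⇔-trans
          (mk⇔ (_∘ from (ih s as)) (_∘ to (ih s as))) (⇔-sym (R′.neg f s c as))))
        (λ f g c d ihf ihg s as → ⇔-trans (R.and f g s c d as) (⇔-trans
          (mk⇔ (λ (p , q) → to (ihf s as) p , to (ihg s as) q)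
               (λ (p , q) → from (ihf s as) p , from (ihg s as) q)) (⇔-sym (R′.and f g s c d as))))
        (λ i f p c ih s as → ⇔-trans (R.ex i f s p c as) (⇔-trans
          (mk⇔ (λ (t , v , q) → t , v , to (ih t (proj₁ v)) q)
               (λ (t , v , q) → t , v , from (ih t (proj₁ v)) q)) (⇔-sym (R′.ex i f s p c as))))
        where
        module R = SatisfactionRelation σ
        module R′ = SatisfactionRelation σ′

    ⊨⇔ : ∀ {T f s} → SatisfactionRelation M T → Code f → Assignment M s → M ⊨ f [ s ] ⇔ ⟨ f , s ⟩ ∈ T
    ⊨⇔ σ c as = mk⇔ (λ (_ , σ′ , m) → to (satisfaction-unique σ′ σ c _ as) m) (λ m → _ , σ , m)

  -- Elementary embeddings

  entry-Nat : ∀ {M s n a} → Assignment M s → ⟨ n , a ⟩ ∈ s → Nat n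
  entry-Nat as m with Function.graph as _ m
  ... | _ , _ , p , _ , e with ⟨⟩-injective e
  ... | refl , refl = p

  entry-∈ : ∀ {M s n a} → Assignment M s → ⟨ n , a ⟩ ∈ s → a ∈ M
  entry-∈ as m with Function.graph as _ m
  ... | _ , _ , _ , q , e with ⟨⟩-injective e
  ... | refl , refl = q

  one : U
  one = numeral 1

  Nat-one : Nat one
  Nat-one = Nat-numeral 1

  one≢∅ : one ≢ ∅
  one≢∅ = succ≢∅

  module Evaluation (P : U) where

    open Truth P using (satisfaction-exists; ⊨⇔)

    -- Assignments are total on ω: variable 0 takes the value `x` and every other variable takes
    -- `y`. Changing variable 0 then yields an assignment of the same form, and an embedding carries
    -- such assignments to such assignments.
    Pairing : U → U → U → Set
    Pairing x y s = Assignment P s ×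
      (∀ n a → Nat n → ⟨ n , a ⟩ ∈ s ⇔ ((n ≡ ∅ × a ≡ x) ⊎ (n ≢ ∅ × a ≡ y)))

    opaque
      assign : ∀ {x y} → x ∈ P → y ∈ P → ∃ (Pairing x y)
      assign {x} {y} p q with define-assignment
        ((#0 ≐ᵈ const ∅ ∧ᵈ #1 ≐ᵈ const x) ∨ᵈ (¬ᵈ (#0 ≐ᵈ const ∅) ∧ᵈ #1 ≐ᵈ const y)) P tot
        (λ { n a b _ (inj₁ (refl , refl)) (inj₁ (_ , refl)) → refl
           ; n a b _ (inj₁ (refl , refl)) (inj₂ (k , _)) → ⊥-elim (k refl)
           ; n a b _ (inj₂ (k , _)) (inj₁ (refl , _)) → ⊥-elim (k refl)
           ; n a b _ (inj₂ (_ , refl)) (inj₂ (_ , refl)) → refl })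
        where
        tot : ∀ n → Nat n → ∃ λ a → a ∈ P × ((n ≡ ∅ × a ≡ x) ⊎ (n ≢ ∅ × a ≡ y))
        tot n _ with em {P = n ≡ ∅}
        ... | yes e = x , p , inj₁ (e , refl)
        ... | no k  = y , q , inj₂ (k , refl)
      ... | s , as , f = s , as , λ n a ν → ⇔-trans (f n a) (mk⇔ (λ (_ , _ , r) → r) λ
        { (inj₁ (e , refl)) → ν , p , inj₁ (e , refl) ; (inj₂ (k , refl)) → ν , q , inj₂ (k , refl) })

    module _ {x y s : U} (π : Pairing x y s) where

      entry₀ : ∀ {a} → ⟨ ∅ , a ⟩ ∈ s ⇔ a ≡ x
      entry₀ = ⇔-trans (proj₂ π _ _ Nat-zero) (mk⇔
        [ proj₂ , (λ (k , _) → ⊥-elim (k refl)) ]′ (λ e → inj₁ (refl , e)))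

      entry₁ : ∀ {a} → ⟨ one , a ⟩ ∈ s ⇔ a ≡ y
      entry₁ = ⇔-trans (proj₂ π _ _ Nat-one) (mk⇔
        [ (λ (e , _) → ⊥-elim (one≢∅ e)) , proj₂ ]′ (λ e → inj₂ (one≢∅ , e)))

    opaque
      evaluate-∈ : ∀ {x y s} → Pairing x y s → P ⊨ ⌜ one ∈ ∅ ⌝ [ s ] ⇔ y ∈ x
      evaluate-∈ {x} {y} {s} π = let T , σ = satisfaction-exists in
        ⇔-trans (⊨⇔ σ (code-∈ Nat-one Nat-zero) (proj₁ π))
        (⇔-trans (SatisfactionRelation.mem σ one ∅ s Nat-one Nat-zero (proj₁ π)) (mk⇔
          (λ (a , b , p , q , m) → subst₂ _∈_ (to (entry₁ π) p) (to (entry₀ π) q) m)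
          (λ m → y , x , from (entry₁ π) refl , from (entry₀ π) refl , m)))

    opaque
      evaluate-≐ : ∀ {x y s} → Pairing x y s → P ⊨ ⌜ one ≐ ∅ ⌝ [ s ] ⇔ y ≡ x
      evaluate-≐ {x} {y} {s} π = let T , σ = satisfaction-exists in
        ⇔-trans (⊨⇔ σ (code-≐ Nat-one Nat-zero) (proj₁ π))
        (⇔-trans (SatisfactionRelation.eq σ one ∅ s Nat-one Nat-zero (proj₁ π)) (mk⇔
          (λ (a , b , p , q , m) → subst₂ _≡_ (to (entry₁ π) p) (to (entry₀ π) q) m)
          (λ m → y , x , from (entry₁ π) refl , from (entry₀ π) refl , m)))

    opaque
      -- The formula says that the value of variable 1 belongs to something. It distinguishes the
      -- one point of a world that belongs to no other.
      evaluate-∃∋ : ∀ {x y s} → y ∈ P → Pairing x y s →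
                    P ⊨ ⌜∃ ∅ , ⌜ one ∈ ∅ ⌝ ⌝ [ s ] ⇔ (∃ λ z → z ∈ P × y ∈ z)
      evaluate-∃∋ {x} {y} {s} y∈P π = let T , σ = satisfaction-exists in
        ⇔-trans (⊨⇔ σ (code-∃ Nat-zero code) (proj₁ π))
        (⇔-trans (SatisfactionRelation.ex σ ∅ ⌜ one ∈ ∅ ⌝ s Nat-zero code (proj₁ π))
          (mk⇔ (forth σ) (back σ)))
        where
        code : Code ⌜ one ∈ ∅ ⌝
        code = code-∈ Nat-one Nat-zero
        forth : ∀ {T} → SatisfactionRelation P T →
                (∃ λ t → Variant P s ∅ t × ⟨ ⌜ one ∈ ∅ ⌝ , t ⟩ ∈ T) → ∃ λ z → z ∈ P × y ∈ z
        forth σ (t , (at , v) , m) with to (SatisfactionRelation.mem σ one ∅ t Nat-one Nat-zero at) m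
        ... | a , z , p , q , a∈z = z , entry-∈ at q ,
              subst (_∈ z) (to (entry₁ π) (to (v one Nat-one one≢∅ a) p)) a∈z
        back : ∀ {T} → SatisfactionRelation P T →
               (∃ λ z → z ∈ P × y ∈ z) → ∃ λ t → Variant P s ∅ t × ⟨ ⌜ one ∈ ∅ ⌝ , t ⟩ ∈ T
        back σ (z , z∈P , y∈z) with assign z∈P y∈P
        ... | t , π′ = t , (proj₁ π′ , λ n p k a → ⇔-trans (proj₂ π′ n a p) (⇔-trans (mk⇔
                [ (λ (e , _) → ⊥-elim (k e)) , inj₂ ]′ [ (λ (e , _) → ⊥-elim (k e)) , inj₂ ]′)
                (⇔-sym (proj₂ π n a p)))) ,
              from (SatisfactionRelation.mem σ one ∅ t Nat-one Nat-zero (proj₁ π′))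
                (y , z , from (entry₁ π′) refl , from (entry₀ π′) refl , y∈z)

  module Embedding {j P : U} (ε : ElementaryEmbedding j P P) where

    open ElementaryEmbedding ε
    open Function function using (total; univalent)
    open Evaluation P

    value∈ : ∀ {x y} → ⟨ x , y ⟩ ∈ j → x ∈ P × y ∈ P
    value∈ m with Function.graph function _ m
    ... | _ , _ , p , q , e with ⟨⟩-injective e
    ... | refl , refl = p , q

    transfer : ∀ {f x y x′ y′} {A A′ : Set} → Code f → ⟨ x , x′ ⟩ ∈ j → ⟨ y , y′ ⟩ ∈ j →
               (∀ {s} → Pairing x y s → P ⊨ f [ s ] ⇔ A) →
               (∀ {s} → Pairing x′ y′ s → P ⊨ f [ s ] ⇔ A′) → A ⇔ A′
    transfer c m n ev ev′ with assign (proj₁ (value∈ m)) (proj₁ (value∈ n)) | assign (proj₂ (value∈ m)) (proj₂ (value∈ n))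
    ... | s , π | t , π′ = ⇔-trans (⇔-sym (ev π)) (⇔-trans (elementary _ s t c (proj₁ π) (proj₁ π′) comp) (ev′ π′))
      where
      comp : ∀ k a b → ⟨ k , a ⟩ ∈ s → ⟨ k , b ⟩ ∈ t → ⟨ a , b ⟩ ∈ j
      comp k a b p q with to (proj₂ π k a (entry-Nat (proj₁ π) p)) p | to (proj₂ π′ k b (entry-Nat (proj₁ π′) q)) q
      ... | inj₁ (_ , refl) | inj₁ (_ , refl) = m
      ... | inj₁ (refl , _) | inj₂ (k , _)    = ⊥-elim (k refl)
      ... | inj₂ (k , _)    | inj₁ (refl , _) = ⊥-elim (k refl)
      ... | inj₂ (_ , refl) | inj₂ (_ , refl) = n

    opaque
      preserves-∈ : ∀ {x y x′ y′} → ⟨ x , x′ ⟩ ∈ j → ⟨ y , y′ ⟩ ∈ j → x ∈ y ⇔ x′ ∈ y′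
      preserves-∈ m n = transfer (code-∈ Nat-one Nat-zero) n m evaluate-∈ evaluate-∈

      preserves-≡ : ∀ {x y x′ y′} → ⟨ x , x′ ⟩ ∈ j → ⟨ y , y′ ⟩ ∈ j → x ≡ y ⇔ x′ ≡ y′
      preserves-≡ m n = transfer (code-≐ Nat-one Nat-zero) n m evaluate-≐ evaluate-≐

    -- e is definable in P as the only element that belongs to no element of P.
    opaque
      fixes-point : ∀ {e} → e ∈ P → (∀ y → y ∈ P → ¬ e ∈ y) →
                    (∀ x → x ∈ P → x ≢ e → ∃ λ y → y ∈ P × x ∈ y) → ⟨ e , e ⟩ ∈ j
      fixes-point {e} e∈P top other with total e e∈P
      ... | e′ , m with em {P = e′ ≡ e}
      ... | yes refl = m
      ... | no k with from (transfer (code-∃ Nat-zero (code-∈ Nat-one Nat-zero)) m m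
                       (evaluate-∃∋ e∈P) (evaluate-∃∋ (proj₂ (value∈ m)))) (other e′ (proj₂ (value∈ m)) k)
      ... | y , y∈P , e∈y = ⊥-elim (top y y∈P e∈y)

  -- Relativizing quantifiers to an element N of P

  module Relativization {N P : U} (N∈P : N ∈ P) (N⊆P : N ⊆ P) where

    -- In u the variable 0 stands for N and the variable i + 1 for the value of i under s.
    Shift : U → U → Set
    Shift s u = ⟨ ∅ , N ⟩ ∈ u × (∀ i a → Nat i → ⟨ i , a ⟩ ∈ s ⇔ ⟨ succ i , a ⟩ ∈ u)

    opaque
      shift : ∀ {s} → Assignment N s → ∃ λ u → Assignment P u × Shift s u
      shift {s} as with define-assignment
        ((#0 ≐ᵈ const ∅ ∧ᵈ #1 ≐ᵈ const N) ∨ᵈ ∃ᵈ (#1 ≐ᵈ succᵈ #0 ∧ᵈ ⟨ #0 , #2 ⟩ᵈ ∈ᵈ const s)) P tot uni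
        where
        tot : ∀ n → Nat n → ∃ λ a → a ∈ P × ((n ≡ ∅ × a ≡ N) ⊎ ∃ λ i → n ≡ succ i × ⟨ i , a ⟩ ∈ s)
        tot n p with Nat-cases p
        ... | inj₁ e = N , N∈P , inj₁ (e , refl)
        ... | inj₂ (i , q , e) with Function.total as i q
        ... | a , m = a , N⊆P a (entry-∈ as m) , inj₂ (i , e , m)
        uni : ∀ n a b → Nat n → (n ≡ ∅ × a ≡ N) ⊎ (∃ λ i → n ≡ succ i × ⟨ i , a ⟩ ∈ s) →
              (n ≡ ∅ × b ≡ N) ⊎ (∃ λ i → n ≡ succ i × ⟨ i , b ⟩ ∈ s) → a ≡ b
        uni n a b p (inj₁ (_ , refl)) (inj₁ (_ , refl)) = refl
        uni n a b p (inj₁ (e , _)) (inj₂ (_ , e′ , _)) = ⊥-elim (succ≢∅ (trans (sym e′) e))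
        uni n a b p (inj₂ (_ , e , _)) (inj₁ (e′ , _)) = ⊥-elim (succ≢∅ (trans (sym e) e′))
        uni n a b p (inj₂ (i , e , m)) (inj₂ (i′ , e′ , m′)) with succ-injective (trans (sym e) e′)
        ... | refl = Function.univalent as i a b m m′
      ... | u , au , f = u , au , from (f ∅ N) (Nat-zero , N∈P , inj₁ (refl , refl)) ,
            λ i a p → mk⇔
              (λ m → from (f _ _) (Nat-succ p , N⊆P a (entry-∈ as m) , inj₂ (i , refl , m)))
              (λ m → back i a (proj₂ (proj₂ (to (f _ _) m))))
        where
        back : ∀ i a → (succ i ≡ ∅ × a ≡ N) ⊎ (∃ λ k → succ i ≡ succ k × ⟨ k , a ⟩ ∈ s) → ⟨ i , a ⟩ ∈ s
        back i a (inj₁ (e , _)) = ⊥-elim (succ≢∅ e)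
        back i a (inj₂ (k , e , m)) with succ-injective e
        ... | refl = m

    opaque
      unshift : ∀ {u} → Assignment P u → ⟨ ∅ , N ⟩ ∈ u →
                (∀ i a → Nat i → ⟨ succ i , a ⟩ ∈ u → a ∈ N) → ∃ λ s → Assignment N s × Shift s u
      unshift {u} au m₀ bounded with define-assignment (⟨ succᵈ #0 , #1 ⟩ᵈ ∈ᵈ const u) N
        (λ n p → let a , m = Function.total au (succ n) (Nat-succ p) in a , bounded n a p m , m)
        (λ n a b _ m m′ → Function.univalent au (succ n) a b m m′)
      ... | s , as , f = s , as , m₀ , λ i a p → ⇔-trans (f i a) (mk⇔
              (λ (_ , _ , m) → m) (λ m → p , bounded i a p m , m))

    module _ {T₁ T₂ : U} (σ₁ : SatisfactionRelation N T₁) (σ₂ : SatisfactionRelation P T₂) where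

      private
        module N′ = SatisfactionRelation σ₁
        module P′ = SatisfactionRelation σ₂

      Translates : U → U → Set
      Translates f g = ∀ s u → Assignment N s → Assignment P u → Shift s u → ⟨ f , s ⟩ ∈ T₁ ⇔ ⟨ g , u ⟩ ∈ T₂

      Translatable : U → Set
      Translatable f = ∃ λ g → Code g × Translates f g

      -- A quantifier over `N` becomes one over `P` bounded by the parameter: some value of variable
      -- `i + 1` belongs to variable 0 and satisfies `g`. The shift by one protects variable 0 from
      -- being bound.
      translatable-∃ : ∀ i f → Nat i → Code f → Translatable f → Translatable ⌜∃ i , f ⌝
      translatable-∃ i f p c (g , d , h) =
        ⌜∃ succ i , body ⌝ , code-∃ (Nat-succ p) code-body , λ s u as au sh →
          ⇔-trans (N′.ex i f s p c as)
          (⇔-trans (mk⇔ (forth as au sh) (back as au sh))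
          (⇔-sym (P′.ex (succ i) body u (Nat-succ p) code-body au)))
        where
        bound body : U
        bound = ⌜ succ i ∈ ∅ ⌝
        body  = ⌜ bound ∧ g ⌝
        code-bound : Code bound
        code-bound = code-∈ (Nat-succ p) Nat-zero
        code-body : Code body
        code-body = code-∧ code-bound d
        forth : ∀ {s u} → Assignment N s → Assignment P u → Shift s u →
                (∃ λ t → Variant N s i t × ⟨ f , t ⟩ ∈ T₁) → ∃ λ v → Variant P u (succ i) v × ⟨ body , v ⟩ ∈ T₂
        forth {s} {u} as au (u₀ , us) (t , (at , δ) , m) with shift at | Function.total at i p
        ... | v , av , (v₀ , vs) | a , t-i = v , (av , agree) ,
              from (P′.and bound g v code-bound d av)
                ( from (P′.mem (succ i) ∅ v (Nat-succ p) Nat-zero av)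
                    (a , N , to (vs i a p) t-i , v₀ , entry-∈ at t-i)
                , to (h t v at av (v₀ , vs)) m )
          where
          agree : ∀ n → Nat n → n ≢ succ i → ∀ a → ⟨ n , a ⟩ ∈ v ⇔ ⟨ n , a ⟩ ∈ u
          agree n q n≢ a with Nat-cases q
          ... | inj₁ refl = mk⇔
                (λ r → subst (λ b → ⟨ ∅ , b ⟩ ∈ u) (Function.univalent av ∅ N a v₀ r) u₀)
                (λ r → subst (λ b → ⟨ ∅ , b ⟩ ∈ v) (Function.univalent au ∅ N a u₀ r) v₀)
          ... | inj₂ (k , q′ , refl) = ⇔-trans (⇔-sym (vs k a q′))
                (⇔-trans (δ k q′ (λ { refl → n≢ refl }) a) (us k a q′))
        back : ∀ {s u} → Assignment N s → Assignment P u → Shift s u →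
               (∃ λ v → Variant P u (succ i) v × ⟨ body , v ⟩ ∈ T₂) → ∃ λ t → Variant N s i t × ⟨ f , t ⟩ ∈ T₁
        back {s} {u} as au (u₀ , us) (v , (av , δ) , m) with to (P′.and bound g v code-bound d av) m
        ... | m₁ , m₂ with to (P′.mem (succ i) ∅ v (Nat-succ p) Nat-zero av) m₁
        ... | a , b , r , r₀ , a∈b with unshift av v₀ bounded
          where
          v₀ : ⟨ ∅ , N ⟩ ∈ v
          v₀ = from (δ ∅ Nat-zero (succ≢∅ ∘ sym) N) u₀
          -- The changed variable takes its value in `N` by the bounding conjunct `m₁`; all others
          -- still have their values under `s`.
          bounded : ∀ k c → Nat k → ⟨ succ k , c ⟩ ∈ v → c ∈ N
          bounded k c q n with em {P = k ≡ i}
          ... | yes refl = subst₂ _∈_ (Function.univalent av (succ k) a c r n) (Function.univalent av ∅ b N r₀ v₀) a∈b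
          ... | no k≢i   = entry-∈ as (from (us k c q)
                             (to (δ (succ k) (Nat-succ q) (λ e → k≢i (succ-injective e)) c) n))
        ... | t , at , sh = t , (at , λ k q k≢i c → ⇔-trans (proj₂ sh k c q)
                (⇔-trans (δ (succ k) (Nat-succ q) (λ e → k≢i (succ-injective e)) c) (⇔-sym (us k c q)))) ,
              from (h t v at av sh) m₂

      opaque
        -- The long definability term is the price of an induction inside the model. With the
        -- satisfaction relations `T₁` and `T₂` as parameters, truth in `N` and in `P` is mere
        -- membership in a set.
        translate : ∀ {f} → Code f → Translatable f
        translate = code-induction
          (∃ᵈ (codeᵈ #0 ∧ᵈ ∀ᵈ ∀ᵈ (assignmentᵈ (const N) #1 ⇒ᵈ assignmentᵈ (const P) #0 ⇒ᵈ
            (⟨ const ∅ , const N ⟩ᵈ ∈ᵈ #0 ∧ᵈ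
              ∀ᵈ ∀ᵈ (natᵈ #1 ⇒ᵈ (⟨ #1 , #0 ⟩ᵈ ∈ᵈ #3 ⇔ᵈ ⟨ succᵈ #1 , #0 ⟩ᵈ ∈ᵈ #2))) ⇒ᵈ
            (⟨ #3 , #1 ⟩ᵈ ∈ᵈ const T₁ ⇔ᵈ ⟨ #2 , #0 ⟩ᵈ ∈ᵈ const T₂))))
          (λ i j p q → ⌜ succ i ∈ succ j ⌝ , code-∈ (Nat-succ p) (Nat-succ q) , λ s u as au (_ , sh) →
            ⇔-trans (N′.mem i j s p q as) (⇔-trans (mk⇔
              (λ (a , b , m , n , r) → a , b , to (sh i a p) m , to (sh j b q) n , r)
              (λ (a , b , m , n , r) → a , b , from (sh i a p) m , from (sh j b q) n , r))
            (⇔-sym (P′.mem _ _ u (Nat-succ p) (Nat-succ q) au))))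
          (λ i j p q → ⌜ succ i ≐ succ j ⌝ , code-≐ (Nat-succ p) (Nat-succ q) , λ s u as au (_ , sh) →
            ⇔-trans (N′.eq i j s p q as) (⇔-trans (mk⇔
              (λ (a , b , m , n , r) → a , b , to (sh i a p) m , to (sh j b q) n , r)
              (λ (a , b , m , n , r) → a , b , from (sh i a p) m , from (sh j b q) n , r))
            (⇔-sym (P′.eq _ _ u (Nat-succ p) (Nat-succ q) au))))
          (λ f c (g , d , h) → ⌜¬ g ⌝ , code-¬ d , λ s u as au sh →
            ⇔-trans (N′.neg f s c as) (⇔-trans
              (mk⇔ (_∘ from (h s u as au sh)) (_∘ to (h s u as au sh))) (⇔-sym (P′.neg g u d au))))
          (λ f f′ c c′ (g , d , h) (g′ , d′ , h′) → ⌜ g ∧ g′ ⌝ , code-∧ d d′ , λ s u as au sh →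
            ⇔-trans (N′.and f f′ s c c′ as) (⇔-trans (mk⇔
              (λ (m , n) → to (h s u as au sh) m , to (h′ s u as au sh) n)
              (λ (m , n) → from (h s u as au sh) m , from (h′ s u as au sh) n)) (⇔-sym (P′.and g g′ u d d′ au))))
          translatable-∃

  module Restriction {j N P : U} (ε : ElementaryEmbedding j P P)
                     (N∈P : N ∈ P) (N⊆P : N ⊆ P) (fixed : ⟨ N , N ⟩ ∈ j) where

    open ElementaryEmbedding ε
    open Embedding ε
    open Relativization N∈P N⊆P

    opaque
      -- That `j` fixes `N` is used twice: it keeps the values of `k` in `N`, and it sends the
      -- parameter at variable 0 of the shifted assignment to itself, so that elementarity of `j`
      -- applies to the translated formula.
      restriction-elementary : ∀ {k} → IsRestriction j N k → ElementaryEmbedding k N N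
      restriction-elementary {k} res = record
        { function = record
          { graph = gr
          ; total = λ x p → let y , m = Function.total function x (N⊆P x p) in y , from (res _) (m , x , y , p , refl)
          ; univalent = λ x y y′ m m′ → Function.univalent function x y y′ (k⊆j m) (k⊆j m′) }
        ; elementary = elem }
        where
        k⊆j : ∀ {z} → z ∈ k → z ∈ j
        k⊆j m = proj₁ (to (res _) m)
        gr : ∀ z → z ∈ k → ∃₂ λ x y → x ∈ N × y ∈ N × z ≡ ⟨ x , y ⟩
        gr z m with to (res z) m
        ... | n , x , y , p , refl = x , y , p , to (preserves-∈ n fixed) p , refl
        elem : ∀ f s t → Code f → Assignment N s → Assignment N t →
               (∀ n a b → ⟨ n , a ⟩ ∈ s → ⟨ n , b ⟩ ∈ t → ⟨ a , b ⟩ ∈ k) → N ⊨ f [ s ] ⇔ N ⊨ f [ t ]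
        elem f s t c as at comp =
          ⇔-trans (Truth.⊨⇔ N σ₁ c as) (⇔-trans (h s u as au su)
          (⇔-trans (⇔-sym (Truth.⊨⇔ P σ₂ d au)) (⇔-trans (elementary g u v d au av comp′)
          (⇔-trans (Truth.⊨⇔ P σ₂ d av) (⇔-trans (⇔-sym (h t v at av sv)) (⇔-sym (Truth.⊨⇔ N σ₁ c at)))))))
          where
          σ₁ : SatisfactionRelation N (proj₁ (Truth.satisfaction-exists N))
          σ₁ = proj₂ (Truth.satisfaction-exists N)
          σ₂ : SatisfactionRelation P (proj₁ (Truth.satisfaction-exists P))
          σ₂ = proj₂ (Truth.satisfaction-exists P)
          g : U
          g = proj₁ (translate σ₁ σ₂ c)
          d : Code g
          d = proj₁ (proj₂ (translate σ₁ σ₂ c))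
          h : Translates σ₁ σ₂ f g
          h = proj₂ (proj₂ (translate σ₁ σ₂ c))
          u : U
          u = proj₁ (shift as)
          v : U
          v = proj₁ (shift at)
          au : Assignment P u
          au = proj₁ (proj₂ (shift as))
          av : Assignment P v
          av = proj₁ (proj₂ (shift at))
          su : Shift s u
          su = proj₂ (proj₂ (shift as))
          sv : Shift t v
          sv = proj₂ (proj₂ (shift at))
          comp′ : ∀ n a b → ⟨ n , a ⟩ ∈ u → ⟨ n , b ⟩ ∈ v → ⟨ a , b ⟩ ∈ j
          comp′ n a b m m′ with Nat-cases (entry-Nat au m)
          ... | inj₁ refl = subst₂ (λ x y → ⟨ x , y ⟩ ∈ j)
                (Function.univalent au ∅ N a (proj₁ su) m) (Function.univalent av ∅ N b (proj₁ sv) m′) fixed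
          ... | inj₂ (i , p , refl) = k⊆j (comp i a b (from (proj₂ su i a p) m) (from (proj₂ sv i b p) m′))

  -- The accessibility relation

  module Accessibility (δ : U) where

    open Potentialism δ
    open World using (transitive; δ∈set)

    opaque
      restriction-exists : ∀ j a → ∃ (IsRestriction j a)
      restriction-exists j a = separate (∃ᵈ ∃ᵈ (#1 ∈ᵈ const a ∧ᵈ #2 ≐ᵈ ⟨ #1 , #0 ⟩ᵈ)) j

    -- Stated for equal sets because worlds also carry proofs. Restricting an embedding to its whole
    -- domain gives it back.
    equal-sets⇒𝓡 : ∀ {M N} → set M ≡ set N → M 𝓡 N
    equal-sets⇒𝓡 {record { set = a }} {record { set = .a }} refl = (λ z m → m) , λ j k ε res →
      subst (λ f → ElementaryEmbedding f a a)
        (extensionality λ z → mk⇔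
          (λ m → let x , y , p , _ , e = Function.graph (ElementaryEmbedding.function ε) z m in
                 from (res z) (m , x , y , p , e))
          (λ m → proj₁ (to (res z) m))) ε

    𝓡-refl : ∀ {M} → M 𝓡 M
    𝓡-refl {M} = equal-sets⇒𝓡 {M} {M} refl

    𝓡-trans : ∀ {M N P} → M 𝓡 N → N 𝓡 P → M 𝓡 P
    𝓡-trans {M} {N} {P} (M⊆N , r) (N⊆P , r′) = (λ z m → N⊆P z (M⊆N z m)) , λ j k ε res →
      let k′ , res′ = restriction-exists j (set N) in
      r k′ k (r′ j k′ ε res′) λ z → mk⇔
        (λ m → let n , x , y , p , e = to (res z) m in from (res′ z) (n , x , y , M⊆N x p , e) , x , y , p , e)
        (λ (m , q) → from (res z) (proj₁ (to (res′ z) m) , q))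

    fixed⇒𝓡 : ∀ {M P} → set M ∈ set P →
              (∀ {j} → ElementaryEmbedding j (set P) (set P) → ⟨ set M , set M ⟩ ∈ j) → M 𝓡 P
    fixed⇒𝓡 {M} {P} M∈P fixed = M⊆P , λ j k ε →
      Restriction.restriction-elementary ε M∈P M⊆P (fixed ε)
      where
      M⊆P : set M ⊆ set P
      M⊆P = transitive P _ M∈P

    -- Common upper bounds of two worlds

    module Join (M N : World) (M≢N : set M ≢ set N) where

      m n e : U
      m = set M
      n = set N
      e = ⟨ m , n ⟩

      carrier : U
      carrier = (m ∪ n) ∪ (⦅ m , n ⦆ ∪ (e ∪ ⦅ e , e ⦆))

      data Element : U → Set where
        in-m  : ∀ {z} → z ∈ m → Element z
        in-n  : ∀ {z} → z ∈ n → Element z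
        is-m  : Element m
        is-n  : Element n
        is-mm : Element ⦅ m , m ⦆
        is-mn : Element ⦅ m , n ⦆
        is-e  : Element e

      element : ∀ {z} → z ∈ carrier → Element z
      element p with ∈-∪⁻ p
      ... | inj₁ q = [ in-m , in-n ]′ (∈-∪⁻ q)
      ... | inj₂ q with ∈-∪⁻ q
      ... | inj₁ r = [ (λ { refl → is-m }) , (λ { refl → is-n }) ]′ (∈-pair⁻ r)
      ... | inj₂ r with ∈-∪⁻ r
      ... | inj₁ s = [ (λ { refl → is-mm }) , (λ { refl → is-mn }) ]′ (∈-pair⁻ s)
      ... | inj₂ s with ∈-single⁻ s
      ... | refl = is-e

      element⁻ : ∀ {z} → Element z → z ∈ carrier
      element⁻ (in-m p) = ∈-∪ˡ (∈-∪ˡ p)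
      element⁻ (in-n p) = ∈-∪ˡ (∈-∪ʳ p)
      element⁻ is-m     = ∈-∪ʳ (∈-∪ˡ ∈-pairˡ)
      element⁻ is-n     = ∈-∪ʳ (∈-∪ˡ ∈-pairʳ)
      element⁻ is-mm    = ∈-∪ʳ (∈-∪ʳ (∈-∪ˡ ∈-pairˡ))
      element⁻ is-mn    = ∈-∪ʳ (∈-∪ʳ (∈-∪ˡ ∈-pairʳ))
      element⁻ is-e     = ∈-∪ʳ (∈-∪ʳ (∈-∪ʳ ∈-pairˡ))

      member : ∀ {y z} → Element y → z ∈ y → Element z
      member (in-m p) q = in-m (transitive M _ p _ q)
      member (in-n p) q = in-n (transitive N _ p _ q)
      member is-m     q = in-m q
      member is-n     q = in-n q
      member is-mm    q with ∈-single⁻ q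
      ... | refl = is-m
      member is-mn    q = [ (λ { refl → is-m }) , (λ { refl → is-n }) ]′ (∈-pair⁻ q)
      member is-e     q = [ (λ { refl → is-mm }) , (λ { refl → is-mn }) ]′ (∈-pair⁻ q)

      world : World
      world = record
        { set        = carrier
        ; transitive = λ y p z q → element⁻ (member (element p) q)
        ; δ∈set      = ∈-∪ˡ (∈-∪ˡ (δ∈set M)) }

      e∉m : ¬ e ∈ m
      e∉m p = ∈-irrefl (transitive M _ (transitive M _ p _ ∈-pairˡ) _ ∈-pairˡ)

      e∉n : ¬ e ∈ n
      e∉n p = ∈-irrefl (transitive N _ (transitive N _ p _ ∈-pairʳ) _ ∈-pairʳ)

      e≢m : e ≢ m
      e≢m p = ∈-irrefl (transitive M _ (subst (⦅ m , m ⦆ ∈_) p ∈-pairˡ) _ ∈-pairˡ)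

      e≢n : e ≢ n
      e≢n p = ∈-irrefl (transitive N _ (subst (⦅ m , n ⦆ ∈_) p ∈-pairʳ) _ ∈-pairʳ)

      e-top : ∀ {y} → Element y → ¬ e ∈ y
      e-top (in-m p) q = e∉m (transitive M _ p _ q)
      e-top (in-n p) q = e∉n (transitive N _ p _ q)
      e-top is-m     q = e∉m q
      e-top is-n     q = e∉n q
      e-top is-mm    q = e≢m (∈-single⁻ q)
      e-top is-mn    q = [ e≢m , e≢n ]′ (∈-pair⁻ q)
      e-top is-e     q = ∈-irrefl q

      covered : ∀ {z} → Element z → z ≢ e → ∃ λ y → y ∈ carrier × z ∈ y
      covered (in-m p) _ = m , element⁻ is-m , p
      covered (in-n p) _ = n , element⁻ is-n , p
      covered is-m     _ = ⦅ m , m ⦆ , element⁻ is-mm , ∈-pairˡ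
      covered is-n     _ = ⦅ m , n ⦆ , element⁻ is-mn , ∈-pairʳ
      covered is-mm    _ = e , element⁻ is-e , ∈-pairˡ
      covered is-mn    _ = e , element⁻ is-e , ∈-pairʳ
      covered is-e     k = ⊥-elim (k refl)

      module _ {j : U} (ε : ElementaryEmbedding j carrier carrier) where
        open Embedding ε
        open Function (ElementaryEmbedding.function ε) using (total)

        opaque
          fixes-e : ⟨ e , e ⟩ ∈ j
          fixes-e = fixes-point (element⁻ is-e) (λ y p → e-top (element p)) (λ x p → covered (element p))

        opaque
          -- The fixed pair `e` has the elements `⦅ m , m ⦆` and `⦅ m , n ⦆`, so `j` maps each of
          -- them to one of the two. They have different numbers of elements and `j` is injective,
          -- so they cannot coincide or change places. Hence `m`, the element of the singleton, is
          -- fixed, and then so is `n`.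
          fixes-both : ⟨ m , m ⟩ ∈ j × ⟨ n , n ⟩ ∈ j
          fixes-both with total m (element⁻ is-m) | total n (element⁻ is-n)
                        | total ⦅ m , m ⦆ (element⁻ is-mm) | total ⦅ m , n ⦆ (element⁻ is-mn)
          ... | m′ , jm | n′ , jn | p , jp | q , jq
            with ∈-pair⁻ (to (preserves-∈ jp fixes-e) ∈-pairˡ) | ∈-pair⁻ (to (preserves-∈ jq fixes-e) ∈-pairʳ)
          ... | inj₂ refl | inj₂ refl = ⊥-elim (M≢N (sym (∈-single⁻ (subst (n ∈_)
                  (sym (from (preserves-≡ jp jq) refl)) ∈-pairʳ))))
          ... | inj₂ refl | inj₁ refl = ⊥-elim (M≢N (from (preserves-≡ jm jn) (trans
                  (∈-single⁻ (to (preserves-∈ jm jq) ∈-pairˡ)) (sym (∈-single⁻ (to (preserves-∈ jn jq) ∈-pairʳ))))))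
          ... | inj₁ refl | inj₁ refl = ⊥-elim (M≢N (sym (∈-single⁻ (subst (n ∈_)
                  (sym (from (preserves-≡ jp jq) refl)) ∈-pairʳ))))
          ... | inj₁ refl | inj₂ refl with ∈-single⁻ (to (preserves-∈ jm jp) ∈-pairˡ)
          ... | refl with ∈-pair⁻ (to (preserves-∈ jn jq) ∈-pairʳ)
          ... | inj₁ refl = ⊥-elim (M≢N (from (preserves-≡ jm jn) refl))
          ... | inj₂ refl = jm , jn

      M𝓡 : M 𝓡 world
      M𝓡 = fixed⇒𝓡 {M} {world} (element⁻ is-m) (proj₁ ∘ fixes-both)

      N𝓡 : N 𝓡 world
      N𝓡 = fixed⇒𝓡 {N} {world} (element⁻ is-n) (proj₂ ∘ fixes-both)

    𝓡-directed : ∀ M N → ∃ λ P → M 𝓡 P × N 𝓡 P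
    𝓡-directed M N with em {P = set M ≡ set N}
    ... | yes e = N , equal-sets⇒𝓡 {M} {N} e , 𝓡-refl {N}
    ... | no k  = Join.world M N k , Join.M𝓡 M N k , Join.N𝓡 M N k

    -- Soundness of S4.2

    module _ {n : ℕ} (Ψ : ℕ → Formula zf◇ n) where

      private
        Truth-at : World → Vec U n → ModalFormula → Set
        Truth-at M ρ φ = M ⊩ substitute φ Ψ [ ρ ]

      module _ (M : World) (ρ : Vec U n) where

        truth-value : ModalFormula → Bool
        truth-value φ = does (em {P = Truth-at M ρ φ})

        truth-value-reflects : ∀ φ → Reflects (Truth-at M ρ φ) (⟦ φ ⟧ truth-value)
        truth-value-reflects (var p)  = proof em
        truth-value-reflects (◇ᵐ φ)   = proof em
        truth-value-reflects (□ᵐ φ)   = proof em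
        truth-value-reflects (¬ᵐ φ)   = ¬-reflects (truth-value-reflects φ)
        truth-value-reflects (φ ∧ᵐ ψ) = truth-value-reflects φ ×-reflects truth-value-reflects ψ
        truth-value-reflects (φ ∨ᵐ ψ) = truth-value-reflects φ ⊎-reflects truth-value-reflects ψ
        truth-value-reflects (φ ⇒ᵐ ψ) = truth-value-reflects φ →-reflects truth-value-reflects ψ

      axiom-true : ∀ {φ} → S4·2-Axiom φ → ∀ M ρ → Truth-at M ρ φ
      axiom-true (s4 (K φ ψ))  M ρ = λ f g N r → f N r (g N r)
      axiom-true (s4 (Dual φ)) M ρ = (λ k N r p → k (N , r , p)) , λ k (N , r , p) → k N r p
      axiom-true (s4 (S φ))    M ρ = λ f → f M (𝓡-refl {M})
      axiom-true (s4 (Four φ)) M ρ = λ f N r P r′ → f P (𝓡-trans {M} {N} {P} r r′)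
      axiom-true (Dot2 φ)      M ρ = λ (N , _ , f) P _ →
        let Q , r , r′ = 𝓡-directed N P in Q , r′ , f Q r

      derivable-true : ∀ {φ} → S4·2 φ → ∀ M ρ → Truth-at M ρ φ
      derivable-true {φ} (taut t)       M ρ = invert (subst (Reflects _) (t _) (truth-value-reflects M ρ φ))
      derivable-true (axiom a)          M ρ = axiom-true a M ρ
      derivable-true (modus-ponens p q) M ρ = derivable-true p M ρ (derivable-true q M ρ)
      derivable-true (necessitation p)  M ρ = λ N _ → derivable-true p N ρ

    soundness : ∀ {φ} → S4·2 φ → Valid φ
    soundness p M Ψ ρ _ = derivable-true Ψ p M ρ

  -- Labelling finite directed preorders

  module Labelling (𝓕 : DirectedModel) where

    open DirectedModel 𝓕

    infix 4 _∼_
    _∼_ : Fin size → Fin size → Set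
    u ∼ v = u ≼ v × v ≼ u

    ∼-sym : ∀ {u v} → u ∼ v → v ∼ u
    ∼-sym (p , q) = q , p

    Chain : (Fin size → Set) → Set
    Chain A = ∀ u v → A u → A v → u ≼ v ⊎ v ≼ u

    Maximum : (Fin size → Set) → Fin size → Set
    Maximum A u = A u × (∀ v → A v → v ≼ u)

    chain-maximum : ∀ {A} → Chain A → ∃ A → ∃ (Maximum A)
    chain-maximum {A} ch (a , Aa) with go (λ i → i)
      where
      -- Stated for an arbitrary finite family of points, to allow induction on its length.
      go : ∀ {m} (f : Fin m → Fin size) → (∀ i → ¬ A (f i)) ⊎ (∃ λ i → A (f i) × (∀ k → A (f k) → f k ≼ f i))
      go {zero}  f = inj₁ λ ()
      go {suc m} f with go (f ∘ suc) | em {P = A (f zero)}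
      ... | inj₁ none        | no k  = inj₁ λ { zero → k ; (suc i) → none i }
      ... | inj₁ none        | yes p = inj₂ (zero , p , λ { zero _ → ≼-refl ; (suc i) q → ⊥-elim (none i q) })
      ... | inj₂ (i , q , h) | no k  = inj₂ (suc i , q , λ { zero p → ⊥-elim (k p) ; (suc l) → h l })
      ... | inj₂ (i , q , h) | yes p with ch _ _ p q
      ... | inj₁ le = inj₂ (suc i , q , λ { zero _ → le ; (suc l) → h l })
      ... | inj₂ ge = inj₂ (zero , p , λ { zero _ → ≼-refl ; (suc l) r → ≼-trans (h l r) ge })
    ... | inj₁ none        = ⊥-elim (none a Aa)
    ... | inj₂ (i , p , h) = i , p , h

    -- The case distinction keeps base monotone: once two incomparable buttons have been pushed,
    -- the cluster is the top one, whatever is pushed afterwards.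
    base : (Fin size → Set) → Fin size
    base A with em {P = ∃ λ u → Maximum A u × Chain A}
    ... | yes (u , _) = u
    ... | no _ with em {P = ∃ A}
    ... | yes _ = top
    ... | no _  = root

    data BaseView (A : Fin size → Set) : Fin size → Set where
      maximum  : ∀ {u} → Maximum A u → Chain A → BaseView A u
      no-chain : ∃ A → ¬ Chain A → BaseView A top
      nothing  : ¬ ∃ A → BaseView A root

    base-view : ∀ A → BaseView A (base A)
    base-view A with em {P = ∃ λ u → Maximum A u × Chain A}
    ... | yes (_ , m , c) = maximum m c
    ... | no k with em {P = ∃ A}
    ... | yes a = no-chain a λ c → let u , m = chain-maximum c a in k (u , m , c)
    ... | no k′ = nothing k′

    base-mono : ∀ {A B} → (∀ u → A u → B u) → base A ≼ base B
    base-mono {A} {B} A⊆B with base A | base-view A | base B | base-view B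
    ... | _ | nothing _           | b | _                  = root-least b
    ... | a | _                   | _ | no-chain _ _       = top-greatest a
    ... | _ | maximum (p , _) _   | _ | maximum (_ , h) _  = h _ (A⊆B _ p)
    ... | _ | maximum (p , _) _   | _ | nothing k          = ⊥-elim (k (_ , A⊆B _ p))
    ... | _ | no-chain _ k        | _ | maximum _ c        =
      ⊥-elim (k λ u v p q → c u v (A⊆B u p) (A⊆B v q))
    ... | _ | no-chain (u , p) _  | _ | nothing k          = ⊥-elim (k (u , A⊆B u p))

    base-nothing : ∀ {A} → (∀ u → ¬ A u) → base A ≡ root
    base-nothing {A} k with base A | base-view A
    ... | _ | maximum (p , _) _  = ⊥-elim (k _ p)
    ... | _ | no-chain (_ , p) _ = ⊥-elim (k _ p)
    ... | _ | nothing _          = refl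

    ≼-base : ∀ {A u} → A u → u ≼ base A
    ≼-base {A} {u} p with base A | base-view A
    ... | _ | maximum (_ , h) _ = h u p
    ... | _ | no-chain _ _      = top-greatest u
    ... | _ | nothing k         = ⊥-elim (k (u , p))

    top≼base : ∀ {A} → ¬ Chain A → top ≼ base A
    top≼base {A} k with base A | base-view A
    ... | _ | maximum _ c  = ⊥-elim (k c)
    ... | _ | no-chain _ _ = ≼-refl
    ... | _ | nothing k′   = ⊥-elim (k λ u v p _ → ⊥-elim (k′ (u , p)))

    -- If `A` is a chain, then so is `B`, with `u` as a maximum. If not, the base of `A` is already
    -- the top, and `u` above it lies in the same cluster. Equality can fail, as a maximum is
    -- determined only up to its cluster.
    base-add : ∀ {A B u} → (∀ v → B v ⇔ (A v ⊎ v ≡ u)) → base A ≼ u → base B ∼ u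
    base-add {A} {B} {u} e le = below , ≼-base (from (e u) (inj₂ refl))
      where
      A≼u : ∀ v → A v → v ≼ u
      A≼u v p = ≼-trans (≼-base p) le
      B≼u : ∀ v → B v → v ≼ u
      B≼u v p = [ A≼u v , (λ { refl → ≼-refl }) ]′ (to (e v) p)
      chain-extends : Chain A → Chain B
      chain-extends c v w p q with to (e v) p | to (e w) q
      ... | inj₁ p′   | inj₁ q′   = c v w p′ q′
      ... | inj₂ refl | _         = inj₂ (B≼u w q)
      ... | _         | inj₂ refl = inj₁ (B≼u v p)
      below : base B ≼ u
      below with base B | base-view B
      ... | _ | maximum (p , _) _ = B≼u _ p
      ... | _ | nothing _         = root-least u
      ... | _ | no-chain _ k      = ≼-trans (top≼base (k ∘ chain-extends)) le

    -- The switch counts only when it names a point of the current cluster. Thus the cluster of the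
    -- label depends on the buttons alone, and monotonicity holds whatever the switches show.
    label : (A T : Fin size → Set) → Fin size
    label A T with em {P = ∃ λ u → T u × u ∼ base A}
    ... | yes (u , _) = u
    ... | no _        = base A

    label∼base : ∀ A T → label A T ∼ base A
    label∼base A T with em {P = ∃ λ u → T u × u ∼ base A}
    ... | yes (_ , _ , p) = p
    ... | no _            = ≼-refl , ≼-refl

    label-switch : ∀ {A T u} → (∀ v → T v ⇔ v ≡ u) → base A ∼ u → label A T ≡ u
    label-switch {A} {T} {u} e p with em {P = ∃ λ v → T v × v ∼ base A}
    ... | yes (v , q , _) = to (e v) q
    ... | no k            = ⊥-elim (k (u , from (e u) refl , ∼-sym p))

    label-nothing : ∀ {A T} → (∀ u → ¬ A u) → (∀ u → ¬ T u) → label A T ≡ root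
    label-nothing {A} {T} a t with em {P = ∃ λ v → T v × v ∼ base A}
    ... | yes (v , q , _) = ⊥-elim (t v q)
    ... | no _            = base-nothing a

    label-mono : ∀ {A B} T T′ → (∀ u → A u → B u) → label A T ≼ label B T′
    label-mono {A} {B} T T′ s =
      ≼-trans (proj₁ (label∼base A T)) (≼-trans (base-mono s) (proj₂ (label∼base B T′)))

    label-push : ∀ {A B T T′ u} → (∀ v → B v ⇔ (A v ⊎ v ≡ u)) → (∀ v → T′ v ⇔ v ≡ u) →
                 label A T ≼ u → label B T′ ≡ u
    label-push {A} {T = T} b t le =
      label-switch t (base-add b (≼-trans (proj₂ (label∼base A T)) le))

  -- Buttons and switches

  module Refutation (δ : U) (δ-transitive : Transitive δ) (𝓕 : DirectedModel) where

    open Potentialism δ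
    open World using (transitive; δ∈set)
    open Accessibility δ
    open DirectedModel 𝓕
    open Labelling 𝓕

    mark : ℕ → U
    mark zero    = δ
    mark (suc k) = succ (mark k)

    mark-transitive : ∀ k → Transitive (mark k)
    mark-transitive zero    = δ-transitive
    mark-transitive (suc k) y p z q with ∈-succ⁻ p
    ... | inj₁ r    = ∈-succ (mark-transitive k y r z q)
    ... | inj₂ refl = ∈-succ q

    mark-∈ : ∀ {k l} → k < l → mark k ∈ mark l
    mark-∈ {k} {suc l} (s≤s k≤l) with m≤n⇒m<n∨m≡n k≤l
    ... | inj₁ k<l  = ∈-succ (mark-∈ k<l)
    ... | inj₂ refl = ∈-succ-self

    mark-injective : ∀ k l → mark k ≡ mark l → k ≡ l
    mark-injective zero    zero    e = refl
    mark-injective zero    (suc l) e = ⊥-elim (∈-irrefl (subst (δ ∈_) (sym e) (mark-∈ {0} {suc l} (s≤s z≤n))))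
    mark-injective (suc k) zero    e = ⊥-elim (∈-irrefl (subst (δ ∈_) e (mark-∈ {0} {suc k} (s≤s z≤n))))
    mark-injective (suc k) (suc l) e = cong suc (mark-injective k l (succ-injective e))

    high : U
    high = mark size

    parameters : Vec U (suc size)
    parameters = high ∷ tabulate (mark ∘ toℕ)

    μ : Fin size → U
    μ i = lookup parameters (suc i)

    μ≡mark : ∀ i → μ i ≡ mark (toℕ i)
    μ≡mark = lookup∘tabulate (mark ∘ toℕ)

    μ∈high : ∀ i → μ i ∈ high
    μ∈high i = subst (_∈ high) (sym (μ≡mark i)) (mark-∈ (toℕ<n i))

    μ-injective : ∀ i j → μ i ≡ μ j → i ≡ j
    μ-injective i j e = toℕ-injective (mark-injective _ _ (trans (sym (μ≡mark i)) (trans e (μ≡mark j))))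

    -- high ∈ y ensures that neither the elements of the initial world nor its extensions are tokens.
    Token : Fin size → U → U → Set
    Token i x y = y ∈ x × μ i ∈ x × high ∈ y × (∀ z → z ∈ x → z ≡ y ⊎ z ≡ μ i)

    Pushed Switched : World → Fin size → Set
    Pushed N i   = ∃ λ x → x ∈ set N × (∃ λ y → Token i x y)
    Switched N i = ∃ λ x → x ∈ set N × (∃ λ y → Token i x y) × (∀ z → z ∈ set N → ¬ x ∈ z)

    Above : World → Set
    Above N = mark (suc size) ⊆ set N

    module _ {N : World} (above : Above N) where

      high∈ : high ∈ set N
      high∈ = above high ∈-succ-self

      μ∈ : ∀ i → μ i ∈ set N
      μ∈ i = transitive N _ high∈ _ (μ∈high i)

      -- The world contains `high`, but a token has only the elements `y` and `μ i`. The first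
      -- contains `high` and the second belongs to `high`, so neither equals it.
      world-not-token : ∀ {i y} → ¬ Token i (set N) y
      world-not-token {i} (_ , _ , p , h) with h high high∈
      ... | inj₁ refl = ∈-irrefl p
      ... | inj₂ e    = ∈-irrefl (subst (_∈ high) (sym e) (μ∈high i))

    -- Pushing a button

    module Push (N : World) (above : Above N) (u : Fin size) where

      n e : U
      n = set N
      e = ⦅ n , μ u ⦆

      carrier : U
      carrier = n ∪ ⦅ n , e ⦆

      data Element : U → Set where
        in-n : ∀ {z} → z ∈ n → Element z
        is-n : Element n
        is-e : Element e

      element : ∀ {z} → z ∈ carrier → Element z
      element p with ∈-∪⁻ p
      ... | inj₁ q = in-n q
      ... | inj₂ q = [ (λ { refl → is-n }) , (λ { refl → is-e }) ]′ (∈-pair⁻ q)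

      element⁻ : ∀ {z} → Element z → z ∈ carrier
      element⁻ (in-n p) = ∈-∪ˡ p
      element⁻ is-n     = ∈-∪ʳ ∈-pairˡ
      element⁻ is-e     = ∈-∪ʳ ∈-pairʳ

      μ∈n : ∀ i → μ i ∈ n
      μ∈n = μ∈ {N} above

      member : ∀ {y z} → Element y → z ∈ y → Element z
      member (in-n p) q = in-n (transitive N _ p _ q)
      member is-n     q = in-n q
      member is-e     q = [ (λ { refl → is-n }) , (λ { refl → in-n (μ∈n u) }) ]′ (∈-pair⁻ q)

      world : World
      world = record
        { set        = carrier
        ; transitive = λ y p z q → element⁻ (member (element p) q)
        ; δ∈set      = ∈-∪ˡ (δ∈set N) }

      e∉n : ¬ e ∈ n
      e∉n p = ∈-irrefl (transitive N _ p _ ∈-pairˡ)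

      e-top : ∀ {y} → Element y → ¬ e ∈ y
      e-top (in-n p) q = e∉n (transitive N _ p _ q)
      e-top is-n     q = e∉n q
      e-top is-e     q = ∈-irrefl q

      covered : ∀ {z} → Element z → z ≢ e → ∃ λ y → y ∈ carrier × z ∈ y
      covered (in-n p) _ = n , element⁻ is-n , p
      covered is-n     _ = e , element⁻ is-e , ∈-pairˡ
      covered is-e     k = ⊥-elim (k refl)

      opaque
        -- The top point `e` is fixed, so `n` can only go to `n` or to `μ u`. In the second case the
        -- image of `μ u`, an element of `n`, lies both in `μ u` and in `e`; either choice in `e`
        -- violates foundation.
        fixes-n : ∀ {j} → ElementaryEmbedding j carrier carrier → ⟨ n , n ⟩ ∈ j
        fixes-n {j} ε with Function.total (ElementaryEmbedding.function ε) n (element⁻ is-n)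
                         | Function.total (ElementaryEmbedding.function ε) (μ u) (∈-∪ˡ (μ∈n u))
        ... | n′ , jn | x′ , jx
          with Embedding.fixes-point ε (element⁻ is-e) (λ y p → e-top (element p)) (λ x p → covered (element p))
        ... | je with ∈-pair⁻ (to (Embedding.preserves-∈ ε jn je) ∈-pairˡ)
        ... | inj₁ refl = jn
        ... | inj₂ refl with to (Embedding.preserves-∈ ε jx jn) (μ∈n u)
                           | ∈-pair⁻ (to (Embedding.preserves-∈ ε jx je) ∈-pairʳ)
        ... | p | inj₁ refl = ⊥-elim (∈-asym p (μ∈n u))
        ... | p | inj₂ refl = ⊥-elim (∈-irrefl p)

      accessible : N 𝓡 world
      accessible = fixed⇒𝓡 {N} {world} (element⁻ is-n) fixes-n

      token-e : Token u e n
      token-e = ∈-pairˡ , ∈-pairʳ , high∈ {N} above , λ z → ∈-pair⁻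

      token-e⁻ : ∀ {i y} → Token i e y → i ≡ u
      token-e⁻ {i} (_ , p , _) with ∈-pair⁻ p
      ... | inj₁ q = ⊥-elim (∈-asym (μ∈high i) (subst (high ∈_) (sym q) (high∈ {N} above)))
      ... | inj₂ q = μ-injective i u q

      opaque
        pushed : ∀ i → Pushed world i ⇔ (Pushed N i ⊎ i ≡ u)
        pushed i = mk⇔ forth λ
          { (inj₁ (x , p , t)) → x , ∈-∪ˡ p , t ; (inj₂ refl) → e , element⁻ is-e , n , token-e }
          where
          forth : Pushed world i → Pushed N i ⊎ i ≡ u
          forth (x , p , y , t) with element p
          ... | in-n q = inj₁ (x , q , y , t)
          ... | is-n   = ⊥-elim (world-not-token {N} above t)
          ... | is-e   = inj₂ (token-e⁻ t)

      opaque
        -- Every old element now belongs to `n`, and `n` belongs to `e`. The previous switch is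
        -- thereby erased, while its button remains pushed.
        switched : ∀ i → Switched world i ⇔ i ≡ u
        switched i = mk⇔ forth λ { refl → e , element⁻ is-e , (n , token-e) , λ y p → e-top (element p) }
          where
          forth : Switched world i → i ≡ u
          forth (x , p , (y , t) , k) with element p
          ... | in-n q = ⊥-elim (k n (element⁻ is-n) q)
          ... | is-n   = ⊥-elim (k e (element⁻ is-e) ∈-pairˡ)
          ... | is-e   = token-e⁻ t

    pushed-mono : ∀ {M N} → M 𝓡 N → ∀ i → Pushed M i → Pushed N i
    pushed-mono (s , _) i (x , p , t) = x , s x p , t

    -- Formulas for buttons, switches and valuations

    -- The environment is `y`, `x`, `high`, followed by the marks: hence index 2 for `high` and
    -- `i + 3` for `μ i`, shifted by one more under the universal quantifier.
    tokenᶠ : Fin size → Formula zf◇ (suc (suc (suc size)))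
    tokenᶠ i = y ∈ᶠ x ∧ᶠ suc (suc (suc i)) ∈ᶠ x ∧ᶠ suc (suc zero) ∈ᶠ y ∧ᶠ
      ∀ᶠ (zero ∈ᶠ suc x ⇒ᶠ zero ≐ᶠ suc y ∨ᶠ zero ≐ᶠ suc (suc (suc (suc i))))
      where
      x y : ∀ {n} → Fin (suc (suc n))
      x = suc zero
      y = zero

    pushedᶠ switchedᶠ : Fin size → Formula zf◇ (suc size)
    pushedᶠ i   = ∃ᶠ ∃ᶠ tokenᶠ i
    switchedᶠ i = ∃ᶠ ((∃ᶠ tokenᶠ i) ∧ᶠ ∀ᶠ ¬ᶠ (suc zero ∈ᶠ zero))

    module _ (N : World) (i : Fin size) where

      tokenᶠ-correct : ∀ {x} → x ∈ set N →
        (N ⊩ ∃ᶠ tokenᶠ i [ x ∷ parameters ]) ⇔ ∃ λ y → Token i x y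
      tokenᶠ-correct p = mk⇔
        -- Quantifiers at a world range over its elements only; transitivity puts the elements of
        -- `x` among them.
        (λ (y , _ , a , b , c , h) → y , a , b , c , λ z q → h z (transitive N _ p _ q) q)
        (λ (y , a , b , c , h) → y , transitive N _ p _ a , a , b , c , λ z _ → h z)

      pushedᶠ-correct : (N ⊩ pushedᶠ i [ parameters ]) ⇔ Pushed N i
      pushedᶠ-correct = mk⇔
        (λ (x , p , t) → x , p , to (tokenᶠ-correct p) t)
        (λ (x , p , t) → x , p , from (tokenᶠ-correct p) t)

      switchedᶠ-correct : (N ⊩ switchedᶠ i [ parameters ]) ⇔ Switched N i
      switchedᶠ-correct = mk⇔
        (λ (x , p , t , k) → x , p , to (tokenᶠ-correct p) t , k)
        (λ (x , p , t , k) → x , p , from (tokenᶠ-correct p) t , k)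

    bits : ∀ {m} → World → (Fin m → Formula zf◇ (suc size)) → Vec Bool m
    bits N χ = tabulate λ i → does (em {P = N ⊩ χ i [ parameters ]})

    -- Shannon expansion
    shannon : ∀ {m} → (Fin m → Formula zf◇ (suc size)) → (Vec Bool m → Formula zf◇ (suc size)) →
              Formula zf◇ (suc size)
    shannon {zero}  χ H = H []
    shannon {suc m} χ H =
      (χ zero ∧ᶠ shannon (χ ∘ suc) (H ∘ (true ∷_))) ∨ᶠ
      (¬ᶠ χ zero ∧ᶠ shannon (χ ∘ suc) (H ∘ (false ∷_)))

    shannon-correct : ∀ {m} N (χ : Fin m → Formula zf◇ (suc size)) H →
      (N ⊩ shannon χ H [ parameters ]) ⇔ (N ⊩ H (bits N χ) [ parameters ])
    shannon-correct {zero}  N χ H = mk⇔ (λ p → p) (λ p → p)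
    shannon-correct {suc m} N χ H with em {P = N ⊩ χ zero [ parameters ]}
    ... | yes p = ⇔-trans (mk⇔ [ proj₂ , (λ (k , _) → ⊥-elim (k p)) ]′ (λ q → inj₁ (p , q)))
                          (shannon-correct N (χ ∘ suc) (H ∘ (true ∷_)))
    ... | no k  = ⇔-trans (mk⇔ [ (λ (p , _) → ⊥-elim (k p)) , proj₂ ]′ (λ q → inj₂ (k , q)))
                          (shannon-correct N (χ ∘ suc) (H ∘ (false ∷_)))

    True : Vec Bool size → Fin size → Set
    True b i = lookup b i ≡ true

    True-bits : ∀ N χ i → True (bits N χ) i ⇔ (N ⊩ χ i [ parameters ])
    True-bits N χ i rewrite lookup∘tabulate (λ i → does (em {P = N ⊩ χ i [ parameters ]})) i
      with em {P = N ⊩ χ i [ parameters ]}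
    ... | yes p = mk⇔ (λ _ → p) (λ _ → refl)
    ... | no k  = mk⇔ (λ ()) (⊥-elim ∘ k)

    opaque
      -- The valuation of the finite model is fixed outside the set-theoretic model; at a given
      -- point it contributes a constant truth value.
      leaf : ℕ → Fin size → Formula zf◇ (suc size)
      leaf p w with em {P = valuation w p}
      ... | yes _ = zero ≐ᶠ zero
      ... | no _  = ¬ᶠ (zero ≐ᶠ zero)

      leaf-correct : ∀ N p w → (N ⊩ leaf p w [ parameters ]) ⇔ valuation w p
      leaf-correct N p w with em {P = valuation w p}
      ... | yes v = mk⇔ (λ _ → v) (λ _ → refl)
      ... | no k  = mk⇔ (λ f → ⊥-elim (f refl)) (⊥-elim ∘ k)

    state : World → Fin size
    state N = label (True (bits N pushedᶠ)) (True (bits N switchedᶠ))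

    -- A case distinction over all Boolean patterns of buttons and of switches. Each pattern
    -- determines the label and with it the constant at the leaf.
    Ψ : ℕ → Formula zf◇ (suc size)
    Ψ p = shannon pushedᶠ λ a → shannon switchedᶠ λ t → leaf p (label (True a) (True t))

    Ψ-correct : ∀ N p → (N ⊩ Ψ p [ parameters ]) ⇔ valuation (state N) p
    Ψ-correct N p = ⇔-trans (shannon-correct N pushedᶠ _) (⇔-trans (shannon-correct N switchedᶠ _)
      (leaf-correct N p (state N)))

    pushed-bits : ∀ N i → True (bits N pushedᶠ) i ⇔ Pushed N i
    pushed-bits N i = ⇔-trans (True-bits N pushedᶠ i) (pushedᶠ-correct N i)

    switched-bits : ∀ N i → True (bits N switchedᶠ) i ⇔ Switched N i
    switched-bits N i = ⇔-trans (True-bits N switchedᶠ i) (switchedᶠ-correct N i)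

    state-mono : ∀ {M N} → M 𝓡 N → state M ≼ state N
    state-mono {M} {N} r = label-mono _ _ λ i p →
      from (pushed-bits N i) (pushed-mono {M} {N} r i (to (pushed-bits M i) p))

    -- The back condition of the bisimulation. The pushed button moves the base into the cluster of
    -- `u`, and the new switch selects `u` itself within that cluster.
    state-push : ∀ {N} (above : Above N) {u} → state N ≼ u → state (Push.world N above u) ≡ u
    state-push {N} above {u} = label-push
      (λ v → ⇔-trans (pushed-bits P v) (⇔-trans (Push.pushed N above u v) (mk⇔
        (map-⊎ (from (pushed-bits N v)) (λ e → e)) (map-⊎ (to (pushed-bits N v)) (λ e → e)))))
      (λ v → ⇔-trans (switched-bits P v) (Push.switched N above u v))
      where
      P : World
      P = Push.world N above u

    truth-transfer : ∀ φ N → Above N → (N ⊩ substitute φ Ψ [ parameters ]) ⇔ Sat (state N) φ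
    truth-transfer (var p)  N ab = Ψ-correct N p
    truth-transfer (¬ᵐ φ)   N ab = mk⇔ (_∘ from (truth-transfer φ N ab)) (_∘ to (truth-transfer φ N ab))
    truth-transfer (φ ∧ᵐ ψ) N ab = mk⇔
      (λ (p , q) → to (truth-transfer φ N ab) p , to (truth-transfer ψ N ab) q)
      (λ (p , q) → from (truth-transfer φ N ab) p , from (truth-transfer ψ N ab) q)
    truth-transfer (φ ∨ᵐ ψ) N ab = mk⇔
      (map-⊎ (to (truth-transfer φ N ab)) (to (truth-transfer ψ N ab)))
      (map-⊎ (from (truth-transfer φ N ab)) (from (truth-transfer ψ N ab)))
    truth-transfer (φ ⇒ᵐ ψ) N ab = mk⇔
      (λ f → to (truth-transfer ψ N ab) ∘ f ∘ from (truth-transfer φ N ab))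
      (λ f → from (truth-transfer ψ N ab) ∘ f ∘ to (truth-transfer φ N ab))
    truth-transfer (◇ᵐ φ)   N ab = mk⇔
      (λ (P , r , p) → state P , state-mono {N} {P} r ,
        to (truth-transfer φ P (λ z m → proj₁ r z (ab z m))) p)
      (λ (u , le , s) → let open Push N ab u in world , accessible ,
        from (truth-transfer φ world (λ z m → proj₁ accessible z (ab z m)))
          (subst (λ w → Sat w φ) (sym (state-push {N} ab le)) s))
    truth-transfer (□ᵐ φ)   N ab = mk⇔
      (λ f u le → let open Push N ab u in subst (λ w → Sat w φ) (state-push {N} ab le)
        (to (truth-transfer φ world (λ z m → proj₁ accessible z (ab z m))) (f world accessible)))
      (λ f P r → from (truth-transfer φ P (λ z m → proj₁ r z (ab z m))) (f (state P) (state-mono {N} {P} r)))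

    initial : World
    initial = record
      { set = mark (suc size) ; transitive = mark-transitive (suc size) ; δ∈set = mark-∈ {0} {suc size} (s≤s z≤n) }

    -- An element `x` of the initial world is `high` or belongs to it, so every element `y` of `x`
    -- lies in `high`. A token requires `high ∈ y`, which would close a membership cycle.
    initial-unpushed : ∀ i → ¬ Pushed initial i
    initial-unpushed i (x , p , y , y∈x , _ , high∈y , _) with ∈-succ⁻ p
    ... | inj₁ q    = ∈-asym high∈y (mark-transitive size x q y y∈x)
    ... | inj₂ refl = ∈-asym high∈y y∈x

    state-initial : state initial ≡ root
    state-initial = label-nothing
      (λ i p → initial-unpushed i (to (pushed-bits initial i) p))
      (λ i p → let x , m , t , _ = to (switched-bits initial i) p in initial-unpushed i (x , m , t))

    valid⇒satisfied : ∀ φ → Valid φ → Sat root φ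
    valid⇒satisfied φ v = subst (λ w → Sat w φ) state-initial
      (to (truth-transfer φ initial (λ z m → m))
        (v initial Ψ parameters (∈-succ-self ∷ tabulate⁺ λ i → ∈-succ (mark-∈ (toℕ<n i)))))

theorem3p13 : ExcludedMiddle 0ℓ → (𝓥 : ZFModel) (δ : ZFModel.U 𝓥) → SetTheory.Berkeley 𝓥 δ →
    ∀ (φ : ModalFormula) → SetTheory.Potentialism.Valid 𝓥 δ φ ⇔ S4·2 φ
theorem3p13 em 𝓥 δ berkeley φ = mk⇔ complete (Accessibility.soundness δ)
  where
  open SetModel 𝓥 em
  complete : SetTheory.Potentialism.Valid 𝓥 δ φ → S4·2 φ
  complete valid = decidable-stable em λ unprovable →
    let 𝓕 , refuted = Completeness.countermodel em φ unprovable
    -- The projections lead from cardinal to ordinal to the transitivity of `δ`, which makes the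
    -- initial world, a finite successor of `δ`, transitive.
    in refuted (Refutation.valid⇒satisfied δ (proj₁ (proj₁ (proj₁ berkeley))) 𝓕 φ valid)
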